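{- Let $G$ be a connected graph with maximum degree $\Delta(G)\le 3$ that is not the Petersen graph. Then $\chi_l(G^2)\le 8$.
   Context: All graphs are finite and simple. The square $G^2$ of a graph $G$ has vertex set $V(G)$, with two vertices adjacent if their distance in $G$ is at most $2$. A graph is $k$-choosable if it has a proper coloring $f$ with $f(v)\in L(v)$ for all $v$ whenever every vertex $v$ is given a list $L(v)$ of $k$ colors; $\chi_l(H)$ is the least $k$ such that $H$ is $k$-choosable. -}

module Defs where

open import Data.Nat using (ℕ; zero; suc; _≤_)
open import Data.Bool using (Bool; true; false; _∨_; _∧_)
open import Data.Fin using (Fin; zero; suc)
import Data.Bool.ListAction as BLA
open import Data.List using (List; length; filter)
open import Data.List.Base using (allFin)
open import Data.List.Membership.Propositional using (_∈_)
open import Data.List.Relation.Unary.Unique.Propositional using (Unique)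
open import Data.Product using (Σ; _×_; ∃; ∃-syntax; _,_)
open import Data.Sum using (_⊎_)
open import Relation.Binary.PropositionalEquality using (_≡_; _≢_)
open import Relation.Nullary using (¬_)
open import Function.Bundles using (_⤖_; Bijection)

record Graph (n : ℕ) : Set where
  field
    adj   : Fin n → Fin n → Bool
    sym   : ∀ u v → adj u v ≡ adj v u
    irrefl : ∀ v → adj v v ≡ false
open Graph public

Adj : ∀ {n} → Graph n → Fin n → Fin n → Set
Adj G u v = adj G u v ≡ true

degree : ∀ {n} → Graph n → Fin n → ℕ
degree {n} G v = length (filter (λ u → Data.Bool._≟_ (adj G v u) true) (allFin n))

MaxDegreeAtMost : ∀ {n} → Graph n → ℕ → Set
MaxDegreeAtMost G d = ∀ v → degree G v ≤ d

data Walk {n} (G : Graph n) : Fin n → Fin n → Set where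
  here : ∀ {v} → Walk G v v
  step : ∀ {u w v} → Adj G u w → Walk G w v → Walk G u v

-- connected: every two vertices are joined by a walk
-- (the graph on 0 vertices counts as connected vacuously)
Connected : ∀ {n} → Graph n → Set
Connected G = ∀ u v → Walk G u v

Adj² : ∀ {n} → Graph n → Fin n → Fin n → Set
Adj² G u v = u ≢ v × (Adj G u v ⊎ ∃[ w ] (Adj G u w × Adj G w v))

Isomorphic : ∀ {m n} → Graph m → Graph n → Set
Isomorphic {m} {n} G H =
  Σ (Fin m ⤖ Fin n) λ φ → ∀ u v → adj G u v ≡ adj H (Bijection.to φ u) (Bijection.to φ v)

-- Petersen graph: vertices 0..4 outer 5-cycle, 5..9 inner pentagram, i ~ i+5.
petersenAdj : Fin 10 → Fin 10 → Bool
petersenAdj u v = BLA.any (λ e → eq e) edges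
  where
  open import Data.Fin using (toℕ)
  open import Data.Nat using (_≡ᵇ_)
  edges : List (ℕ × ℕ)
  edges = (0 , 1) Data.List.∷ (1 , 2) Data.List.∷ (2 , 3) Data.List.∷ (3 , 4) Data.List.∷ (4 , 0)
    Data.List.∷ (5 , 7) Data.List.∷ (7 , 9) Data.List.∷ (9 , 6) Data.List.∷ (6 , 8) Data.List.∷ (8 , 5)
    Data.List.∷ (0 , 5) Data.List.∷ (1 , 6) Data.List.∷ (2 , 7) Data.List.∷ (3 , 8) Data.List.∷ (4 , 9)
    Data.List.∷ Data.List.[]
  eq : ℕ × ℕ → Bool
  eq (a , b) = ((toℕ u ≡ᵇ a) ∧ (toℕ v ≡ᵇ b)) ∨ ((toℕ u ≡ᵇ b) ∧ (toℕ v ≡ᵇ a))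

Petersen : Graph 10
Petersen = record { adj = petersenAdj ; sym = symP ; irrefl = irrP }
  where
  open import Relation.Binary.PropositionalEquality using (refl)
  all10 : (P : Fin 10 → Set) → P zero → P (suc zero) → P (suc (suc zero))
        → P (suc (suc (suc zero))) → P (suc (suc (suc (suc zero))))
        → P (suc (suc (suc (suc (suc zero))))) → P (suc (suc (suc (suc (suc (suc zero))))))
        → P (suc (suc (suc (suc (suc (suc (suc zero)))))))
        → P (suc (suc (suc (suc (suc (suc (suc (suc zero))))))))
        → P (suc (suc (suc (suc (suc (suc (suc (suc (suc zero)))))))))
        → ∀ v → P v
  all10 P p0 p1 p2 p3 p4 p5 p6 p7 p8 p9 zero = p0
  all10 P p0 p1 p2 p3 p4 p5 p6 p7 p8 p9 (suc zero) = p1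
  all10 P p0 p1 p2 p3 p4 p5 p6 p7 p8 p9 (suc (suc zero)) = p2
  all10 P p0 p1 p2 p3 p4 p5 p6 p7 p8 p9 (suc (suc (suc zero))) = p3
  all10 P p0 p1 p2 p3 p4 p5 p6 p7 p8 p9 (suc (suc (suc (suc zero)))) = p4
  all10 P p0 p1 p2 p3 p4 p5 p6 p7 p8 p9 (suc (suc (suc (suc (suc zero))))) = p5
  all10 P p0 p1 p2 p3 p4 p5 p6 p7 p8 p9 (suc (suc (suc (suc (suc (suc zero)))))) = p6
  all10 P p0 p1 p2 p3 p4 p5 p6 p7 p8 p9 (suc (suc (suc (suc (suc (suc (suc zero))))))) = p7
  all10 P p0 p1 p2 p3 p4 p5 p6 p7 p8 p9 (suc (suc (suc (suc (suc (suc (suc (suc zero)))))))) = p8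
  all10 P p0 p1 p2 p3 p4 p5 p6 p7 p8 p9 (suc (suc (suc (suc (suc (suc (suc (suc (suc zero))))))))) = p9
  symP : ∀ u v → petersenAdj u v ≡ petersenAdj v u
  symP = all10 _ (all10 _ refl refl refl refl refl refl refl refl refl refl)
                 (all10 _ refl refl refl refl refl refl refl refl refl refl)
                 (all10 _ refl refl refl refl refl refl refl refl refl refl)
                 (all10 _ refl refl refl refl refl refl refl refl refl refl)
                 (all10 _ refl refl refl refl refl refl refl refl refl refl)
                 (all10 _ refl refl refl refl refl refl refl refl refl refl)
                 (all10 _ refl refl refl refl refl refl refl refl refl refl)
                 (all10 _ refl refl refl refl refl refl refl refl refl refl)
                 (all10 _ refl refl refl refl refl refl refl refl refl refl)
                 (all10 _ refl refl refl refl refl refl refl refl refl refl)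
  irrP : ∀ v → petersenAdj v v ≡ false
  irrP = all10 _ refl refl refl refl refl refl refl refl refl refl

ListAssignment : ℕ → ℕ → Set
ListAssignment n k = Σ (Fin n → List ℕ) λ L → ∀ v → Unique (L v) × length (L v) ≡ k

ProperL²Colouring : ∀ {n} → Graph n → (Fin n → List ℕ) → (Fin n → ℕ) → Set
ProperL²Colouring G L f = (∀ v → f v ∈ L v) × (∀ u v → Adj² G u v → f u ≢ f v)

Square-Choosable : ∀ {n} → Graph n → ℕ → Set
Square-Choosable {n} G k = (L : ListAssignment n k) →
  ∃[ f ] ProperL²Colouring G (Data.Product.proj₁ L) f

{-# OPTIONS --safe #-}
module Submission where

-- Colour greedily: a vertex with two uncoloured neighbours in G² left always has a free colour, since degrees in
-- G² are at most 9. So the colouring can be completed as soon as two adjacent vertices x, y remain at the end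
-- and their lists have been "spared" once and twice more than expected. A vertex z is spared when two neighbours
-- of z in G² that are not adjacent in G² together have more colours than z: they can be coloured so that z loses
-- at most one colour.
--
-- A vertex of degree at most 2 and a neighbour of it are spared enough from the start. In the cubic case, short
-- cycles and theta graphs formed by two short cycles are handled by explicit sequences of such pairs, with a
-- case distinction that ends at the Petersen graph. Otherwise take a shortest cycle, of length at least 5, and
-- let uᵢ be the neighbour of its i-th vertex vᵢ off the cycle; there are no short connections between the uᵢ.
-- After everything else is coloured, uᵢ has at least 2 colours and vᵢ at least 6. Either four consecutive uᵢ and
-- one vⱼ next to them can be coloured so that two adjacent vertices of the cycle are spared three times in
-- total, or the lists of uᵢ₋₁, uᵢ, uᵢ₊₁ are disjoint subsets of the list of vᵢ for every i; in the latter case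
-- vᵢ takes a colour from the list of uᵢ.

open import Defs hiding (sym)
import Data.Bool as Bool
open import Data.Bool using (Bool; false; true)
open import Data.Bool.Properties using (¬-not)
open import Data.Empty using (⊥; ⊥-elim)
import Data.Fin as Fin
open import Data.Fin using (Fin; fromℕ<; toℕ)
import Data.Fin.Properties as Fin
open import Data.List
  using (List; []; _++_; _∷_; allFin; concatMap; deduplicate; filter; length; map; take; upTo)
open import Data.List.Membership.Propositional using (_∈_; _∉_; find; lose)
open import Data.List.Membership.Propositional.Properties
open import Data.List.Properties
  using (filter-accept; filter-notAll; filter-reject; length-++; length-map; length-take)
import Data.List.Relation.Unary.All as All
open import Data.List.Relation.Unary.All using (All; []; _∷_)
import Data.List.Relation.Unary.All.Properties as All
open import Data.List.Relation.Unary.AllPairs using ([]; _∷_)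
import Data.List.Relation.Unary.Any as Any
open import Data.List.Relation.Unary.Any using (Any; here; there)
import Data.List.Relation.Unary.Any.Properties as Any
import Data.List.Relation.Unary.Unique.DecPropositional as UniqueDec?
open import Data.List.Relation.Unary.Unique.Propositional using (Unique)
import Data.List.Relation.Unary.Unique.Propositional.Properties as Unique
open import Data.Maybe using (Maybe; just; nothing)
import Data.Maybe.Properties as Maybe
open import Data.Nat using (_*_; _+_; _<?_; _<_; _∸_; _≤?_; _≤_; suc; s≤s; zero; z≤n; ℕ)
open import Data.Nat.DivMod using (_%_; _/_; m%n<n; m≡m%n+[m/n]*n)
open import Data.Nat.Induction using (<-rec)
open import Data.Nat.ListAction using (sum)
open import Data.Nat.Properties
open import Data.Product using (_,_; _×_; proj₁; proj₂; ∃-syntax; ∃₂)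
import Data.Product.Properties as Product
open import Data.Sum using ([_,_]′; _⊎_; inj₁; inj₂)
open import Data.Unit using (tt; ⊤)
open import Function using (_∘_; case_of_; id)
open import Function.Bundles using (mk⤖)
open import Relation.Binary.Definitions using (DecidableEquality; Tri; tri<; tri>; tri≈)
open import Relation.Binary.PropositionalEquality
  using (_≡_; _≢_; cong; cong₂; refl; subst; subst₂; sym; trans)
open import Relation.Nullary using (Dec; does; no; yes; ¬_)
open import Relation.Nullary.Decidable
  using (True; _×-dec_; _→-dec_; _⊎-dec_; decidable-stable; map′; toWitness; ¬?)
open import Relation.Nullary.Negation using (contradiction)

-- Slack is counted so that nine square-neighbours against eight colours give 0. A vertex can be
-- coloured when its slack plus the number of its later neighbours is at least two, so the last two
-- vertices need slacks 1 and 2: three sparings. On a long cycle the pendant vertices have only two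
-- colours each, and pairs of them may fail to spare enough. The obstruction is the pattern of
-- disjoint pendant lists inside the list of the vertex between them, and this pattern is what the
-- other colouring exploits: when each cycle vertex takes a colour of its own pendant, a pendant
-- loses one colour to three neighbours. Theta graphs enter because two pendants at distance one or
-- two form an ear of length three or four on the cycle. For feet at most three steps apart, the ear
-- gives a shorter cycle unless the cycle has length at most seven, and the exceptions are a few
-- theta graphs. The shortest cycle is studied under the assumption that no colouring exists. This
-- proves only a double negation, which is removed because the existence of a colouring can be
-- decided by a finite search.

infix 4 _⊑_
_⊑_ : ∀ {A : Set} → List A → List A → Set
xs ⊑ ys = ∀ {x} → x ∈ xs → x ∈ ys

unique-⊑-length : ∀ {A : Set} {xs ys : List A} → Unique xs → xs ⊑ ys → length xs ≤ length ys
unique-⊑-length {xs = []} _ _ = z≤n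
unique-⊑-length {xs = x ∷ xs} {ys} (x∉ ∷ u) sub with ∈-∃++ (sub (here refl))
... | as , bs , refl = begin
    suc (length xs)               ≤⟨ s≤s (unique-⊑-length u rest) ⟩
    suc (length (as ++ bs))       ≡⟨ cong suc (length-++ as) ⟩
    suc (length as + length bs)   ≡⟨ +-suc (length as) (length bs) ⟨
    length as + suc (length bs)   ≡⟨ length-++ as ⟨
    length (as ++ x ∷ bs)         ∎
  where
  open ≤-Reasoning
  rest : xs ⊑ as ++ bs
  rest {y} y∈ with ∈-++⁻ as (sub (there y∈))
  ... | inj₁ p = ∈-++⁺ˡ p
  ... | inj₂ (here refl) = contradiction refl (All.lookup x∉ y∈)
  ... | inj₂ (there p) = ∈-++⁺ʳ as p

module _ {A : Set} (_≟_ : DecidableEquality A) where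
  open import Data.List.Membership.DecPropositional _≟_ using (_∈?_)

  exists-outside : ∀ {xs} (ys : List A) → Unique xs → length ys < length xs → ∃[ x ] x ∈ xs × x ∉ ys
  exists-outside {xs} ys u lt with Any.any? (λ x → ¬? (x ∈? ys)) xs
  ... | yes p = let (x , x∈ , q) = find p in x , x∈ , q
  ... | no np = contradiction (unique-⊑-length u sub) (<⇒≱ lt)
    where
    sub : xs ⊑ ys
    sub {x} x∈ with x ∈? ys
    ... | yes p = p
    ... | no q = contradiction (Any.map (λ { refl → q }) x∈) np

_∈ℕ?_ : (x : ℕ) (xs : List ℕ) → Dec (x ∈ xs)
_∈ℕ?_ = _∈?_ where open import Data.List.Membership.DecPropositional _≟_

∃∈? : ∀ {P : ℕ → Set} → (∀ x → Dec (P x)) → ∀ xs → Dec (∃[ x ] x ∈ xs × P x)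
∃∈? P? xs = map′ find (λ (_ , i , p) → lose i p) (Any.any? P? xs)

All-≢⁺ : ∀ {A : Set} {x : A} {xs} → x ∉ xs → All (x ≢_) xs
All-≢⁺ {xs = []} _ = []
All-≢⁺ {xs = y ∷ ys} n = (λ e → n (here e)) ∷ All-≢⁺ (n ∘ there)

All-≢⁻ : ∀ {A : Set} {x : A} {xs} → All (x ≢_) xs → x ∉ xs
All-≢⁻ ps x∈ = All.lookup ps x∈ refl

map-unique : ∀ {A B : Set} (f : A → B) {xs} → Unique xs → (∀ {x y} → x ∈ xs → y ∈ xs → f x ≡ f y → x ≡ y) →
             Unique (map f xs)
map-unique f [] _ = []
map-unique f (x∉ ∷ u) inj =
  All.map⁺ (All.tabulate λ y∈ e → All.lookup x∉ y∈ (inj (here refl) (there y∈) e)) ∷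
  map-unique f u (λ i j → inj (there i) (there j))

take-⊑ : ∀ {A : Set} i {xs : List A} → take i xs ⊑ xs
take-⊑ (suc i) {x ∷ xs} (here e) = here e
take-⊑ (suc i) {x ∷ xs} (there j) = there (take-⊑ i j)

-- Partial list colourings of the square, slack and greedy completion

module Colour {n} (G : Graph n) (L : Fin n → List ℕ) (uL : ∀ v → Unique (L v)) where

  V : Set
  V = Fin n

  open import Data.List.Membership.DecPropositional (Fin._≟_ {n}) using () renaming (_∈?_ to _∈V?_) public

  Adj? : ∀ u v → Dec (Adj G u v)
  Adj? u v = adj G u v Bool.≟ true

  Adj²? : ∀ u v → Dec (Adj² G u v)
  Adj²? u v = ¬? (u Fin.≟ v) ×-dec (Adj? u v ⊎-dec Fin.any? (λ w → Adj? u w ×-dec Adj? w v))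

  Adj-sym : ∀ {u v} → Adj G u v → Adj G v u
  Adj-sym {u} {v} a = trans (Graph.sym G v u) a

  Adj-≢ : ∀ {u v} → Adj G u v → u ≢ v
  Adj-≢ {u} a refl = case trans (sym a) (irrefl G u) of λ ()

  Adj²-sym : ∀ {u v} → Adj² G u v → Adj² G v u
  Adj²-sym (ne , inj₁ a) = (ne ∘ sym) , inj₁ (Adj-sym a)
  Adj²-sym (ne , inj₂ (w , a , b)) = (ne ∘ sym) , inj₂ (w , Adj-sym b , Adj-sym a)

  adj₁ : ∀ {u v} → Adj G u v → Adj² G u v
  adj₁ a = Adj-≢ a , inj₁ a

  adj₂ : ∀ {u v w} → u ≢ v → Adj G u w → Adj G w v → Adj² G u v
  adj₂ ne a b = ne , inj₂ (_ , a , b)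

  PC : Set
  PC = V → Maybe ℕ

  Unc : PC → V → Set
  Unc c v = c v ≡ nothing

  _≟M_ : DecidableEquality (Maybe ℕ)
  _≟M_ = Maybe.≡-dec _≟_

  Unc? : ∀ c v → Dec (Unc c v)
  Unc? c v = c v ≟M nothing

  Proper : PC → Set
  Proper c = (∀ {v p} → c v ≡ just p → p ∈ L v) ×
             (∀ {u v p} → Adj² G u v → c u ≡ just p → c v ≡ just p → ⊥)

  Clash : PC → V → ℕ → Set
  Clash c v p = ∃[ t ] Adj² G v t × c t ≡ just p

  Clash? : ∀ c v p → Dec (Clash c v p)
  Clash? c v p = Fin.any? λ t → Adj²? v t ×-dec (c t ≟M just p)

  avail : PC → V → List ℕ
  avail c v = filter (λ p → ¬? (Clash? c v p)) (L v)

  unc : PC → V → List V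
  unc c v = filter (λ t → Adj²? v t ×-dec Unc? c t) (allFin n)

  unc⁺ : ∀ c v {t} → Adj² G v t → Unc c t → t ∈ unc c v
  unc⁺ c v a u = ∈-filter⁺ (λ t → Adj²? v t ×-dec Unc? c t) (∈-allFin _) (a , u)

  unc⁻ : ∀ c v {t} → t ∈ unc c v → Adj² G v t × Unc c t
  unc⁻ c v t∈ = proj₂ (∈-filter⁻ (λ t → Adj²? v t ×-dec Unc? c t) {xs = allFin n} t∈)

  unc-unique : ∀ c v → Unique (unc c v)
  unc-unique c v = Unique.filter⁺ _ (Unique.allFin⁺ n)

  avail⁺ : ∀ c v {p} → p ∈ L v → ¬ Clash c v p → p ∈ avail c v
  avail⁺ c v p∈ np = ∈-filter⁺ (λ p → ¬? (Clash? c v p)) p∈ np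

  avail⁻ : ∀ c v {p} → p ∈ avail c v → p ∈ L v × ¬ Clash c v p
  avail⁻ c v p∈ = ∈-filter⁻ (λ p → ¬? (Clash? c v p)) {xs = L v} p∈

  -- S c z m says that z has at least (number of uncoloured square-neighbours) + m − 1 available colours.
  record S (c : PC) (z : V) (m : ℕ) : Set where
    constructor mkS
    field bound : length (unc c z) + m ≤ suc (length (avail c z))

  unc-lower : ∀ {c z ns} → Unique ns → (∀ {t} → t ∈ ns → Adj² G z t × Unc c t) →
              length ns ≤ length (unc c z)
  unc-lower {c} {z} u f = unique-⊑-length u λ t∈ → let (a , b) = f t∈ in unc⁺ c z a b

  unc-upper : ∀ {c z} ns → (∀ {t} → Adj² G z t → Unc c t → t ∈ ns) → length (unc c z) ≤ length ns
  unc-upper {c} {z} ns f = unique-⊑-length (unc-unique c z) λ t∈ → let (a , b) = unc⁻ c z t∈ in f a b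

  avail-unique : ∀ c v → Unique (avail c v)
  avail-unique c v = Unique.filter⁺ _ (uL v)

  Assignment : Set
  Assignment = List (V × ℕ)

  dom : Assignment → List V
  dom = map proj₁

  upd : PC → Assignment → PC
  upd c [] t = c t
  upd c ((v , p) ∷ as) t with v Fin.≟ t
  ... | yes _ = just p
  ... | no _ = upd c as t

  upd-just : ∀ c as {t p} → upd c as t ≡ just p → (t , p) ∈ as ⊎ (c t ≡ just p × t ∉ dom as)
  upd-just c [] e = inj₂ (e , λ ())
  upd-just c ((v , q) ∷ as) {t} e with v Fin.≟ t
  upd-just c ((v , q) ∷ as) refl | yes refl = inj₁ (here refl)
  ... | no ne with upd-just c as e
  ...   | inj₁ i = inj₁ (there i)
  ...   | inj₂ (e' , n∉) = inj₂ (e' , λ { (here r) → ne (sym r) ; (there r) → n∉ r })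

  upd-none : ∀ c as {t} → Unc (upd c as) t → Unc c t × t ∉ dom as
  upd-none c [] e = e , λ ()
  upd-none c ((v , q) ∷ as) {t} e with v Fin.≟ t
  ... | yes _ = case e of λ ()
  ... | no ne = let (a , b) = upd-none c as e in a , λ { (here r) → ne (sym r) ; (there r) → b r }

  upd-unc : ∀ c as {t} → Unc c t → t ∉ dom as → Unc (upd c as) t
  upd-unc c [] u _ = u
  upd-unc c ((v , q) ∷ as) {t} u n∉ with v Fin.≟ t
  ... | yes refl = contradiction (here refl) n∉
  ... | no _ = upd-unc c as u (n∉ ∘ there)

  -- A batch of colours given at once. All are available before the batch, so only clashes inside
  -- the batch remain to be excluded. Vertices not adjacent in G² may share a colour, which is one
  -- of the ways to spare a common neighbour.
  data Asg (c : PC) : Assignment → Set where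
    []  : Asg c []
    _∷_ : ∀ {v p as} → Unc c v × v ∉ dom as × p ∈ avail c v × (∀ {w q} → (w , q) ∈ as → Adj² G v w → p ≢ q) →
          Asg c as → Asg c ((v , p) ∷ as)

  asg-avail : ∀ {c as v p} → Asg c as → (v , p) ∈ as → p ∈ avail c v
  asg-avail ((_ , _ , a , _) ∷ _) (here refl) = a
  asg-avail (_ ∷ as) (there i) = asg-avail as i

  asg-compat : ∀ {c as u v p} → Asg c as → (u , p) ∈ as → (v , p) ∈ as → ¬ Adj² G u v
  asg-compat (_ ∷ _) (here refl) (here refl) (ne , _) = ne refl
  asg-compat ((_ , _ , _ , f) ∷ _) (here refl) (there j) a = f j a refl
  asg-compat ((_ , _ , _ , f) ∷ _) (there i) (here refl) a = f i (Adj²-sym a) refl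
  asg-compat (_ ∷ as) (there i) (there j) a = asg-compat as i j a

  upd-proper : ∀ {c as} → Proper c → Asg c as → Proper (upd c as)
  upd-proper {c} {as} (pl , pp) A = f , g
    where
    f : ∀ {v p} → upd c as v ≡ just p → p ∈ L v
    f {v} e with upd-just c as e
    ... | inj₁ i = proj₁ (avail⁻ c v (asg-avail A i))
    ... | inj₂ (e' , _) = pl e'
    g : ∀ {u v p} → Adj² G u v → upd c as u ≡ just p → upd c as v ≡ just p → ⊥
    g {u} {v} a e₁ e₂ with upd-just c as e₁ | upd-just c as e₂
    ... | inj₁ i | inj₁ j = asg-compat A i j a
    ... | inj₁ i | inj₂ (e , _) = proj₂ (avail⁻ c u (asg-avail A i)) (v , a , e)
    ... | inj₂ (e , _) | inj₁ j = proj₂ (avail⁻ c v (asg-avail A j)) (u , Adj²-sym a , e)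
    ... | inj₂ (e , _) | inj₂ (e' , _) = pp a e e'

  upd-avail : ∀ {c as z A} ys → Unique A → A ⊑ avail c z →
    (∀ {v p} → p ∈ A → (v , p) ∈ as → Adj² G z v → p ∈ ys) →
    length A ≤ length (avail (upd c as) z) + length ys
  upd-avail {c} {as} {z} {A} ys u sub hit = ≤-trans (unique-⊑-length u cover) (≤-reflexive (length-++ (avail c' z)))
    where
    c' = upd c as
    cover : A ⊑ avail c' z ++ ys
    cover {p} p∈ with p ∈ℕ? ys
    ... | yes q = ∈-++⁺ʳ _ q
    ... | no q = ∈-++⁺ˡ (avail⁺ c' z (proj₁ (avail⁻ c z (sub p∈))) clash)
      where
      clash : ¬ Clash c' z p
      clash (t , a , e) with upd-just c as e
      ... | inj₁ i = q (hit p∈ i a)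
      ... | inj₂ (e' , _) = proj₂ (avail⁻ c z (sub p∈)) (t , a , e')

  upd-count : ∀ {c as z} xs → Unique xs → (∀ {t} → t ∈ xs → t ∈ dom as × Unc c t × Adj² G z t) →
    length (unc (upd c as) z) + length xs ≤ length (unc c z)
  upd-count {c} {as} {z} xs u f = ≤-trans (≤-reflexive (sym (length-++ (unc c' z)))) (unique-⊑-length uu sub)
    where
    c' = upd c as
    uu : Unique (unc c' z ++ xs)
    uu = Unique.++⁺ (unc-unique c' z) u λ (i , j) → proj₂ (upd-none c as (proj₂ (unc⁻ c' z i))) (proj₁ (f j))
    sub : unc c' z ++ xs ⊑ unc c z
    sub t∈ with ∈-++⁻ (unc c' z) t∈
    ... | inj₁ i = let (a , b) = unc⁻ c' z i in unc⁺ c z a (proj₁ (upd-none c as b))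
    ... | inj₂ j = let (_ , b , a) = f j in unc⁺ c z a b

  -- Colouring the square-neighbours `xs` lowers the demand by their number, while only the colours
  -- `ys` are lost. A vertex is spared when `ys` is shorter than `xs`. Losses are counted inside
  -- `A`, so that the list of `z` can first be cut down to a convenient size.
  upd-S : ∀ c as {z A m} (xs : List V) (ys : List ℕ) → Unique A → A ⊑ avail c z →
    (∀ {v p} → p ∈ A → (v , p) ∈ as → Adj² G z v → p ∈ ys) →
    Unique xs → (∀ {t} → t ∈ xs → t ∈ dom as × Unc c t × Adj² G z t) →
    length (unc c z) + m + length ys ≤ suc (length A) + length xs →
    S (upd c as) z m
  upd-S c as {z} {A} {m} xs ys uA sub hit ux f le = mkS (+-cancelʳ-≤ (k + y) _ _ (begin
      u' + m + (k + y)        ≡⟨ +-assoc (u' + m) k y ⟨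
      u' + m + k + y          ≡⟨ cong (_+ y) (trans (+-assoc u' m k) (trans (cong (u' +_) (+-comm m k)) (sym (+-assoc u' k m)))) ⟩
      u' + k + m + y          ≤⟨ +-monoˡ-≤ y (+-monoˡ-≤ m (upd-count xs ux f)) ⟩
      length (unc c z) + m + y ≤⟨ le ⟩
      suc (length A) + k      ≤⟨ +-monoˡ-≤ k (s≤s (upd-avail ys uA sub hit)) ⟩
      suc (a' + y) + k        ≡⟨ cong suc (trans (+-assoc a' y k) (cong (a' +_) (+-comm y k))) ⟩
      suc (a' + (k + y))      ∎))
    where
    open ≤-Reasoning
    k = length xs
    y = length ys
    u' = length (unc (upd c as) z)
    a' = length (avail (upd c as) z)

  -- A coloured square-neighbour takes away one uncoloured neighbour and at most one colour, so
  -- slack never drops.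
  S-mono₁ : ∀ {c w p z m} → Unc c w → S c z m → S (upd c ((w , p) ∷ [])) z m
  S-mono₁ {c} {w} {p} {z} {m} uw (mkS s) with Adj²? z w
  ... | yes a = upd-S c ((w , p) ∷ []) (w ∷ []) (p ∷ []) (avail-unique c z) id
          (λ { _ (here refl) _ → here refl }) ([] ∷ []) (λ { (here refl) → here refl , uw , a })
          (+-monoˡ-≤ 1 s)
  ... | no na = upd-S c ((w , p) ∷ []) [] [] (avail-unique c z) id
          (λ { _ (here refl) a → contradiction a na }) [] (λ ())
          (+-monoˡ-≤ 0 s)

  S-mono : ∀ {c as z m} → Asg c as → S c z m → S (upd c as) z m
  S-mono {c} {as} {z} (A) (mkS s) = upd-S c as (dom bs) (map proj₂ bs) (avail-unique c z) id
      (λ _ i a → ∈-map⁺ proj₂ (∈-filter⁺ (λ b → Adj²? z (proj₁ b)) i a))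
      (filter-dom A) (λ t∈ → let (b , b∈ , e) = ∈-map⁻ proj₁ t∈ ; (i , a) = ∈-filter⁻ (λ b → Adj²? z (proj₁ b)) {xs = as} b∈ in
        subst (λ t → t ∈ dom as × Unc c t × Adj² G z t) (sym e) (∈-map⁺ proj₁ i , asg-unc A i , a))
      (+-mono-≤ s (≤-reflexive (trans (length-map proj₂ bs) (sym (length-map proj₁ bs)))))
    where
    bs = filter (λ b → Adj²? z (proj₁ b)) as
    asg-unc : ∀ {as v p} → Asg c as → (v , p) ∈ as → Unc c v
    asg-unc ((u , _) ∷ _) (here refl) = u
    asg-unc (_ ∷ A) (there i) = asg-unc A i
    filter-dom : ∀ {as} → Asg c as → Unique (dom (filter (λ b → Adj²? z (proj₁ b)) as))
    filter-dom [] = []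
    filter-dom {(v , p) ∷ as} ((_ , v∉ , _) ∷ A) with Adj²? z v
    ... | no n rewrite filter-reject (λ b → Adj²? z (proj₁ b)) {x = v , p} {xs = as} n = filter-dom A
    ... | yes a rewrite filter-accept (λ b → Adj²? z (proj₁ b)) {x = v , p} {xs = as} a = All-≢⁺ (λ i → let (b , b∈ , e) = ∈-map⁻ proj₁ i in
            v∉ (subst (_∈ dom as) (sym e) (∈-map⁺ proj₁ (proj₁ (∈-filter⁻ (λ b → Adj²? z (proj₁ b)) {xs = as} b∈))))) ∷ filter-dom A

  -- Every vertex of ws keeps enough square-neighbours that are coloured later (they lie in the
  -- rest of ws, or in the set R that stays uncoloured) to be coloured greedily.
  data Order (c : PC) (R : List V) : List V → Set where
    []   : Order c R []
    step : ∀ {w ws} m ns → Unc c w → w ∉ ws → w ∉ R → Unique ns →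
           (∀ {t} → t ∈ ns → Adj² G w t × Unc c t × (t ∈ ws ⊎ t ∈ R)) → S c w m → 2 ≤ length ns + m →
           Order c R ws → Order c R (w ∷ ws)

  order-step : ∀ {c R w p ws} → Unc c w → w ∉ ws → w ∉ R → Order c R ws →
               Order (upd c ((w , p) ∷ [])) R ws
  order-step _ _ _ [] = []
  order-step {c} {R} {w} {p} uw w∉ w∉R (step {w = z} {ws = zs} m ns uz z∉ z∉R un f s le o) =
    step m ns (upd-unc c ((w , p) ∷ []) uz λ { (here e) → w∉ (here (sym e)) }) z∉ z∉R un f' (S-mono₁ uw s) le
      (order-step uw (w∉ ∘ there) w∉R o)
    where
    f' : ∀ {t} → t ∈ ns → Adj² G z t × Unc (upd c ((w , p) ∷ [])) t × (t ∈ zs ⊎ t ∈ R)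
    f' {t} t∈ = let (a , b , r) = f t∈ in a , upd-unc c ((w , p) ∷ []) b (λ { (here refl) → [ w∉ ∘ there , w∉R ]′ r }) , r

  -- At least `length ns` neighbours are still uncoloured, so slack `m` leaves no fewer than
  -- `length ns + m` minus one colours, hence one.
  order-colour : ∀ {c w m} ns → Unique ns → (∀ {t} → t ∈ ns → Adj² G w t × Unc c t) → S c w m →
                 2 ≤ length ns + m → ∃[ p ] p ∈ avail c w
  order-colour {c} {w} {m} ns un f (mkS s) le with avail c w
  ... | p ∷ _ = p , here refl
  ... | [] = contradiction (≤-trans le (≤-trans (+-monoˡ-≤ m (unc-lower un f)) s)) λ { (s≤s ()) }

  -- The transfer of slack is part of the result, so that slack known before the greedy run can be
  -- used for the vertices left over.
  greedy : ∀ {c R ws} → Proper c → Order c R ws →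
    ∃[ c' ] Proper c' × (∀ {t} → Unc c' t → Unc c t × t ∉ ws) × (∀ {t} → Unc c t → t ∉ ws → Unc c' t) ×
            (∀ {z m} → S c z m → S c' z m)
  greedy {c} P [] = c , P , (λ u → u , λ ()) , (λ u _ → u) , id
  greedy {c} {R} P (step {w = w} {ws = ws} m ns uw w∉ w∉R un f s le o)
    with order-colour ns un (λ t∈ → let (a , b , _) = f t∈ in a , b) s le
  ... | p , p∈ with greedy (upd-proper P ((uw , (λ ()) , p∈ , λ ()) ∷ [])) (order-step {p = p} uw w∉ w∉R o)
  ...   | c' , P' , g , h , mono = c' , P' ,
            (λ {t} u → let (a , b) = g u ; (a' , b') = upd-none c ((w , p) ∷ []) a in
               a' , λ { (here e) → b' (here e) ; (there i) → b i }) ,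
            (λ u n → h (upd-unc c ((w , p) ∷ []) u (λ { (here e) → n (here e) })) (n ∘ there)) ,
            mono ∘ S-mono₁ uw

  Done : Set
  Done = ∃[ f ] ProperL²Colouring G L f

  complete : ∀ {c} → Proper c → (∀ t → ¬ Unc c t) → Done
  complete {c} (pl , pp) all = f , (λ v → pl (f-eq v)) , λ u v a e → pp a (f-eq u) (trans (f-eq v) (cong just (sym e)))
    where
    get : ∀ (x : Maybe ℕ) → x ≢ nothing → ∃[ p ] x ≡ just p
    get (just p) _ = p , refl
    get nothing n = contradiction refl n
    f : V → ℕ
    f v = proj₁ (get (c v) (all v))
    f-eq : ∀ v → c v ≡ just (f v)
    f-eq v = proj₂ (get (c v) (all v))

  finish : ∀ {c ws} → Proper c → Order c [] ws → (∀ {t} → Unc c t → t ∈ ws) → Done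
  finish P o all with greedy P o
  ... | c' , P' , g , _ , _ = complete P' λ t u → let (a , b) = g u in b (all a)

  -- Orders from connectedness, and the final two vertices

  data Path (P : V → Set) : V → V → Set where
    end  : ∀ {v} → P v → Path P v v
    edge : ∀ {u w v} → P u → Adj G u w → Path P w v → Path P u v

  -- An order of an arbitrary connected set, grown outwards from R: the new vertex w is adjacent to
  -- some t in the set grown so far, and t has a further neighbour in that set.
  module Grow (c : PC) (uncS : ∀ {w} → Unc c w → S c w 0) (R : List V) (uR : Unique R) (r₀ : V) (r₀∈ : r₀ ∈ R)
              (R-nb : ∀ {r} → r ∈ R → ∃[ r' ] r' ∈ R × Adj G r r')
              (R-unc : ∀ {r} → r ∈ R → Unc c r)
              (conn : ∀ {w} → Unc c w → Path (Unc c) w r₀) where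

    boundary : ∀ {P : V → Set} (T : List V) {x y} → Path P x y → x ∉ T → y ∈ T →
               ∃₂ λ w t → w ∉ T × t ∈ T × Adj G w t × P w
    boundary T (end _) n i = contradiction i n
    boundary T (edge {w = w} pu a p) n i with w ∈V? T
    ... | yes w∈ = _ , w , n , w∈ , a , pu
    ... | no w∉ = boundary T p w∉ i

    Nb : List V → Set
    Nb T = ∀ {t} → t ∈ T ++ R → ∃[ t' ] t' ∈ T ++ R × Adj G t t'

    -- `k` is fuel: `T ++ R` consists of at least `n` minus `k` distinct vertices, so when `k` is
    -- zero a further vertex `w` would bring their number above `n`.
    grow : ∀ k T → n ≤ k + length (T ++ R) → Unique (T ++ R) → Nb T → Order c R T →
           ∃[ T ] Order c R T × (∀ {w} → Unc c w → w ∈ T ++ R)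
    grow k T le uT nb o with Fin.any? (λ w → Unc? c w ×-dec ¬? (w ∈V? (T ++ R)))
    ... | no none = T , o , λ {w} u → dec w u
      where
      dec : ∀ w → Unc c w → w ∈ T ++ R
      dec w u with w ∈V? (T ++ R)
      ... | yes i = i
      ... | no i = contradiction (w , u , i) none
    ... | yes (x , ux , x∉) with boundary (T ++ R) (conn ux) x∉ (∈-++⁺ʳ T r₀∈)
    ...   | w , t , w∉ , t∈ , a , uw with nb t∈
    ...     | t' , t'∈ , a' = next k le
      where
      w≢t' : w ≢ t'
      w≢t' refl = w∉ t'∈
      uT' : Unique (w ∷ T ++ R)
      uT' = All-≢⁺ w∉ ∷ uT
      T-unc : ∀ {ws s} → Order c R ws → s ∈ ws → Unc c s
      T-unc (step _ _ u _ _ _ _ _ _ _) (here refl) = u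
      T-unc (step _ _ _ _ _ _ _ _ _ o) (there i) = T-unc o i
      unc∈ : ∀ {s} → s ∈ T ++ R → Unc c s × (s ∈ T ⊎ s ∈ R)
      unc∈ i with ∈-++⁻ T i
      ... | inj₁ j = T-unc o j , inj₁ j
      ... | inj₂ j = R-unc j , inj₂ j
      o' : Order c R (w ∷ T)
      -- `w` goes in front, so `t` and `t'` are still uncoloured when its turn comes, and slack 0
      -- suffices.
      o' = step 0 (t ∷ t' ∷ []) uw (w∉ ∘ ∈-++⁺ˡ) (w∉ ∘ ∈-++⁺ʳ T)
             ((Adj-≢ a' ∷ []) ∷ [] ∷ [])
             (λ { (here refl) → adj₁ a , unc∈ t∈ ; (there (here refl)) → adj₂ w≢t' a a' , unc∈ t'∈ })
             (uncS uw) ≤-refl o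
      nb' : Nb (w ∷ T)
      nb' (here refl) = t , there t∈ , a
      nb' (there i) = let (s , s∈ , b) = nb i in s , there s∈ , b
      next : ∀ k → n ≤ k + length (T ++ R) → ∃[ T ] Order c R T × (∀ {w} → Unc c w → w ∈ T ++ R)
      next zero le = contradiction
        (≤-trans (unique-⊑-length uT' (λ {x} _ → ∈-allFin x)) (≤-trans (≤-reflexive (length-tabulate id)) le)) (<-irrefl refl)
        where open import Data.List.Properties using (length-tabulate)
      next (suc k) le = grow k (w ∷ T) (≤-trans le (≤-reflexive (sym (+-suc k _)))) uT' nb' o'

    result : ∃[ T ] Order c R T × (∀ {w} → Unc c w → w ∈ T ++ R)
    result = grow n [] (m≤m+n n _) uR R-nb []

  -- When `x` is coloured, `y` is still uncoloured, so slack 1 is enough for `x`; `y` comes last,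
  -- without later neighbours, and needs 2. All other vertices are ordered towards this edge.
  endgame : ∀ {c x y} → Proper c → Adj G x y → Unc c x → Unc c y → S c x 1 → S c y 2 →
    (∀ {w} → Unc c w → S c w 0) → (∀ {w} → Unc c w → Path (Unc c) w x) → Done
  endgame {c} {x} {y} P a ux uy sx sy s conn with Grow.result c s (x ∷ y ∷ []) ((Adj-≢ a ∷ []) ∷ [] ∷ []) x (here refl)
      (λ { (here refl) → y , there (here refl) , a ; (there (here refl)) → x , here refl , Adj-sym a })
      (λ { (here refl) → ux ; (there (here refl)) → uy }) conn
  ... | T , o , all with greedy P o
  ...   | c′ , P′ , f , g , mono = finish P′
            (step 1 (y ∷ []) (g ux (x∉ o)) (λ { (here e) → Adj-≢ a e ; (there ()) }) (λ ()) ([] ∷ [])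
              (λ { (here refl) → adj₁ a , g uy (y∉ o) , inj₁ (here refl) }) (mono sx) ≤-refl
            (step 2 [] (g uy (y∉ o)) (λ ()) (λ ()) [] (λ ()) (mono sy) ≤-refl []))
            λ {t} u → cover (all (proj₁ (f u))) (proj₂ (f u))
    where
    x∉ : ∀ {ws} → Order c (x ∷ y ∷ []) ws → x ∉ ws
    x∉ (step _ _ _ _ n _ _ _ _ _) (here refl) = n (here refl)
    x∉ (step _ _ _ _ _ _ _ _ _ o) (there i) = x∉ o i
    y∉ : ∀ {ws} → Order c (x ∷ y ∷ []) ws → y ∉ ws
    y∉ (step _ _ _ _ n _ _ _ _ _) (here refl) = n (there (here refl))
    y∉ (step _ _ _ _ _ _ _ _ _ o) (there i) = y∉ o i
    cover : ∀ {t} → t ∈ T ++ x ∷ y ∷ [] → t ∉ T → t ∈ x ∷ y ∷ []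
    cover i n with ∈-++⁻ T i
    ... | inj₁ j = contradiction j n
    ... | inj₂ j = j

  -- Decidability is what permits an argument by contradiction on a shortest loop. The search runs
  -- through the finite product of the lists; `ext` stands in for function extensionality.
  Done? : Dec Done
  Done? = map′ (λ (f , a , b) → f , a , b) (λ (f , a , b) → f , a , b)
      (choice? n L Good good-ext (λ f → Fin.all? λ u → Fin.all? λ v → Adj²? u v →-dec ¬? (f u ≟ f v)))
    where
    Good : (V → ℕ) → Set
    Good f = ∀ u v → Adj² G u v → f u ≢ f v
    good-ext : ∀ {f g} → (∀ v → f v ≡ g v) → Good f → Good g
    good-ext e gf u v a e′ = gf u v a (trans (e u) (trans e′ (sym (e v))))
    choice? : ∀ m (L : Fin m → List ℕ) (P : (Fin m → ℕ) → Set) → (∀ {f g} → (∀ v → f v ≡ g v) → P f → P g) →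
              (∀ f → Dec (P f)) → Dec (∃[ f ] (∀ v → f v ∈ L v) × P f)
    choice? zero L P ext P? = map′ (λ p → none , (λ ()) , p) (λ (f , _ , p) → ext {f} {none} (λ ()) p) (P? none)
      where
      none : Fin 0 → ℕ
      none ()
    choice? (suc m) L P ext P? = map′
        (λ (x , x∈ , f , f∈ , p) → cons x f , (λ { Fin.zero → x∈ ; (Fin.suc v) → f∈ v }) , p)
        (λ (f , f∈ , p) → f Fin.zero , f∈ Fin.zero , f ∘ Fin.suc , f∈ ∘ Fin.suc ,
           ext {f} {cons (f Fin.zero) (f ∘ Fin.suc)} (λ { Fin.zero → refl ; (Fin.suc v) → refl }) p)
        (∃∈? (λ x → choice? m (L ∘ Fin.suc) (P ∘ cons x)
           (λ e → ext λ { Fin.zero → refl ; (Fin.suc v) → e v }) (P? ∘ cons x)) (L Fin.zero))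
      where
      cons : ∀ {m} → ℕ → (Fin m → ℕ) → Fin (suc m) → ℕ
      cons x f Fin.zero = x
      cons x f (Fin.suc v) = f v

-- Colour lists near a cycle: four pendants, two middle vertices, one cut vertex

hit : List ℕ → List ℕ → List ℕ
hit A xs = filter (_∈ℕ? xs) A

-- Of the colours `xs` on its neighbours, `A` can lose only those in `ys`. Coincidences and colours
-- outside `A` make it possible that `ys` is shorter than `xs`.
Kills : List ℕ → List ℕ → List ℕ → Set
Kills A ys xs = All (λ x → x ∈ A → x ∈ ys) xs

hit-length : ∀ {A xs} ys → Unique A → Kills A ys xs → length (hit A xs) ≤ length ys
hit-length {A} {xs} ys u k = unique-⊑-length (Unique.filter⁺ _ u) λ x∈ →
  let (a , b) = ∈-filter⁻ (_∈ℕ? xs) {xs = A} x∈ in All.lookup k b a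

-- The colours a₀,…,a₃ are for four consecutive pendant vertices, A₁ and A₂ are the lists of the two middle
-- cycle vertices, and p is a colour for the cycle vertex next to them on the side of a₃.
Balanced : (A₁ A₂ : List ℕ) (a₀ a₁ a₂ a₃ p : ℕ) → Set
Balanced A₁ A₂ a₀ a₁ a₂ a₃ p =
  (length (hit A₁ (a₀ ∷ a₁ ∷ a₂ ∷ p ∷ [])) ≤ 3 × length (hit A₂ (a₁ ∷ a₂ ∷ a₃ ∷ p ∷ [])) ≤ 2) ⊎
  (length (hit A₁ (a₀ ∷ a₁ ∷ a₂ ∷ p ∷ [])) ≤ 2 × length (hit A₂ (a₁ ∷ a₂ ∷ a₃ ∷ p ∷ [])) ≤ 3)

-- The cut vertex is within distance two of the last two pendants, whence the two inequalities. The
-- four pendants are pairwise farther apart, so they may share colours with each other, and the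
-- first two also with the cut vertex.
Win : (U₀ U₁ U₂ U₃ A₁ A₂ C : List ℕ) → Set
Win U₀ U₁ U₂ U₃ A₁ A₂ C =
  ∃[ a₀ ] a₀ ∈ U₀ × ∃[ a₁ ] a₁ ∈ U₁ × ∃[ a₂ ] a₂ ∈ U₂ × ∃[ a₃ ] a₃ ∈ U₃ × ∃[ p ] p ∈ C ×
    p ≢ a₂ × p ≢ a₃ × Balanced A₁ A₂ a₀ a₁ a₂ a₃ p

Two : List ℕ → Set
Two U = ∃₂ λ x y → x ∈ U × y ∈ U × x ≢ y

other : ∀ {U} → Two U → ∀ z → ∃[ y ] y ∈ U × y ≢ z
other (x , y , x∈ , y∈ , ne) z with x ≟ z
... | no x≢z = x , x∈ , x≢z
... | yes refl = y , y∈ , ne ∘ sym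

some : ∀ {U} → Two U → ∃[ y ] y ∈ U
some (x , _ , x∈ , _) = x , x∈

-- The lists of cycle vertices are cut to exactly six colours, so that seven distinct colours in one
-- of them are a contradiction.
Six : List ℕ → Set
Six A = Unique A × length A ≡ 6

without : ℕ → List ℕ → List ℕ
without a = filter (λ x → ¬? (x ≟ a))

without⁻ : ∀ a xs {x} → x ∈ without a xs → x ∈ xs × x ≢ a
without⁻ a xs = ∈-filter⁻ (λ x → ¬? (x ≟ a)) {xs = xs}

without-length : ∀ a {xs} → Unique xs → length xs ≤ suc (length (without a xs))
without-length a {xs} u = unique-⊑-length u sub
  where
  sub : xs ⊑ a ∷ without a xs
  sub {x} x∈ with x ≟ a
  ... | yes refl = here refl
  ... | no ne = there (∈-filter⁺ (λ x → ¬? (x ≟ a)) x∈ ne)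

without-unique : ∀ a {xs} → Unique xs → Unique (without a xs)
without-unique a = Unique.filter⁺ _

six-bound : ∀ {A xs} → Six A → Unique xs → xs ⊑ A → length xs ≤ 6
six-bound (_ , e) u s = ≤-trans (unique-⊑-length u s) (≤-reflexive e)

six-outside : ∀ {A} ys → Six A → length ys ≤ 5 → ∃[ x ] x ∈ A × x ∉ ys
six-outside ys (u , e) le = exists-outside _≟_ ys u (≤-trans (s≤s le) (≤-reflexive (sym e)))

at₀ : ∀ {x : ℕ} {xs} {B : Set} → B → x ∈ x ∷ xs
at₀ _ = here refl

at₁ : ∀ {x y : ℕ} {xs} {B : Set} → B → x ∈ y ∷ x ∷ xs
at₁ _ = there (here refl)

at₂ : ∀ {x y z : ℕ} {xs} {B : Set} → B → x ∈ y ∷ z ∷ x ∷ xs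
at₂ _ = there (there (here refl))

module _ {U₀ U₁ U₂ U₃ A₁ A₂ C : List ℕ} (s₁ : Six A₁) (s₂ : Six A₂)
         (lose : ¬ Win U₀ U₁ U₂ U₃ A₁ A₂ C) where

  lose₃₂ : ∀ {a₀ a₁ a₂ a₃ p} → a₀ ∈ U₀ → a₁ ∈ U₁ → a₂ ∈ U₂ → a₃ ∈ U₃ → p ∈ C → p ≢ a₂ → p ≢ a₃ →
    ∀ {x y z v w} → Kills A₁ (x ∷ y ∷ z ∷ []) (a₀ ∷ a₁ ∷ a₂ ∷ p ∷ []) →
                    Kills A₂ (v ∷ w ∷ []) (a₁ ∷ a₂ ∷ a₃ ∷ p ∷ []) → ⊥
  lose₃₂ i₀ i₁ i₂ i₃ j n₂ n₃ k₁ k₂ = lose (_ , i₀ , _ , i₁ , _ , i₂ , _ , i₃ , _ , j , n₂ , n₃ ,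
    inj₁ (hit-length _ (proj₁ s₁) k₁ , hit-length _ (proj₁ s₂) k₂))

  lose₂₃ : ∀ {a₀ a₁ a₂ a₃ p} → a₀ ∈ U₀ → a₁ ∈ U₁ → a₂ ∈ U₂ → a₃ ∈ U₃ → p ∈ C → p ≢ a₂ → p ≢ a₃ →
    ∀ {v w x y z} → Kills A₁ (v ∷ w ∷ []) (a₀ ∷ a₁ ∷ a₂ ∷ p ∷ []) →
                    Kills A₂ (x ∷ y ∷ z ∷ []) (a₁ ∷ a₂ ∷ a₃ ∷ p ∷ []) → ⊥
  lose₂₃ i₀ i₁ i₂ i₃ j n₂ n₃ k₁ k₂ = lose (_ , i₀ , _ , i₁ , _ , i₂ , _ , i₃ , _ , j , n₂ , n₃ ,
    inj₂ (hit-length _ (proj₁ s₁) k₁ , hit-length _ (proj₁ s₂) k₂))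

  -- Giving the first two pendants a common colour c spares both middle vertices; then the pair formed by
  -- the pendant of U₀ and the cut vertex, which have eight colours between them, spares A₁ again.
  middle-disjoint : Two U₀ → Two U₃ → Six C → ∀ {c} → c ∈ U₁ → c ∈ U₂ → ⊥
  middle-disjoint t₀@(x , y , x∈ , y∈ , x≢y) t₃ sC {c} c₁ c₂ =
    contradiction (six-bound s₁ uni sub) (<⇒≱ (≤-trans (n≤1+n 7) (≤-reflexive (cong (λ k → suc (suc k)) (sym (proj₂ sC))))))
    where
    a₃ = proj₁ (some t₃)
    i₃ = proj₂ (some t₃)
    q-out = six-outside (c ∷ a₃ ∷ []) sC (s≤s (s≤s z≤n))
    q = proj₁ q-out
    q∈ = proj₁ (proj₂ q-out)
    q≢c : q ≢ c
    q≢c e = proj₂ (proj₂ q-out) (here e)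
    q≢a₃ : q ≢ a₃
    q≢a₃ e = proj₂ (proj₂ q-out) (there (here e))
    U₀⊑A₁ : ∀ {a} → a ∈ U₀ → a ∈ A₁
    U₀⊑A₁ {a} a∈ with a ∈ℕ? A₁
    ... | yes i = i
    ... | no n = ⊥-elim (lose₂₃ a∈ c₁ c₂ i₃ q∈ q≢c q≢a₃
                   {v = c} {w = q} {x = c} {y = a₃} {z = q}
                   ((λ i → contradiction i n) ∷ at₀ ∷ at₀ ∷ at₁ ∷ []) (at₀ ∷ at₀ ∷ at₁ ∷ at₂ ∷ []))
    C⊑A₁ : ∀ {p} → p ∈ C → p ∈ A₁
    C⊑A₁ {p} p∈ with p ∈ℕ? A₁
    ... | yes i = i
    ... | no n with p ≟ c
    -- The cut vertex cannot take `c`, but here `c` is missing from `A₁`, so the reserve colour `q`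
    -- lets `A₁` lose only `x` and `q`.
    ...   | yes refl = ⊥-elim (lose₂₃ x∈ c₁ c₂ i₃ q∈ q≢c q≢a₃ {v = x} {w = q} {x = c} {y = a₃} {z = q}
                   (at₀ ∷ (λ i → contradiction i n) ∷ (λ i → contradiction i n) ∷ at₁ ∷ []) (at₀ ∷ at₀ ∷ at₁ ∷ at₂ ∷ []))
    ...   | no p≢c with other t₃ p
    ...     | b , b∈ , b≢p = ⊥-elim (lose₂₃ x∈ c₁ c₂ b∈ p∈ p≢c (b≢p ∘ sym) {v = x} {w = c} {x = c} {y = b} {z = p}
                   (at₀ ∷ at₁ ∷ at₁ ∷ (λ i → contradiction i n) ∷ []) (at₀ ∷ at₀ ∷ at₁ ∷ at₂ ∷ []))
    U₀∩C : ∀ {a} → a ∈ U₀ → a ∉ C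
    U₀∩C {a} a∈ p∈ with a ≟ c
    ... | yes refl = lose₂₃ a∈ c₁ c₂ i₃ q∈ q≢c q≢a₃ {v = c} {w = q} {x = c} {y = a₃} {z = q}
                   (at₀ ∷ at₀ ∷ at₀ ∷ at₁ ∷ []) (at₀ ∷ at₀ ∷ at₁ ∷ at₂ ∷ [])
    ... | no a≢c with other t₃ a
    ...   | b , b∈ , b≢a = lose₂₃ a∈ c₁ c₂ b∈ p∈ a≢c (b≢a ∘ sym) {v = a} {w = c} {x = c} {y = b} {z = a}
                   (at₀ ∷ at₁ ∷ at₁ ∷ at₀ ∷ []) (at₀ ∷ at₀ ∷ at₁ ∷ at₂ ∷ [])
    uni : Unique (x ∷ y ∷ C)
    uni = (x≢y ∷ All-≢⁺ (U₀∩C x∈)) ∷ All-≢⁺ (U₀∩C y∈) ∷ proj₁ sC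
    sub : x ∷ y ∷ C ⊑ A₁
    sub (here refl) = U₀⊑A₁ x∈
    sub (there (here refl)) = U₀⊑A₁ y∈
    sub (there (there i)) = C⊑A₁ i

  -- The pendants a₁, a₂, a₃ together kill at most the two colours h₁, h₂ of A₂.
  module Spared {a₁ a₂ a₃ h₁ h₂} (i₁ : a₁ ∈ U₁) (i₂ : a₂ ∈ U₂) (i₃ : a₃ ∈ U₃)
                (k₂ : Kills A₂ (h₁ ∷ h₂ ∷ []) (a₁ ∷ a₂ ∷ a₃ ∷ [])) where

    kills : ∀ {p} → (p ∈ A₂ → p ∈ a₁ ∷ a₂ ∷ a₃ ∷ []) → Kills A₂ (h₁ ∷ h₂ ∷ []) (a₁ ∷ a₂ ∷ a₃ ∷ p ∷ [])
    kills f = All.lookup k₂ (here refl) ∷ All.lookup k₂ (there (here refl)) ∷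
              All.lookup k₂ (there (there (here refl))) ∷ (λ i → All.lookup k₂ (f i) i) ∷ []

    -- `p` adds nothing to the loss of `A₂`, which stays at two. As the play does not win, `A₁` must
    -- lose four different colours; the failure of any part of the conclusion would reduce its loss
    -- to three.
    free-cut : ∀ {p} → p ∈ C → p ≢ a₂ → p ≢ a₃ → (p ∈ A₂ → p ∈ a₁ ∷ a₂ ∷ a₃ ∷ []) →
      ∀ {a₀} → a₀ ∈ U₀ → p ∈ A₁ × p ≢ a₁ × a₀ ∈ A₁ × p ≢ a₀ × a₂ ≢ a₀
    free-cut {p} p∈ n₂ n₃ f {a₀} i₀ =
      p∈A₁ ,
      (λ { refl → L {x = a₀} {y = a₁} {z = a₂} (at₀ ∷ at₁ ∷ at₂ ∷ at₁ ∷ []) (kills f) }) ,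
      a₀∈A₁ ,
      (λ { refl → L {x = a₀} {y = a₁} {z = a₂} (at₀ ∷ at₁ ∷ at₂ ∷ at₀ ∷ []) (kills f) }) ,
      (λ { refl → L {x = a₀} {y = a₁} {z = p} (at₀ ∷ at₁ ∷ at₀ ∷ at₂ ∷ []) (kills f) })
      where
      L = lose₃₂ i₀ i₁ i₂ i₃ p∈ n₂ n₃
      p∈A₁ : p ∈ A₁
      p∈A₁ with p ∈ℕ? A₁
      ... | yes i = i
      ... | no n = ⊥-elim (L {x = a₀} {y = a₁} {z = a₂} (at₀ ∷ at₁ ∷ at₂ ∷ (λ i → contradiction i n) ∷ []) (kills f))
      a₀∈A₁ : a₀ ∈ A₁
      a₀∈A₁ with a₀ ∈ℕ? A₁
      ... | yes i = i
      ... | no n = ⊥-elim (L {x = p} {y = a₁} {z = a₂} ((λ i → contradiction i n) ∷ at₁ ∷ at₂ ∷ at₀ ∷ []) (kills f))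

    -- Otherwise A₁ contains all of U₀ and C without a₃: at least seven colours.
    not-one : Two U₀ → Six C → ∀ h → ¬ Kills A₂ (h ∷ []) (a₁ ∷ a₂ ∷ a₃ ∷ [])
    not-one (x , y , x∈ , y∈ , x≢y) sC h k = contradiction (six-bound s₁ uni sub)
        (<⇒≱ (s≤s (s≤s (≤-pred (≤-trans (≤-reflexive (sym (proj₂ sC))) (without-length a₃ (proj₁ sC)))))))
      where
      C' = without a₃ C
      L : ∀ {a₀ p} → a₀ ∈ U₀ → p ∈ C → p ≢ a₂ → p ≢ a₃ → ∀ {x y z} → Kills A₁ (x ∷ y ∷ z ∷ []) (a₀ ∷ a₁ ∷ a₂ ∷ p ∷ []) → ⊥
      L {p = p} i₀ p∈ n₂ n₃ k₁ = lose₃₂ i₀ i₁ i₂ i₃ p∈ n₂ n₃ {v = h} {w = p} k₁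
        (wk (All.lookup k (here refl)) ∷ wk (All.lookup k (there (here refl))) ∷ wk (All.lookup k (there (there (here refl)))) ∷ at₁ ∷ [])
        where
        wk : ∀ {z} → (z ∈ A₂ → z ∈ h ∷ []) → z ∈ A₂ → z ∈ h ∷ p ∷ []
        wk f i with f i
        ... | here e = here e
      q-out = six-outside (a₂ ∷ a₃ ∷ []) sC (s≤s (s≤s z≤n))
      q = proj₁ q-out
      q∈ = proj₁ (proj₂ q-out)
      q≢a₂ : q ≢ a₂
      q≢a₂ e = proj₂ (proj₂ q-out) (here e)
      q≢a₃ : q ≢ a₃
      q≢a₃ e = proj₂ (proj₂ q-out) (there (here e))
      U₀⊑A₁ : ∀ {a} → a ∈ U₀ → a ∈ A₁
      U₀⊑A₁ {a} a∈ with a ∈ℕ? A₁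
      ... | yes i = i
      ... | no n = ⊥-elim (L a∈ q∈ q≢a₂ q≢a₃ {x = q} {y = a₁} {z = a₂} ((λ i → contradiction i n) ∷ at₁ ∷ at₂ ∷ at₀ ∷ []))
      C⊑A₁ : ∀ {p} → p ∈ C' → p ∈ A₁
      C⊑A₁ {p} p∈' with without⁻ a₃ C p∈'
      ... | p∈ , n₃ with p ∈ℕ? A₁
      ...   | yes i = i
      ...   | no n with p ≟ a₂
      -- `a₂` is forbidden on the cut vertex, but as it is missing from `A₁` the reserve colour `q`
      -- keeps the loss at three.
      ...     | yes refl = ⊥-elim (L x∈ q∈ q≢a₂ q≢a₃ {x = x} {y = a₁} {z = q} (at₀ ∷ at₁ ∷ (λ i → contradiction i n) ∷ at₂ ∷ []))
      ...     | no n₂ = ⊥-elim (L x∈ p∈ n₂ n₃ {x = x} {y = a₁} {z = a₂} (at₀ ∷ at₁ ∷ at₂ ∷ (λ i → contradiction i n) ∷ []))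
      U₀∩C : ∀ {a} → a ∈ U₀ → a ∉ C'
      U₀∩C {a} a∈ p∈' with without⁻ a₃ C p∈'
      ... | p∈ , n₃ with a ≟ a₂
      ...   | yes refl = L a∈ q∈ q≢a₂ q≢a₃ {x = a} {y = a₁} {z = q} (at₀ ∷ at₁ ∷ at₀ ∷ at₂ ∷ [])
      ...   | no n₂ = L a∈ p∈ n₂ n₃ {x = a} {y = a₁} {z = a₂} (at₀ ∷ at₁ ∷ at₂ ∷ at₀ ∷ [])
      uni : Unique (x ∷ y ∷ C')
      uni = (x≢y ∷ All-≢⁺ (U₀∩C x∈)) ∷ All-≢⁺ (U₀∩C y∈) ∷ without-unique a₃ (proj₁ sC)
      sub : x ∷ y ∷ C' ⊑ A₁
      sub (here refl) = U₀⊑A₁ x∈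
      sub (there (here refl)) = U₀⊑A₁ y∈
      sub (there (there i)) = C⊑A₁ i

Disjoint : List ℕ → List ℕ → Set
Disjoint X Y = ∀ {c} → c ∈ X → c ∉ Y

-- The lists `U₋`, `U₀`, ..., `U₄` belong to pendants at consecutive indices -1, ..., 4, and `Aᵢ` to
-- the cycle vertex `i`. In the plays `lA` and `lD` the cut vertex follows the two middle vertices,
-- in `lB` and `lC` it precedes them. The aim is that colours from `U₁`, `U₂`, `U₃` always cost `A₂`
-- three different colours.
module Window {U₋ U₀ U₁ U₂ U₃ U₄ A₀ A₁ A₂ A₃ : List ℕ}
  (t₋ : Two U₋) (t₀ : Two U₀) (t₁ : Two U₁) (t₂ : Two U₂) (t₃ : Two U₃) (t₄ : Two U₄)
  (s₀ : Six A₀) (s₁ : Six A₁) (s₂ : Six A₂) (s₃ : Six A₃)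
  (lA : ¬ Win U₀ U₁ U₂ U₃ A₁ A₂ A₃) (lB : ¬ Win U₃ U₂ U₁ U₀ A₂ A₁ A₀)
  (lC : ¬ Win U₄ U₃ U₂ U₁ A₃ A₂ A₁) (lD : ¬ Win U₋ U₀ U₁ U₂ A₀ A₁ A₂)
  (d₋₀ : Disjoint U₋ U₀) (d₀₁ : Disjoint U₀ U₁) (d₁₂ : Disjoint U₁ U₂) (d₂₃ : Disjoint U₂ U₃) where

  -- The opposite of the aim is assumed: `A₂` loses at most `h₁` and `h₂`. The module refutes this
  -- in `contradictory`.
  module At {a₁ a₂ a₃ h₁ h₂} (i₁ : a₁ ∈ U₁) (i₂ : a₂ ∈ U₂) (i₃ : a₃ ∈ U₃)
            (k₂ : Kills A₂ (h₁ ∷ h₂ ∷ []) (a₁ ∷ a₂ ∷ a₃ ∷ [])) where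

    as : List ℕ
    as = a₁ ∷ a₂ ∷ a₃ ∷ []

    -- `free` concerns the cut vertex 3 and the list `A₁`; its mirror image `free′` concerns the cut
    -- vertex 1 and the list `A₃`.
    open Spared s₁ s₂ lA i₁ i₂ i₃ k₂ using (not-one; kills) renaming (free-cut to free)
    open Spared s₃ s₂ lC i₃ i₂ i₁
      (All.lookup k₂ (there (there (here refl))) ∷ All.lookup k₂ (there (here refl)) ∷ All.lookup k₂ (here refl) ∷ [])
      using () renaming (free-cut to free′)

    rev : ∀ {p} → (p ∈ A₂ → p ∈ as) → p ∈ A₂ → p ∈ a₃ ∷ a₂ ∷ a₁ ∷ []
    rev f i with f i
    ... | here e = there (there (here e))
    ... | there (here e) = there (here e)
    ... | there (there (here e)) = here e

    a₁≢a₂ : a₁ ≢ a₂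
    a₁≢a₂ refl = d₁₂ i₁ i₂
    a₂≢a₃ : a₂ ≢ a₃
    a₂≢a₃ refl = d₂₃ i₂ i₃

    -- The play with cut vertex 0: `A₂` still loses only two colours, and `A₁` at most `a₀`, `a₁`,
    -- `a₂`.
    back : ∀ {p a₀} → p ∈ A₀ → a₀ ∈ U₀ → p ≢ a₁ → p ≢ a₀ → (p ∈ A₂ → p ∈ as) → (p ∈ A₁ → p ≡ a₂) → ⊥
    back {p} {a₀} p∈ i₀ n₁ n₀ f g with kills f
    ... | k₁ ∷ k₂ ∷ k₃ ∷ kp ∷ [] = lose₂₃ s₂ s₁ lB i₃ i₂ i₁ i₀ p∈ n₁ n₀ {x = a₂} {y = a₁} {z = a₀}
        (k₃ ∷ k₂ ∷ k₁ ∷ kp ∷ []) (at₀ ∷ at₁ ∷ at₂ ∷ (λ i → here (g i)) ∷ [])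

    -- If only one colour of `A₂` or none were killed, `not-one` would apply.
    two-killed : ∃₂ λ g₁ g₂ → g₁ ≢ g₂ × g₁ ∈ A₂ × g₂ ∈ A₂ × g₁ ∈ as × g₂ ∈ as
    two-killed with a₁ ∈ℕ? A₂ | a₂ ∈ℕ? A₂ | a₃ ∈ℕ? A₂
    ... | yes j₁ | yes j₂ | _ = a₁ , a₂ , a₁≢a₂ , j₁ , j₂ , here refl , there (here refl)
    ... | _ | yes j₂ | yes j₃ = a₂ , a₃ , a₂≢a₃ , j₂ , j₃ , there (here refl) , there (there (here refl))
    ... | no n₁ | no n₂ | _ = ⊥-elim (not-one t₀ s₃ a₃ ((λ i → contradiction i n₁) ∷ (λ i → contradiction i n₂) ∷ at₀ ∷ []))
    ... | no n₁ | yes _ | no n₃ = ⊥-elim (not-one t₀ s₃ a₂ ((λ i → contradiction i n₁) ∷ at₀ ∷ (λ i → contradiction i n₃) ∷ []))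
    ... | yes _ | no n₂ | no n₃ = ⊥-elim (not-one t₀ s₃ a₁ (at₀ ∷ (λ i → contradiction i n₂) ∷ (λ i → contradiction i n₃) ∷ []))
    ... | yes j₁ | no n₂ | yes j₃ with a₁ ≟ a₃
    ...   | yes refl = ⊥-elim (not-one t₀ s₃ a₁ (at₀ ∷ (λ i → contradiction i n₂) ∷ at₀ ∷ []))
    ...   | no ne = a₁ , a₃ , ne , j₁ , j₃ , here refl , there (there (here refl))

    -- At least two of the six colours of `A₂` lie in `as`, so there is room for only four outside.
    crowded : ∀ {xs} → Unique xs → xs ⊑ A₂ → (∀ {x} → x ∈ xs → x ∉ as) → 5 ≤ length xs → ⊥
    crowded {xs} u sub out le with two-killed
    ... | g₁ , g₂ , ne , j₁ , j₂ , e₁ , e₂ = contradiction (six-bound s₂ uni sub') (<⇒≱ (s≤s (s≤s le)))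
      where
      uni : Unique (g₁ ∷ g₂ ∷ xs)
      uni = (ne ∷ All-≢⁺ (λ i → out i e₁)) ∷ All-≢⁺ (λ i → out i e₂) ∷ u
      sub' : g₁ ∷ g₂ ∷ xs ⊑ A₂
      sub' (here refl) = j₁
      sub' (there (here refl)) = j₂
      sub' (there (there i)) = sub i

    a₃-rare : ∀ {p} → p ∈ A₁ → p ≢ a₁ → p ≢ a₂ → p ≢ a₃
    a₃-rare p∈ n₁ n₂ refl = proj₁ (proj₂ (free′ p∈ n₂ n₁ (λ _ → here refl) (proj₂ (some t₄)))) refl

    not-a : ∀ {p} → p ≢ a₁ → p ≢ a₂ → p ≢ a₃ → p ∉ as
    not-a n₁ n₂ n₃ (here e) = n₁ e
    not-a n₁ n₂ n₃ (there (here e)) = n₂ e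
    not-a n₁ n₂ n₃ (there (there (here e))) = n₃ e

    -- With `A₁` almost inside `A₂`, a colour of `A₀` other than `a₁` wins on the cut vertex 0
    -- unless it is in `A₂` and outside `as`. At least five colours of `A₀` would have to be so,
    -- which `crowded` forbids.
    module NoD (inA₂ : ∀ {p} → p ∈ A₁ → p ≢ a₁ → p ≢ a₂ → p ∈ A₂) where

      A₀⊑A₂ : ∀ {p} → p ∈ A₀ → p ≢ a₁ → p ∈ A₂ × p ∉ as
      A₀⊑A₂ {p} p∈ n₁ with other t₀ p
      ... | a₀ , i₀ , a₀≢p = claim
        where
        B = back p∈ i₀ n₁ (a₀≢p ∘ sym)
        n₂ : p ≢ a₂
        n₂ refl = B (λ _ → there (here refl)) (λ _ → refl)
        n₃ : p ≢ a₃
        n₃ refl with p ∈ℕ? A₁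
        ... | yes i = a₃-rare i n₁ n₂ refl
        ... | no n = B (λ _ → there (there (here refl))) (λ i → contradiction i n)
        claim : p ∈ A₂ × p ∉ as
        claim with p ∈ℕ? A₂
        ... | yes i = i , not-a n₁ n₂ n₃
        ... | no n = ⊥-elim (B (λ i → contradiction i n) (λ i → contradiction (inA₂ i n₁ n₂) n))

      absurd : ⊥
      absurd = crowded (without-unique a₁ (proj₁ s₀))
        (λ i → let (a , b) = without⁻ a₁ A₀ i in proj₁ (A₀⊑A₂ a b))
        (λ i → let (a , b) = without⁻ a₁ A₀ i in proj₂ (A₀⊑A₂ a b))
        (≤-pred (≤-trans (≤-reflexive (sym (proj₂ s₀))) (without-length a₁ (proj₁ s₀))))

    -- A colour `d` missing from `A₂` costs it nothing on the cut vertex 3, so `free` applies. This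
    -- is separate from `Main` because colours of `U₀` and `U₁` are later tried in the place of `d`.
    module D {d} (d∈₃ : d ∈ A₃) (d∉₂ : d ∉ A₂) (d≢a₂ : d ≢ a₂) (d≢a₃ : d ≢ a₃) where

      fr : ∀ {a₀} → a₀ ∈ U₀ → d ∈ A₁ × d ≢ a₁ × a₀ ∈ A₁ × d ≢ a₀ × a₂ ≢ a₀
      fr = free d∈₃ d≢a₂ d≢a₃ (λ i → contradiction i d∉₂)

      x₀ = proj₁ t₀
      y₀ = proj₁ (proj₂ t₀)
      x₀∈ : x₀ ∈ U₀
      x₀∈ = proj₁ (proj₂ (proj₂ t₀))
      y₀∈ : y₀ ∈ U₀
      y₀∈ = proj₁ (proj₂ (proj₂ (proj₂ t₀)))
      x₀≢y₀ : x₀ ≢ y₀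
      x₀≢y₀ = proj₂ (proj₂ (proj₂ (proj₂ t₀)))

      d∈₁ : d ∈ A₁
      d∈₁ = proj₁ (fr x₀∈)
      d≢a₁ : d ≢ a₁
      d≢a₁ = proj₁ (proj₂ (fr x₀∈))
      U₀⊑A₁ : U₀ ⊑ A₁
      U₀⊑A₁ i = proj₁ (proj₂ (proj₂ (fr i)))
      d∉U₀ : d ∉ U₀
      d∉U₀ i = proj₁ (proj₂ (proj₂ (proj₂ (fr i)))) refl
      a₂∉U₀ : a₂ ∉ U₀
      a₂∉U₀ i = proj₂ (proj₂ (proj₂ (proj₂ (fr i)))) refl

      d∉U₁ : d ∉ U₁
      d∉U₁ i = lose₃₂ s₁ s₂ lA x₀∈ i i₂ i₃ d∈₃ d≢a₂ d≢a₃ {x = x₀} {y = d} {z = a₂} {v = a₂} {w = a₃}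
        (at₀ ∷ at₁ ∷ at₂ ∷ at₁ ∷ []) ((λ i → contradiction i d∉₂) ∷ at₀ ∷ at₁ ∷ (λ i → contradiction i d∉₂) ∷ [])

    module Main {d} (d∈₃ : d ∈ A₃) (d∉₂ : d ∉ A₂) (d≢a₂ : d ≢ a₂) (d≢a₃ : d ≢ a₃) where
      open D d∈₃ d∉₂ d≢a₂ d≢a₃

      U₀≢a₁ : ∀ {x} → x ∈ U₀ → x ≢ a₁
      U₀≢a₁ i refl = d₀₁ i i₁
      U₀≢a₂ : ∀ {x} → x ∈ U₀ → x ≢ a₂
      U₀≢a₂ i refl = a₂∉U₀ i
      U₀≢a₃ : ∀ {x} → x ∈ U₀ → x ≢ a₃
      U₀≢a₃ i = a₃-rare (U₀⊑A₁ i) (U₀≢a₁ i) (U₀≢a₂ i)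

      -- A colour of `U₀` missing from `A₂` would qualify as `d` by `free′`, but no such `d` lies in
      -- `U₀`.
      U₀⊑A₂ : U₀ ⊑ A₂
      U₀⊑A₂ {x} i with x ∈ℕ? A₂
      ... | yes j = j
      ... | no n with free′ (U₀⊑A₁ i) (U₀≢a₂ i) (U₀≢a₁ i) (λ j → contradiction j n) (proj₂ (some t₄))
      ...   | x∈₃ , x≢a₃ , _ = contradiction i (D.d∉U₀ x∈₃ n (U₀≢a₂ i) x≢a₃)

      -- The pendant of U₀ and the cut vertex of A₂ share the colour p.
      module Edge {p x y z} (p∈ : p ∈ U₀) (x∈ : x ∈ U₋) (y∈ : y ∈ U₁) (z∈ : z ∈ U₂) (p≢z : p ≢ z) where
        p≢y : p ≢ y
        p≢y refl = d₀₁ p∈ y∈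
        L₃₂ = λ {a b c v w} → lose₃₂ s₀ s₁ lD x∈ p∈ y∈ z∈ (U₀⊑A₂ p∈) p≢y p≢z {a} {b} {c} {v} {w}
        L₂₃ = λ {v w a b c} → lose₂₃ s₀ s₁ lD x∈ p∈ y∈ z∈ (U₀⊑A₂ p∈) p≢y p≢z {v} {w} {a} {b} {c}
        y∈A₁ : y ∈ A₁
        y∈A₁ with y ∈ℕ? A₁
        ... | yes i = i
        ... | no n = ⊥-elim (L₃₂ {x} {p} {y} {p} {z} (at₀ ∷ at₁ ∷ at₂ ∷ at₁ ∷ []) (at₀ ∷ (λ i → contradiction i n) ∷ at₁ ∷ at₀ ∷ []))
        z∈A₁ : z ∈ A₁
        z∈A₁ with z ∈ℕ? A₁
        ... | yes i = i
        ... | no n = ⊥-elim (L₃₂ {x} {p} {y} {p} {y} (at₀ ∷ at₁ ∷ at₂ ∷ at₁ ∷ []) (at₀ ∷ at₁ ∷ (λ i → contradiction i n) ∷ at₀ ∷ []))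
        x∈A₀ : x ∈ A₀
        x∈A₀ with x ∈ℕ? A₀
        ... | yes i = i
        ... | no n = ⊥-elim (L₂₃ {p} {y} {p} {y} {z} ((λ i → contradiction i n) ∷ at₀ ∷ at₁ ∷ at₀ ∷ []) (at₀ ∷ at₁ ∷ at₂ ∷ at₀ ∷ []))
        p∈A₀ : p ∈ A₀
        p∈A₀ with p ∈ℕ? A₀
        ... | yes i = i
        ... | no n = ⊥-elim (L₂₃ {x} {y} {p} {y} {z} (at₀ ∷ (λ i → contradiction i n) ∷ at₁ ∷ (λ i → contradiction i n) ∷ []) (at₀ ∷ at₁ ∷ at₂ ∷ at₀ ∷ []))
        y∈A₀ : y ∈ A₀
        y∈A₀ with y ∈ℕ? A₀
        ... | yes i = i
        ... | no n = ⊥-elim (L₂₃ {x} {p} {p} {y} {z} (at₀ ∷ at₁ ∷ (λ i → contradiction i n) ∷ at₁ ∷ []) (at₀ ∷ at₁ ∷ at₂ ∷ at₀ ∷ []))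
        x≢y : x ≢ y
        x≢y refl = L₂₃ {x} {p} {p} {y} {z} (at₀ ∷ at₁ ∷ at₀ ∷ at₁ ∷ []) (at₀ ∷ at₁ ∷ at₂ ∷ at₀ ∷ [])

      p-for : ∀ z → ∃[ p ] p ∈ U₀ × p ≢ z
      p-for = other t₀
      z-for : ∀ p → ∃[ z ] z ∈ U₂ × p ≢ z
      z-for p = let (z , i , n) = other t₂ p in z , i , n ∘ sym
      x₋∈ = proj₂ (some t₋)

      U₁⊑A₁ : U₁ ⊑ A₁
      U₁⊑A₁ i = let (z , j , n) = z-for x₀ in Edge.y∈A₁ x₀∈ x₋∈ i j n
      U₁⊑A₀ : U₁ ⊑ A₀
      U₁⊑A₀ i = let (z , j , n) = z-for x₀ in Edge.y∈A₀ x₀∈ x₋∈ i j n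
      U₀⊑A₀ : U₀ ⊑ A₀
      U₀⊑A₀ {p} i = let (z , j , n) = z-for p in Edge.p∈A₀ i x₋∈ i₁ j n
      U₋⊑A₀ : U₋ ⊑ A₀
      U₋⊑A₀ i = let (z , j , n) = z-for x₀ in Edge.x∈A₀ x₀∈ i i₁ j n
      U₋≢U₁ : ∀ {x y} → x ∈ U₋ → y ∈ U₁ → x ≢ y
      U₋≢U₁ i i' = let (z , j , n) = z-for x₀ in Edge.x≢y x₀∈ i i' j n
      U₂⊑A₁ : U₂ ⊑ A₁
      U₂⊑A₁ {z} j = let (p , i , n) = p-for z in Edge.z∈A₁ i x₋∈ i₁ j n

      b₁ = proj₁ (other t₁ a₁)
      b₁∈ : b₁ ∈ U₁
      b₁∈ = proj₁ (proj₂ (other t₁ a₁))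
      b₁≢a₁ : b₁ ≢ a₁
      b₁≢a₁ = proj₂ (proj₂ (other t₁ a₁))
      b₂ = proj₁ (other t₂ a₂)
      b₂∈ : b₂ ∈ U₂
      b₂∈ = proj₁ (proj₂ (other t₂ a₂))
      b₂≢a₂ : b₂ ≢ a₂
      b₂≢a₂ = proj₂ (proj₂ (other t₂ a₂))
      U₁≢U₂ : ∀ {x y} → x ∈ U₁ → y ∈ U₂ → x ≢ y
      U₁≢U₂ i j refl = d₁₂ i j
      U₀≢U₁ : ∀ {x y} → x ∈ U₀ → y ∈ U₁ → x ≢ y
      U₀≢U₁ i j refl = d₀₁ i j
      U₋≢U₀ : ∀ {x y} → x ∈ U₋ → y ∈ U₀ → x ≢ y
      U₋≢U₀ i j refl = d₋₀ i j
      d≢U₀ : ∀ {x} → x ∈ U₀ → d ≢ x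
      d≢U₀ i refl = d∉U₀ i
      d≢U₁ : ∀ {x} → x ∈ U₁ → d ≢ x
      d≢U₁ i refl = d∉U₁ i

      b₁∈A₂ : b₁ ∈ A₂
      b₁∈A₂ with b₁ ∈ℕ? A₂
      ... | yes i = i
      ... | no n with free′ (U₁⊑A₁ b₁∈) (U₁≢U₂ b₁∈ i₂) b₁≢a₁ (λ i → contradiction i n) (proj₂ (some t₄))
      ...   | b₁∈₃ , b₁≢a₃ , _ = contradiction b₁∈ (D.d∉U₁ b₁∈₃ n (U₁≢U₂ b₁∈ i₂) b₁≢a₃)

      seven : ∀ {x} → Unique x → x ⊑ A₁ → length x ≡ 7 → ⊥
      seven u s e = contradiction (six-bound s₁ u s) (<⇒≱ (≤-reflexive (sym e)))

      -- Now `x₀`, `y₀`, `a₁`, `b₁`, `a₂`, `d` fill `A₁`, so no colour of `U₋` is in `A₁`. Then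
      -- `back` forces two colours of `U₋` into `A₂` and outside `as`; together with `x₀`, `y₀`,
      -- `b₁` they are five.
      module In-U₂ (d∈U₂ : d ∈ U₂) where

        d∉A₀ : d ∉ A₀
        d∉A₀ d∈ = lose₂₃ s₂ s₁ lB i₃ d∈U₂ i₁ x₀∈ d∈ d≢a₁ (d≢U₀ x₀∈) {v = a₃} {w = a₁} {x = d} {y = a₁} {z = x₀}
          (at₀ ∷ (λ i → contradiction i d∉₂) ∷ at₁ ∷ (λ i → contradiction i d∉₂) ∷ [])
          (at₀ ∷ at₁ ∷ at₂ ∷ at₀ ∷ [])
        a₂∉A₀ : a₂ ∉ A₀
        a₂∉A₀ i = back i x₀∈ (a₁≢a₂ ∘ sym) (U₀≢a₂ x₀∈ ∘ sym) (λ _ → there (here refl)) (λ _ → refl)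

        module X {x} (x∈ : x ∈ U₋) where
          x≢a₁ : x ≢ a₁
          x≢a₁ = U₋≢U₁ x∈ i₁
          x≢a₂ : x ≢ a₂
          x≢a₂ refl = a₂∉A₀ (U₋⊑A₀ x∈)
          x≢d : x ≢ d
          x≢d refl = d∉A₀ (U₋⊑A₀ x∈)
          x∉A₁ : x ∉ A₁
          x∉A₁ i = seven uni sub refl
            where
            uni : Unique (x ∷ x₀ ∷ y₀ ∷ a₁ ∷ b₁ ∷ a₂ ∷ d ∷ [])
            uni = (U₋≢U₀ x∈ x₀∈ ∷ U₋≢U₀ x∈ y₀∈ ∷ x≢a₁ ∷ U₋≢U₁ x∈ b₁∈ ∷ x≢a₂ ∷ x≢d ∷ []) ∷
                  (x₀≢y₀ ∷ U₀≢a₁ x₀∈ ∷ U₀≢U₁ x₀∈ b₁∈ ∷ U₀≢a₂ x₀∈ ∷ (d≢U₀ x₀∈ ∘ sym) ∷ []) ∷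
                  (U₀≢a₁ y₀∈ ∷ U₀≢U₁ y₀∈ b₁∈ ∷ U₀≢a₂ y₀∈ ∷ (d≢U₀ y₀∈ ∘ sym) ∷ []) ∷
                  ((b₁≢a₁ ∘ sym) ∷ a₁≢a₂ ∷ (d≢a₁ ∘ sym) ∷ []) ∷
                  (U₁≢U₂ b₁∈ i₂ ∷ (d≢U₁ b₁∈ ∘ sym) ∷ []) ∷ ((d≢a₂ ∘ sym) ∷ []) ∷ [] ∷ []
            sub : x ∷ x₀ ∷ y₀ ∷ a₁ ∷ b₁ ∷ a₂ ∷ d ∷ [] ⊑ A₁
            sub = All.lookup (i ∷ U₀⊑A₁ x₀∈ ∷ U₀⊑A₁ y₀∈ ∷ U₁⊑A₁ i₁ ∷ U₁⊑A₁ b₁∈ ∷ U₂⊑A₁ i₂ ∷ d∈₁ ∷ [])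
          bk : (x ∈ A₂ → x ∈ as) → ⊥
          bk f = back (U₋⊑A₀ x∈) x₀∈ x≢a₁ (U₋≢U₀ x∈ x₀∈) f (λ i → contradiction i x∉A₁)
          x∈A₂ : x ∈ A₂
          x∈A₂ with x ∈ℕ? A₂
          ... | yes i = i
          ... | no n = ⊥-elim (bk (λ i → contradiction i n))
          x∉as : x ∉ as
          x∉as i = bk (λ _ → i)

        absurd : ⊥
        absurd = let (x , x' , x∈ , x'∈ , ne) = t₋ in
          crowded {xs = x ∷ x' ∷ x₀ ∷ y₀ ∷ b₁ ∷ []}
            ((ne ∷ U₋≢U₀ x∈ x₀∈ ∷ U₋≢U₀ x∈ y₀∈ ∷ U₋≢U₁ x∈ b₁∈ ∷ []) ∷
             (U₋≢U₀ x'∈ x₀∈ ∷ U₋≢U₀ x'∈ y₀∈ ∷ U₋≢U₁ x'∈ b₁∈ ∷ []) ∷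
             (x₀≢y₀ ∷ U₀≢U₁ x₀∈ b₁∈ ∷ []) ∷ (U₀≢U₁ y₀∈ b₁∈ ∷ []) ∷ [] ∷ [])
            (All.lookup (X.x∈A₂ x∈ ∷ X.x∈A₂ x'∈ ∷ U₀⊑A₂ x₀∈ ∷ U₀⊑A₂ y₀∈ ∷ b₁∈A₂ ∷ []))
            (All.lookup (X.x∉as x∈ ∷ X.x∉as x'∈ ∷ not-a (U₀≢a₁ x₀∈) (U₀≢a₂ x₀∈) (U₀≢a₃ x₀∈) ∷
               not-a (U₀≢a₁ y₀∈) (U₀≢a₂ y₀∈) (U₀≢a₃ y₀∈) ∷
               not-a b₁≢a₁ (U₁≢U₂ b₁∈ i₂) (a₃-rare (U₁⊑A₁ b₁∈) b₁≢a₁ (U₁≢U₂ b₁∈ i₂)) ∷ []))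
            ≤-refl

      -- A common colour c of U₀ and U₂ leaves A₁ with a second spared colour.
      common : ∀ {c} → c ∈ U₀ → c ∈ U₂ → ⊥
      common {c} c₀ c₂ with exists-outside _≟_ (without d A₁) (proj₁ s₂)
        (≤-trans (s≤s (≤-pred (≤-trans (shorter d∈₁) (≤-reflexive (proj₂ s₁))))) (≤-reflexive (sym (proj₂ s₂))))
        where
        shorter : ∀ {d A} → d ∈ A → suc (length (without d A)) ≤ length A
        shorter {d} {A} d∈ = filter-notAll (λ x → ¬? (x ≟ d)) A (Any.map (λ { refl n → n refl }) d∈)
          where open import Data.List.Properties using (filter-notAll)
      ... | q , q∈ , q∉′ = win (q ∈ℕ? A₀)
        where
        -- `q` was found by counting: `A₁` without `d` has at most five colours, `A₂` has six. It is
        -- not `d` either, since `d` is missing from `A₂`.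
        q∉ : q ∉ A₁
        q∉ i = q∉′ (∈-filter⁺ (λ x → ¬? (x ≟ d)) i λ { refl → d∉₂ q∈ })
          where open import Data.List.Membership.Propositional.Properties using (∈-filter⁺)
        q≢ : ∀ {x} → x ∈ A₁ → q ≢ x
        q≢ i refl = q∉ i
        finishing : ∀ {x} → x ∈ U₋ → (q ∈ A₀ → q ≡ x) → ⊥
        finishing {x} x∈ f = lose₃₂ s₀ s₁ lD x∈ c₀ i₁ c₂ q∈ (q≢ (U₁⊑A₁ i₁)) (q≢ (U₂⊑A₁ c₂))
          {x = x} {y = c} {z = a₁} {v = c} {w = a₁}
          (at₀ ∷ at₁ ∷ at₂ ∷ (λ i → here (f i)) ∷ []) (at₀ ∷ at₁ ∷ at₀ ∷ (λ i → contradiction i q∉) ∷ [])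
        win : Dec (q ∈ A₀) → ⊥
        win (no n) = finishing x₋∈ (λ i → contradiction i n)
        win (yes q∈₀) = go t₋
          where
          go : Two U₋ → ⊥
          go (x , x' , x∈ , x'∈ , ne) = contradiction (six-bound s₀ uni sub) (<⇒≱ ≤-refl)
            where
            out : ∀ {x} → x ∈ U₋ → q ≢ x
            out i refl = finishing i (λ _ → refl)
            uni : Unique (q ∷ x ∷ x' ∷ x₀ ∷ y₀ ∷ a₁ ∷ b₁ ∷ [])
            uni = (out x∈ ∷ out x'∈ ∷ q≢ (U₀⊑A₁ x₀∈) ∷ q≢ (U₀⊑A₁ y₀∈) ∷ q≢ (U₁⊑A₁ i₁) ∷ q≢ (U₁⊑A₁ b₁∈) ∷ []) ∷
                  (ne ∷ U₋≢U₀ x∈ x₀∈ ∷ U₋≢U₀ x∈ y₀∈ ∷ U₋≢U₁ x∈ i₁ ∷ U₋≢U₁ x∈ b₁∈ ∷ []) ∷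
                  (U₋≢U₀ x'∈ x₀∈ ∷ U₋≢U₀ x'∈ y₀∈ ∷ U₋≢U₁ x'∈ i₁ ∷ U₋≢U₁ x'∈ b₁∈ ∷ []) ∷
                  (x₀≢y₀ ∷ U₀≢U₁ x₀∈ i₁ ∷ U₀≢U₁ x₀∈ b₁∈ ∷ []) ∷ (U₀≢U₁ y₀∈ i₁ ∷ U₀≢U₁ y₀∈ b₁∈ ∷ []) ∷
                  ((b₁≢a₁ ∘ sym) ∷ []) ∷ [] ∷ []
            sub : q ∷ x ∷ x' ∷ x₀ ∷ y₀ ∷ a₁ ∷ b₁ ∷ [] ⊑ A₀
            sub = All.lookup (q∈₀ ∷ U₋⊑A₀ x∈ ∷ U₋⊑A₀ x'∈ ∷ U₀⊑A₀ x₀∈ ∷ U₀⊑A₀ y₀∈ ∷ U₁⊑A₀ i₁ ∷ U₁⊑A₀ b₁∈ ∷ [])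

      -- Two colours each of `U₀`, `U₁`, `U₂` together with `d` are seven colours of `A₁`, unless
      -- `d` lies in `U₂` or `U₀` meets `U₂`.
      absurd : ⊥
      absurd with d ∈ℕ? U₂
      ... | yes i = In-U₂.absurd i
      ... | no d∉U₂ with x₀ ≟ b₂ | y₀ ≟ b₂
      ...   | yes e | _ = common x₀∈ (subst (_∈ U₂) (sym e) b₂∈)
      ...   | no _ | yes e = common y₀∈ (subst (_∈ U₂) (sym e) b₂∈)
      ...   | no nx | no ny = seven
                {x₀ ∷ y₀ ∷ a₁ ∷ b₁ ∷ a₂ ∷ b₂ ∷ d ∷ []}
                ((x₀≢y₀ ∷ U₀≢a₁ x₀∈ ∷ U₀≢U₁ x₀∈ b₁∈ ∷ U₀≢a₂ x₀∈ ∷ nx ∷ (d≢U₀ x₀∈ ∘ sym) ∷ []) ∷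
                 (U₀≢a₁ y₀∈ ∷ U₀≢U₁ y₀∈ b₁∈ ∷ U₀≢a₂ y₀∈ ∷ ny ∷ (d≢U₀ y₀∈ ∘ sym) ∷ []) ∷
                 ((b₁≢a₁ ∘ sym) ∷ a₁≢a₂ ∷ U₁≢U₂ i₁ b₂∈ ∷ (d≢a₁ ∘ sym) ∷ []) ∷
                 (U₁≢U₂ b₁∈ i₂ ∷ U₁≢U₂ b₁∈ b₂∈ ∷ (d≢U₁ b₁∈ ∘ sym) ∷ []) ∷
                 ((b₂≢a₂ ∘ sym) ∷ (d≢a₂ ∘ sym) ∷ []) ∷ ((λ e → d∉U₂ (subst (_∈ U₂) e b₂∈)) ∷ []) ∷ [] ∷ [])
                (All.lookup (U₀⊑A₁ x₀∈ ∷ U₀⊑A₁ y₀∈ ∷ U₁⊑A₁ i₁ ∷ U₁⊑A₁ b₁∈ ∷ U₂⊑A₁ i₂ ∷ U₂⊑A₁ b₂∈ ∷ d∈₁ ∷ []))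
                refl

    contradictory : ⊥
    contradictory with ∃∈? (λ d → ¬? (d ∈ℕ? A₂) ×-dec ¬? (d ≟ a₁) ×-dec ¬? (d ≟ a₂)) A₁
    -- `free′` carries `d` from `A₁` over to `A₃`, the list of the cut vertex 3.
    ... | yes (d , d∈₁ , d∉₂ , d≢a₁ , d≢a₂) with free′ d∈₁ d≢a₂ d≢a₁ (λ i → contradiction i d∉₂) (proj₂ (some t₄))
    ...   | d∈₃ , d≢a₃ , _ = Main.absurd d∈₃ d∉₂ d≢a₂ d≢a₃
    contradictory | no none = NoD.absurd inA₂
      where
      inA₂ : ∀ {p} → p ∈ A₁ → p ≢ a₁ → p ≢ a₂ → p ∈ A₂
      inA₂ {p} p∈ n₁ n₂ with p ∈ℕ? A₂
      ... | yes i = i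
      ... | no n = contradiction (p , p∈ , n , n₁ , n₂) none

  U₂⊑A₂ : U₂ ⊑ A₂
  U₂⊑A₂ {a} i with a ∈ℕ? A₂
  ... | yes j = j
  ... | no n = ⊥-elim (At.contradictory (proj₂ (some t₁)) i (proj₂ (some t₃)) (at₀ ∷ (λ j → contradiction j n) ∷ at₁ ∷ []))

  U₁∩U₃ : Disjoint U₁ U₃
  U₁∩U₃ i j = At.contradictory i (proj₂ (some t₂)) j (at₀ ∷ at₁ ∷ at₀ ∷ [])

-- Sparing one or two lists by a pair of colours

union : ∀ {X Y Z : List ℕ} → (∀ {c} → c ∈ X → c ∉ Y) → Unique X → Unique Y → X ⊑ Z → Y ⊑ Z →
        length X + length Y ≤ length Z
union {X} disj u v f g = ≤-trans (≤-reflexive (sym (length-++ X)))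
  (unique-⊑-length (Unique.++⁺ u v λ (i , j) → disj i j) λ i → [ f , g ]′ (∈-++⁻ X i))

-- Every colour of `Y` is in `Z` or in `W`. The part in `Z` fits into `Z` beside `X`, the part in
-- `W` fits into `W` beside `X`; this counts `X` twice.
spread : ∀ {X Y Z W : List ℕ} → Unique X → Unique Y → (∀ {c} → c ∈ X → c ∉ Y) → X ⊑ Z → X ⊑ W →
         ¬ (∃[ q ] q ∈ Y × q ∉ Z × q ∉ W) → length X + (length X + length Y) ≤ length Z + length W
spread {X} {Y} {Z} {W} uX uY disj XZ XW none = begin
    x + (x + length Y)                  ≤⟨ +-monoʳ-≤ x (+-monoʳ-≤ x (≤-trans (unique-⊑-length uY split) (≤-reflexive (length-++ Y₁)))) ⟩
    x + (x + (length Y₁ + length Y₂))   ≡⟨ cong (x +_) (trans (sym (+-assoc x _ _)) (+-comm (x + length Y₁) _)) ⟩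
    x + (length Y₂ + (x + length Y₁))   ≡⟨ trans (sym (+-assoc x _ _)) (+-comm (x + length Y₂) _) ⟩
    (x + length Y₁) + (x + length Y₂)   ≤⟨ +-mono-≤ (part XZ) (part XW) ⟩
    length Z + length W                 ∎
  where
  open ≤-Reasoning
  x = length X
  Y₁ = filter (_∈ℕ? Z) Y
  Y₂ = filter (_∈ℕ? W) Y
  split : Y ⊑ Y₁ ++ Y₂
  split {q} j with q ∈ℕ? Z | q ∈ℕ? W
  ... | yes a | _ = ∈-++⁺ˡ (∈-filter⁺ (_∈ℕ? Z) j a)
  ... | no _ | yes b = ∈-++⁺ʳ Y₁ (∈-filter⁺ (_∈ℕ? W) j b)
  ... | no a | no b = contradiction (q , j , a , b) none
  part : ∀ {Z} → X ⊑ Z → x + length (filter (_∈ℕ? Z) Y) ≤ length Z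
  part {Z} XZ = union (λ i j → disj i (proj₁ (∈-filter⁻ (_∈ℕ? Z) {xs = Y} j))) uX (Unique.filter⁺ _ uY) XZ
    (proj₂ ∘ ∈-filter⁻ (_∈ℕ? Z) {xs = Y})

module PairLemma {X Y : List ℕ} (uX : Unique X) (uY : Unique Y) where

  Spares : List ℕ → ℕ → ℕ → Set
  Spares Z p q = ∃[ y ] Kills Z (y ∷ []) (p ∷ q ∷ [])

  same : ∀ {Z c} → Spares Z c c
  same {c = c} = c , at₀ ∷ at₀ ∷ []
  missₗ : ∀ {Z p q} → p ∉ Z → Spares Z p q
  missₗ {q = q} n = q , (λ i → contradiction i n) ∷ at₀ ∷ []
  missᵣ : ∀ {Z p q} → q ∉ Z → Spares Z p q
  missᵣ {p = p} n = p , at₀ ∷ (λ i → contradiction i n) ∷ []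

  meet-or-disjoint : (∃[ c ] c ∈ X × c ∈ Y) ⊎ (∀ {c} → c ∈ X → c ∉ Y)
  meet-or-disjoint with ∃∈? (_∈ℕ? Y) X
  ... | yes r = inj₁ r
  ... | no n = inj₂ λ i j → n (_ , i , j)

  subset? : ∀ W Z → (∃[ p ] p ∈ W × p ∉ Z) ⊎ W ⊑ Z
  subset? W Z with ∃∈? (λ p → ¬? (p ∈ℕ? Z)) W
  ... | yes r = inj₁ r
  ... | no n = inj₂ sub
    where
    sub : W ⊑ Z
    sub {p} i with p ∈ℕ? Z
    ... | yes j = j
    ... | no m = contradiction (p , i , m) n

  module _ (x₀ : ∃[ x ] x ∈ X) (y₀ : ∃[ y ] y ∈ Y) where

    single : ∀ Z → length Z < length X + length Y → ∃₂ λ p q → p ∈ X × q ∈ Y × Spares Z p q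
    single Z lt with meet-or-disjoint
    ... | inj₁ (c , i , j) = c , c , i , j , same
    ... | inj₂ disj with subset? X Z | subset? Y Z
    ...   | inj₁ (p , i , n) | _ = p , proj₁ y₀ , i , proj₂ y₀ , missₗ n
    ...   | _ | inj₁ (q , j , n) = proj₁ x₀ , q , proj₂ x₀ , j , missᵣ n
    ...   | inj₂ s | inj₂ t = contradiction (union disj uX uY s t) (<⇒≱ lt)

    -- A common colour of `X` and `Y` serves both lists, as does a colour missing from both;
    -- otherwise one colour must miss `Z` and the other `W`. The first two bounds exclude that `X`
    -- and `Y` lie in the same list, the last two that one of them lies in both lists while these
    -- cover the other.
    double : ∀ Z W → length Z < length X + length Y → length W < length X + length Y →
      length Z + length W < length X + (length X + length Y) →
      length Z + length W < length Y + (length X + length Y) →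
      ∃₂ λ p q → p ∈ X × q ∈ Y × Spares Z p q × Spares W p q
    double Z W l₁ l₂ l₃ l₄ with meet-or-disjoint
    ... | inj₁ (c , i , j) = c , c , i , j , same , same
    ... | inj₂ disj with ∃∈? (λ p → ¬? (p ∈ℕ? Z) ×-dec ¬? (p ∈ℕ? W)) X | ∃∈? (λ p → ¬? (p ∈ℕ? Z) ×-dec ¬? (p ∈ℕ? W)) Y
    ...   | yes (p , i , n , m) | _ = p , proj₁ y₀ , i , proj₂ y₀ , missₗ n , missₗ m
    ...   | no _ | yes (q , j , n , m) = proj₁ x₀ , q , proj₂ x₀ , j , missᵣ n , missᵣ m
    ...   | no bX | no bY with subset? X Z | subset? Y W | subset? X W | subset? Y Z
    ...     | inj₁ (p , i , n) | inj₁ (q , j , m) | _ | _ = p , q , i , j , missₗ n , missᵣ m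
    ...     | _ | _ | inj₁ (p , i , n) | inj₁ (q , j , m) = p , q , i , j , missᵣ m , missₗ n
    ...     | inj₂ XZ | _ | _ | inj₂ YZ = contradiction (union disj uX uY XZ YZ) (<⇒≱ l₁)
    ...     | _ | inj₂ YW | inj₂ XW | _ = contradiction (union disj uX uY XW YW) (<⇒≱ l₂)
    ...     | inj₂ XZ | inj₁ _ | inj₂ XW | inj₁ _ = contradiction (spread uX uY disj XZ XW bY) (<⇒≱ l₃)
    ...     | inj₁ _ | inj₂ YW | inj₁ _ | inj₂ YZ = contradiction
      (≤-trans (≤-reflexive (cong (length Y +_) (+-comm (length X) (length Y)))) (spread uY uX (λ j i → disj i j) YZ YW bX)) (<⇒≱ l₄)

-- Configurations, and the conditions on a colouring script

-- A configuration is a graph on the names 0, …, k − 1, given by a list of edges.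
Edges : Set
Edges = List (ℕ × ℕ)

nbs : Edges → ℕ → List ℕ
nbs [] i = []
nbs ((a , b) ∷ E) i with i ≟ a | i ≟ b
... | yes _ | _ = b ∷ nbs E i
... | no _ | yes _ = a ∷ nbs E i
... | no _ | no _ = nbs E i

two-step : Edges → ℕ → List ℕ
two-step E i = nbs E i ++ concatMap (nbs E) (nbs E i)

near : Edges → ℕ → List ℕ
near E i = deduplicate _≟_ (filter (λ j → ¬? (i ≟ j)) (two-step E i))

unique? : (xs : List ℕ) → Dec (Unique xs)
unique? = UniqueDec?.unique? _≟_

_∈²?_ : (x : ℕ × ℕ) (xs : List (ℕ × ℕ)) → Dec (x ∈ xs)
_∈²?_ = _∈?_ where open import Data.List.Membership.DecPropositional (Product.≡-dec _≟_ _≟_)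

Apart : List (ℕ × ℕ) → ℕ → ℕ → Set
Apart far i j = (i , j) ∈ far ⊎ (j , i) ∈ far

apart? : ∀ far i j → Dec (Apart far i j)
apart? far i j = (i , j) ∈²? far ⊎-dec (j , i) ∈²? far

bump : (ℕ → ℕ) → ℕ → ℕ → ℕ
bump m z i with i ≟ z
... | yes _ = suc (m i)
... | no _ = m i

lower : Edges → List ℕ → ℕ → ℕ
lower E R i = within (near E i)
  where
  within : List ℕ → ℕ
  within ns = length (filter (_∈ℕ? ns) R)

upper : List (ℕ × ℕ) → List ℕ → ℕ → ℕ
upper far R i = length (filter (λ j → ¬? (j ≟ i) ×-dec ¬? (apart? far i j)) R)

Gains : Edges → ℕ → ℕ → ℕ → Set
Gains E x y z = x ∈ near E z × y ∈ near E z

drop₂ : ℕ → ℕ → List ℕ → List ℕ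
drop₂ x y = filter (λ j → ¬? (j ≟ x) ×-dec ¬? (j ≟ y))

module Script (E : Edges) (far : List (ℕ × ℕ)) where
  lo up : List ℕ → ℕ → ℕ
  lo = lower E
  up = upper far

  -- lo R i and up R i bound the number of neighbours of i in G² that belong to R; m i counts how often i has
  -- been spared.
  StepOK : List ℕ → (ℕ → ℕ) → ℕ → ℕ → ℕ × ℕ ⊎ ℕ → Set
  StepOK R m x y (inj₂ z) = Gains E x y z × z ∈ R ×
    suc (suc (up R z + m z)) ≤ (lo R x + m x) + (lo R y + m y)
  StepOK R m x y (inj₁ (z , w)) = z ≢ w × Gains E x y z × Gains E x y w × z ∈ R × w ∈ R ×
    suc (suc (up R z + m z)) ≤ (lo R x + m x) + (lo R y + m y) ×
    suc (suc (up R w + m w)) ≤ (lo R x + m x) + (lo R y + m y) ×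
    suc (suc ((up R z + m z) + (up R w + m w))) ≤ (lo R x + m x) + ((lo R x + m x) + (lo R y + m y)) ×
    suc (suc ((up R z + m z) + (up R w + m w))) ≤ (lo R y + m y) + ((lo R x + m x) + (lo R y + m y))

  bumps : ℕ × ℕ ⊎ ℕ → (ℕ → ℕ) → ℕ → ℕ
  bumps (inj₁ (z , w)) m = bump (bump m z) w
  bumps (inj₂ z) m = bump m z

  OrderOK : (ℕ → ℕ) → List ℕ → Set
  OrderOK m [] = ⊤
  OrderOK m (w ∷ ws) = w ∉ ws × 2 ≤ length (filter (λ j → j ∈ℕ? near E w) ws) + m w × OrderOK m ws

  -- The bounds `2 ≤ lo R x + m x` and `2 ≤ lo R y + m y` ensure that `x` and `y` still have a
  -- colour each; they must be apart so that both may receive the same one.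
  StepsOK : List ℕ → (ℕ → ℕ) → List (ℕ × ℕ × (ℕ × ℕ ⊎ ℕ)) → List ℕ → Set
  StepsOK R m [] ws = R ⊑ᴬ ws × ws ⊑ᴬ R × OrderOK m ws
    where _⊑ᴬ_ : List ℕ → List ℕ → Set
          xs ⊑ᴬ ys = All (_∈ ys) xs
  StepsOK R m ((x , y , g) ∷ ss) ws = x ∈ R × y ∈ R × x ≢ y × Apart far x y × 2 ≤ lo R x + m x × 2 ≤ lo R y + m y ×
    StepOK R m x y g × StepsOK (drop₂ x y R) (bumps g m) ss ws

  StepOK? : ∀ R m x y g → Dec (StepOK R m x y g)
  StepOK? R m x y (inj₂ z) = (x ∈ℕ? _ ×-dec y ∈ℕ? _) ×-dec z ∈ℕ? R ×-dec _ ≤? _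
  StepOK? R m x y (inj₁ (z , w)) = ¬? (z ≟ w) ×-dec (x ∈ℕ? _ ×-dec y ∈ℕ? _) ×-dec (x ∈ℕ? _ ×-dec y ∈ℕ? _) ×-dec
    z ∈ℕ? R ×-dec w ∈ℕ? R ×-dec _ ≤? _ ×-dec _ ≤? _ ×-dec _ ≤? _ ×-dec _ ≤? _

  OrderOK? : ∀ m ws → Dec (OrderOK m ws)
  OrderOK? m [] = yes tt
  OrderOK? m (w ∷ ws) = ¬? (w ∈ℕ? ws) ×-dec _ ≤? _ ×-dec OrderOK? m ws

  StepsOK? : ∀ R m ss ws → Dec (StepsOK R m ss ws)
  StepsOK? R m [] ws = All.all? (_∈ℕ? ws) R ×-dec All.all? (_∈ℕ? R) ws ×-dec OrderOK? m ws
  StepsOK? R m ((x , y , g) ∷ ss) ws = x ∈ℕ? R ×-dec y ∈ℕ? R ×-dec ¬? (x ≟ y) ×-dec apart? far x y ×-dec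
    2 ≤? _ ×-dec 2 ≤? _ ×-dec StepOK? R m x y g ×-dec StepsOK? _ _ ss ws

-- Soundness of colouring scripts

module Engine {n} (G : Graph n) (L : Fin n → List ℕ) (uL : ∀ v → Unique (L v)) where
  open Colour G L uL public

  -- The copy need not be induced: G may have further edges between named vertices. So the edges
  -- give adjacencies in G², whereas non-adjacency has to come from `far`. The values of `h` from
  -- `k` on are junk.
  record Embed (k : ℕ) (E : Edges) : Set where
    field
      h     : ℕ → V
      inj   : ∀ {i j} → i < k → j < k → h i ≡ h j → i ≡ j
      edges : All (λ (a , b) → a < k × b < k × Adj G (h a) (h b)) E

  module Config {k E} (emb : Embed k E) where
    open Embed emb

    nbs-sound : ∀ {F i j} → All (λ (a , b) → a < k × b < k × Adj G (h a) (h b)) F → j ∈ nbs F i → i < k × j < k × Adj G (h i) (h j)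
    nbs-sound {(a , b) ∷ F} {i} (p ∷ ps) j∈ with i ≟ a | i ≟ b
    nbs-sound (p ∷ ps) (here refl) | yes refl | _ = p
    nbs-sound (p ∷ ps) (there j∈) | yes _ | _ = nbs-sound ps j∈
    nbs-sound ((a< , b< , ad) ∷ ps) (here refl) | no _ | yes refl = b< , a< , Adj-sym ad
    nbs-sound (p ∷ ps) (there j∈) | no _ | yes _ = nbs-sound ps j∈
    nbs-sound (p ∷ ps) j∈ | no _ | no _ = nbs-sound ps j∈

    nb : ∀ {i j} → j ∈ nbs E i → i < k × j < k × Adj G (h i) (h j)
    nb = nbs-sound edges

    near-sound : ∀ {i j} → j ∈ near E i → i < k × j < k × Adj² G (h i) (h j)
    near-sound {i} {j} j∈ with ∈-filter⁻ (λ j → ¬? (i ≟ j)) {xs = two-step E i} (∈-deduplicate⁻ _≟_ (filter (λ j → ¬? (i ≟ j)) (two-step E i)) j∈)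
    ... | j∈′ , i≢j with ∈-++⁻ (nbs E i) j∈′
    ...   | inj₁ p = let (a , b , c) = nb p in a , b , adj₁ c
    ...   | inj₂ p with find (∈-concatMap⁻ (nbs E) {xs = nbs E i} p)
    ...     | w , w∈ , j∈w = let (a , _ , c) = nb w∈ ; (_ , b , d) = nb j∈w in a , b , adj₂ (i≢j ∘ inj a b) c d

  module Run {k E} (far : List (ℕ × ℕ)) (emb : Embed k E) (far-sound : ∀ {i j} → (i , j) ∈ far → ¬ Adj² G (Embed.h emb i) (Embed.h emb j)) where
    open Script E far
    open Embed emb
    open Config emb

    apart : ∀ {i j} → Apart far i j → ¬ Adj² G (h i) (h j)
    apart (inj₁ p) = far-sound p
    apart (inj₂ p) = far-sound p ∘ Adj²-sym

    record St (c : PC) (R : List ℕ) (m : ℕ → ℕ) : Set where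
      field
        proper : Proper c
        uR     : Unique R
        R<k    : ∀ {i} → i ∈ R → i < k
        R-unc  : ∀ {i} → i ∈ R → Unc c (h i)
        unc-R  : ∀ {t} → Unc c t → ∃[ i ] i ∈ R × t ≡ h i
        slack  : ∀ {i} → i ∈ R → S c (h i) (m i)

    names-unique : ∀ {xs} → Unique xs → (∀ {i} → i ∈ xs → i < k) → Unique (map h xs)
    names-unique u f = map-unique h u λ i j → inj (f i) (f j)

    module State {c R m} (st : St c R m) where
      open St st

      lo≤ : ∀ {i} → i ∈ R → lo R i ≤ length (unc c (h i))
      lo≤ {i} i∈ = ≤-trans (≤-reflexive (sym (length-map h known)))
        (unc-lower (names-unique (Unique.filter⁺ _ uR) (R<k ∘ proj₁ ∘ flt)) λ t∈ →
           let (j , j∈ , e) = ∈-map⁻ h t∈ ; (j∈R , j∈n) = flt j∈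
           in subst (λ t → Adj² G (h i) t × Unc c t) (sym e) (proj₂ (proj₂ (near-sound j∈n)) , R-unc j∈R))
        where
        known = filter (λ j → j ∈ℕ? near E i) R
        flt : ∀ {j} → j ∈ known → j ∈ R × j ∈ near E i
        flt = ∈-filter⁻ (λ j → j ∈ℕ? near E i) {xs = R}

      up≥ : ∀ {i} → i ∈ R → length (unc c (h i)) ≤ up R i
      up≥ {i} i∈ = ≤-trans (unc-upper (map h poss) cover) (≤-reflexive (length-map h poss))
        where
        poss = filter (λ j → ¬? (j ≟ i) ×-dec ¬? (apart? far i j)) R
        cover : ∀ {t} → Adj² G (h i) t → Unc c t → t ∈ map h poss
        cover a u with unc-R u
        ... | j , j∈ , refl = ∈-map⁺ h (∈-filter⁺ (λ j → ¬? (j ≟ i) ×-dec ¬? (apart? far i j)) j∈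
                ((λ { refl → proj₁ a refl }) , λ ap → apart ap a))

      size : ∀ {i} → i ∈ R → lo R i + m i ≤ suc (length (avail c (h i)))
      size {i} i∈ = ≤-trans (+-monoˡ-≤ (m i) (lo≤ i∈)) (S.bound (slack i∈))

      nonempty : ∀ {i} → i ∈ R → 2 ≤ lo R i + m i → ∃[ p ] p ∈ avail c (h i)
      nonempty {i} i∈ le with avail c (h i) | size i∈
      ... | p ∷ _ | _ = p , here refl
      ... | [] | s = contradiction (≤-trans le s) λ { (s≤s ()) }

      -- The lemmas on pairs need an upper bound for the size of the list of z, hence the truncation.
      part : ℕ → List ℕ
      part z = take (length (unc c (h z)) + m z ∸ 1) (avail c (h z))

      part-length : ∀ {z} → z ∈ R → length (part z) ≡ length (unc c (h z)) + m z ∸ 1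
      part-length {z} z∈ = trans (length-take (length (unc c (h z)) + m z ∸ 1) (avail c (h z))) (m≤n⇒m⊓n≡m (∸-monoˡ-≤ 1 (S.bound (slack z∈))))

      part-unique : ∀ z → Unique (part z)
      part-unique z = Unique.take⁺ _ (avail-unique c (h z))

      part⊑ : ∀ z → part z ⊑ avail c (h z)
      part⊑ z = take-⊑ (length (unc c (h z)) + m z ∸ 1)

      part-up : ∀ {z} → z ∈ R → 1 ≤ length (unc c (h z)) → suc (length (part z)) ≤ up R z + m z
      part-up {z} z∈ 1≤ = ≤-trans (≤-reflexive (trans (cong suc (part-length z∈)) (m+[n∸m]≡n {1} (≤-trans 1≤ (m≤m+n _ (m z))))))
        (+-monoˡ-≤ (m z) (up≥ z∈))

      module Pick {x y} (x∈ : x ∈ R) (y∈ : y ∈ R) (x≢y : x ≢ y) (ap : Apart far x y)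
                  {p q} (p∈ : p ∈ avail c (h x)) (q∈ : q ∈ avail c (h y)) where
        as : Assignment
        as = (h x , p) ∷ (h y , q) ∷ []
        hx≢hy : h x ≢ h y
        hx≢hy = x≢y ∘ inj (R<k x∈) (R<k y∈)
        asg : Asg c as
        asg = (R-unc x∈ , (λ { (here e) → hx≢hy e }) , p∈ , λ { (here refl) a → contradiction a (apart ap) }) ∷
              (R-unc y∈ , (λ ()) , q∈ , λ ()) ∷ []
        c′ : PC
        c′ = upd c as

        R′ = drop₂ x y R
        flt : ∀ {i} → i ∈ R′ → i ∈ R × i ≢ x × i ≢ y
        flt = ∈-filter⁻ (λ j → ¬? (j ≟ x) ×-dec ¬? (j ≟ y)) {xs = R}

        -- Two coloured neighbours against one lost colour raise the slack by one.
        gain : ∀ {z} → z ∈ R → Gains E x y z → PairLemma.Spares (avail-unique c (h x)) (avail-unique c (h y)) (part z) p q →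
               S c′ (h z) (suc (m z))
        gain {z} z∈ (gx , gy) (l , kp ∷ kq ∷ []) = upd-S c as (h x ∷ h y ∷ []) (l ∷ []) (part-unique z) (part⊑ z)
          (λ { i (here refl) _ → kp i ; i (there (here refl)) _ → kq i })
          ((hx≢hy ∷ []) ∷ [] ∷ [])
          (λ { (here refl) → here refl , R-unc x∈ , ax ; (there (here refl)) → there (here refl) , R-unc y∈ , ay })
          (begin
            u + suc (m z) + 1               ≡⟨ trans (+-comm (u + suc (m z)) 1) (cong suc (+-suc u (m z))) ⟩
            suc (suc (u + m z))             ≡⟨ cong (suc ∘ suc) (m+[n∸m]≡n {1} (≤-trans 1≤u (m≤m+n u (m z)))) ⟨
            suc (suc (suc (u + m z ∸ 1)))   ≡⟨ cong (suc ∘ suc ∘ suc) (part-length z∈) ⟨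
            suc (suc (suc (length (part z)))) ≡⟨ +-comm 2 (suc (length (part z))) ⟩
            suc (length (part z)) + 2       ∎)
          where
          open ≤-Reasoning
          u = length (unc c (h z))
          ax = proj₂ (proj₂ (near-sound gx))
          ay = proj₂ (proj₂ (near-sound gy))
          1≤u : 1 ≤ u
          1≤u = ∈-length (unc⁺ c (h z) ax (R-unc x∈))

        slack′ : ∀ {i} → i ∈ R → S c′ (h i) (m i)
        slack′ i∈ = S-mono asg (slack i∈)

        next : ∀ (m′ : ℕ → ℕ) → (∀ {i} → i ∈ R → S c′ (h i) (m′ i)) → St c′ R′ m′
        next m′ sl = record
          { proper = upd-proper proper asg
          ; uR = Unique.filter⁺ _ uR
          ; R<k = R<k ∘ proj₁ ∘ flt
          ; R-unc = λ i∈ → let (j , nx , ny) = flt i∈ in upd-unc c as (R-unc j)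
              λ { (here e) → nx (inj (R<k j) (R<k x∈) e) ; (there (here e)) → ny (inj (R<k j) (R<k y∈) e) }
          ; unc-R = λ {t} u → let (u₀ , n∉) = upd-none c as u ; (i , i∈ , e) = unc-R u₀ in
              i , ∈-filter⁺ (λ j → ¬? (j ≟ x) ×-dec ¬? (j ≟ y)) i∈
                ((λ e′ → n∉ (here (trans e (cong h e′)))) , (λ e′ → n∉ (there (here (trans e (cong h e′)))))) , e
          ; slack = sl ∘ proj₁ ∘ flt
          }

        bumped : ∀ {m′ : ℕ → ℕ} {z} → (∀ {i} → i ∈ R → S c′ (h i) (m′ i)) → S c′ (h z) (suc (m′ z)) →
                 ∀ {i} → i ∈ R → S c′ (h i) (bump m′ z i)
        bumped {m′} {z} f s {i} i∈ with i ≟ z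
        ... | yes refl = s
        ... | no _ = f i∈

    order-sound : ∀ {c R m ws} → St c R m → All (_∈ R) ws → OrderOK m ws → Order c [] (map h ws)
    order-sound {ws = []} st _ _ = []
    order-sound {c} {R} {m} {w ∷ ws} st (w∈ ∷ ws∈) (w∉ , le , ok) =
      step (m w) (map h later) (R-unc w∈)
        (λ i → let (j , j∈ , e) = ∈-map⁻ h i in w∉ (subst (_∈ ws) (sym (inj (R<k w∈) (R<k (All.lookup ws∈ j∈)) e)) j∈))
        (λ ()) (names-unique (filter-unique (uniq ok)) (R<k ∘ All.lookup ws∈ ∘ proj₁ ∘ flt))
        (λ t∈ → let (j , j∈ , e) = ∈-map⁻ h t∈ ; (j∈ws , j∈n) = flt j∈ in
           subst (λ t → Adj² G (h w) t × Unc c t × (t ∈ map h ws ⊎ t ∈ [])) (sym e)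
             (proj₂ (proj₂ (near-sound j∈n)) , R-unc (All.lookup ws∈ j∈ws) , inj₁ (∈-map⁺ h j∈ws)))
        (slack w∈) (≤-trans le (≤-reflexive (cong (_+ m w) (sym (length-map h later)))))
        (order-sound st ws∈ ok)
      where
      open St st
      later = filter (λ j → j ∈ℕ? near E w) ws
      filter-unique : ∀ {xs} → Unique xs → Unique (filter (λ j → j ∈ℕ? near E w) xs)
      filter-unique = Unique.filter⁺ _
      flt : ∀ {j} → j ∈ later → j ∈ ws × j ∈ near E w
      flt = ∈-filter⁻ (λ j → j ∈ℕ? near E w) {xs = ws}
      uniq : ∀ {ws} → OrderOK m ws → Unique ws
      uniq {[]} _ = []
      uniq {_ ∷ _} (n , _ , o) = All-≢⁺ n ∷ uniq o

    run : ∀ {c R m} ss ws → St c R m → StepsOK R m ss ws → Done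
    run [] ws st (R⊑ , ws⊑ , ok) = finish (St.proper st) (order-sound st ws⊑ ok)
      λ u → let (i , i∈ , e) = St.unc-R st u in subst (_∈ map h ws) (sym e) (∈-map⁺ h (All.lookup R⊑ i∈))
    run {c} {R} {m} ((x , y , inj₂ z) ∷ ss) ws st (x∈ , y∈ , ne , ap , lx , ly , (g , z∈ , le) , rest)
      = go (PairLemma.single (avail-unique c (h x)) (avail-unique c (h y)) (nonempty x∈ lx) (nonempty y∈ ly) (part z)
             (sz z∈ (proj₁ g) le))
      where
      open State st
      -- At least `lo + m` minus one colours are available at `x` and at `y`, and at most `up + m`
      -- minus one are in `part z`. These offsets and the strict inequality make up the two `suc` in
      -- `StepOK`.
      sz : ∀ {z} → z ∈ R → x ∈ near E z → suc (suc (up R z + m z)) ≤ (lo R x + m x) + (lo R y + m y) →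
           length (part z) < length (avail c (h x)) + length (avail c (h y))
      sz {z} z∈ gx le = ≤-pred (≤-pred (≤-trans (s≤s (s≤s (part-up z∈ (∈-length (unc⁺ c (h z) (proj₂ (proj₂ (near-sound gx))) (St.R-unc st x∈)))))) (≤-trans le
           (≤-trans (+-mono-≤ (size x∈) (size y∈)) (≤-reflexive (cong suc (+-suc _ _)))))))
      go : (∃₂ λ p q → p ∈ avail c (h x) × q ∈ avail c (h y) × PairLemma.Spares (avail-unique c (h x)) (avail-unique c (h y)) (part z) p q) → Done
      go (p , q , p∈ , q∈ , sp) = run ss ws (next _ (bumped slack′ (gain z∈ g sp))) rest
        where open Pick x∈ y∈ ne ap p∈ q∈
    run {c} {R} {m} ((x , y , inj₁ (z , w)) ∷ ss) ws st
      (x∈ , y∈ , ne , ap , lx , ly , (z≢w , g , g′ , z∈ , w∈ , le₁ , le₂ , le₃ , le₄) , rest)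
      = go (PairLemma.double (avail-unique c (h x)) (avail-unique c (h y)) (nonempty x∈ lx) (nonempty y∈ ly) (part z) (part w)
             (s₁ (pu z∈ (proj₁ g)) le₁) (s₁ (pu w∈ (proj₁ g′)) le₂)
             (s₂ le₃ (≤-trans (+-mono-≤ (size x∈) (+-mono-≤ (size x∈) (size y∈))) (≤-reflexive (re a a b))))
             (s₂ le₄ (≤-trans (+-mono-≤ (size y∈) (+-mono-≤ (size x∈) (size y∈))) (≤-reflexive (re b a b)))))
      where
      open State st
      a = length (avail c (h x))
      b = length (avail c (h y))
      pu : ∀ {z} → z ∈ R → x ∈ near E z → suc (length (part z)) ≤ up R z + m z
      pu {z} z∈ gx = part-up z∈ (∈-length (unc⁺ c (h z) (proj₂ (proj₂ (near-sound gx))) (St.R-unc st x∈)))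
      s₁ : ∀ {z} → suc (length (part z)) ≤ up R z + m z → suc (suc (up R z + m z)) ≤ (lo R x + m x) + (lo R y + m y) →
           length (part z) < a + b
      s₁ pz le = ≤-pred (≤-pred (≤-trans (s≤s (s≤s pz)) (≤-trans le
           (≤-trans (+-mono-≤ (size x∈) (size y∈)) (≤-reflexive (cong suc (+-suc _ _)))))))
      re : ∀ a b c → suc a + (suc b + suc c) ≡ suc (suc (suc (a + (b + c))))
      re a b c = cong suc (trans (cong (a +_) (cong suc (+-suc b c))) (trans (+-suc a _) (cong suc (+-suc a _))))
      s₂ : ∀ {t r} → suc (suc ((up R z + m z) + (up R w + m w))) ≤ t → t ≤ suc (suc (suc r)) →
           length (part z) + length (part w) < r
      s₂ le le′ = ≤-pred (≤-pred (≤-pred (≤-trans (s≤s (s≤s (≤-trans (≤-reflexive (cong suc (sym (+-suc _ _))))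
           (+-mono-≤ (pu z∈ (proj₁ g)) (pu w∈ (proj₁ g′)))))) (≤-trans le le′))))
      go : (∃₂ λ p q → p ∈ avail c (h x) × q ∈ avail c (h y) ×
             PairLemma.Spares (avail-unique c (h x)) (avail-unique c (h y)) (part z) p q ×
             PairLemma.Spares (avail-unique c (h x)) (avail-unique c (h y)) (part w) p q) → Done
      go (p , q , p∈ , q∈ , sp , sp′) = run ss ws (next _ (bumped (bumped slack′ (gain z∈ g sp)) s-w)) rest
        where
        open Pick x∈ y∈ ne ap p∈ q∈
        s-w : S c′ (h w) (suc (bump m z w))
        s-w with w ≟ z
        ... | yes e = contradiction (sym e) z≢w
        ... | no _ = gain w∈ g′ sp′

-- An upper bound for the number of vertices within distance two of vertex i of a cubic graph that
-- contains the configuration E.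
reach : Edges → ℕ → ℕ
reach E i = length (near E i) + (sum (map (λ w → 3 ∸ length (nbs E w)) (nbs E i)) + (3 ∸ length (nbs E i)) * 3)

-- Nine is the eight colours plus the one in `S`. Truncation at zero is harmless, as slack 0 holds
-- at every vertex from the start.
slack₀ : Edges → ℕ → ℕ
slack₀ E i = 9 ∸ reach E i

-- Certificates for case distinctions on configurations

Extension : Set
Extension = ℕ × Edges

-- A repeated edge would put a neighbour twice into `nbs` and fail the tests for duplicate-free
-- neighbour lists.
addE : ℕ × ℕ → Edges → Edges
addE (i , j) E with j ∈ℕ? nbs E i
... | yes _ = E
... | no _ = (i , j) ∷ E

-- The configurations that can arise when x and y turn out to be at distance at most two (joins), or when the
-- third neighbour of v is revealed (grows): a new edge at known vertices, or a new vertex, which gets the name k.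
joins : ℕ → Edges → ℕ → ℕ → List Extension
joins k E x y = (k , addE (x , y) E) ∷ (suc k , (x , k) ∷ (y , k) ∷ E) ∷ map (λ z → k , addE (y , z) (addE (x , z) E)) (upTo k)

grows : ℕ → Edges → ℕ → List Extension
grows k E v = (suc k , (v , k) ∷ E) ∷ map (λ z → k , addE (v , z) E) (filter (λ z → ¬? (z ∈ℕ? nbs E v)) (upTo k))

-- script R far ss ws css: outside R colour everything first; for each (x , y , zs) in ss colour the pair x, y so
-- that the vertices zs are spared; finish greedily in the order ws.  The pairs in far must be non-adjacent
-- in G², and css handles the configurations in which they are adjacent.
-- known i ρ: the vertices ρ span a copy of the i-th solved configuration.
-- full v, loop v: impossible, v has four neighbours or is its own neighbour.
data Cert : Set where
  script : List ℕ → List (ℕ × ℕ) → List (ℕ × ℕ × (ℕ × ℕ ⊎ ℕ)) → List ℕ → List (List Cert) → Cert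
  grow   : ℕ → List Cert → Cert
  known  : ℕ → List ℕ → Cert
  full   : ℕ → Cert
  loop   : ℕ → Cert

lookupE : {A : Set} → A → List A → ℕ → A
lookupE d [] _ = d
lookupE d (x ∷ _) zero = x
lookupE d (_ ∷ xs) (suc i) = lookupE d xs i

lookupE-∈ : ∀ {A : Set} {d : A} {xs i} → i < length xs → lookupE d xs i ∈ xs
lookupE-∈ {xs = x ∷ xs} {zero} _ = here refl
lookupE-∈ {xs = x ∷ xs} {suc i} (s≤s lt) = there (lookupE-∈ lt)

lookupE-inj : ∀ {A : Set} {d : A} {xs i j} → Unique xs → i < length xs → j < length xs →
              lookupE d xs i ≡ lookupE d xs j → i ≡ j
lookupE-inj {xs = x ∷ xs} {zero} {zero} _ _ _ _ = refl
lookupE-inj {xs = x ∷ xs} {zero} {suc j} (x∉ ∷ _) _ (s≤s lt) e = contradiction e (All.lookup x∉ (lookupE-∈ lt))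
lookupE-inj {xs = x ∷ xs} {suc i} {zero} (x∉ ∷ _) (s≤s lt) _ e = contradiction (sym e) (All.lookup x∉ (lookupE-∈ lt))
lookupE-inj {xs = x ∷ xs} {suc i} {suc j} (_ ∷ u) (s≤s l₁) (s≤s l₂) e = cong suc (lookupE-inj u l₁ l₂ e)

module Checker (solved : List Extension) where

  -- `R` is non-empty and each of its vertices has a neighbour in `R`; this is what colouring
  -- everything outside `R` requires. Duplicate-free neighbour lists make `reach` a true upper
  -- bound.
  ScriptOK : ℕ → Edges → List ℕ → List (ℕ × ℕ) → List (ℕ × ℕ × (ℕ × ℕ ⊎ ℕ)) → List ℕ → Set
  ScriptOK k E R far ss ws = 1 ≤ length R × Unique R × All (λ i → Unique (nbs E i)) (upTo k) ×
    All (λ i → i < k × Any (_∈ R) (nbs E i)) R × Script.StepsOK E far R (slack₀ E) ss ws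

  ScriptOK? : ∀ k E R far ss ws → Dec (ScriptOK k E R far ss ws)
  ScriptOK? k E R far ss ws = 1 ≤? length R ×-dec unique? R ×-dec All.all? (λ i → unique? (nbs E i)) (upTo k) ×-dec
    All.all? (λ i → i <? k ×-dec Any.any? (_∈ℕ? R) (nbs E i)) R ×-dec Script.StepsOK? E far R (slack₀ E) ss ws

  Occurs : ℕ → Edges → Extension → List ℕ → Set
  Occurs k E (k₀ , E₀) ρ = length ρ ≡ k₀ × Unique ρ × All (_< k) ρ ×
    All (λ (a , b) → a < k₀ × b < k₀ × lookupE 0 ρ b ∈ nbs E (lookupE 0 ρ a)) E₀

  Occurs? : ∀ k E K ρ → Dec (Occurs k E K ρ)
  Occurs? k E (k₀ , E₀) ρ = length ρ ≟ k₀ ×-dec unique? ρ ×-dec All.all? (_<? k) ρ ×-dec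
    All.all? (λ (a , b) → a <? k₀ ×-dec b <? k₀ ×-dec lookupE 0 ρ b ∈ℕ? nbs E (lookupE 0 ρ a)) E₀

  mutual
    Valid : Extension → Cert → Set
    Valid (k , E) (script R far ss ws css) = ScriptOK k E R far ss ws × ValidFar k E far css
    Valid (k , E) (grow v cs) = v < k × Unique (nbs E v) × length (nbs E v) ≤ 2 × Valids (grows k E v) cs
    Valid (k , E) (known i ρ) = i < length solved × Occurs k E (lookupE (0 , []) solved i) ρ
    Valid (k , E) (full v) = Unique (nbs E v) × 4 ≤ length (nbs E v)
    Valid (k , E) (loop v) = v ∈ nbs E v

    Valids : List Extension → List Cert → Set
    Valids [] [] = ⊤
    Valids (K ∷ Ks) (c ∷ cs) = Valid K c × Valids Ks cs
    Valids [] (_ ∷ _) = ⊥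
    Valids (_ ∷ _) [] = ⊥

    ValidFar : ℕ → Edges → List (ℕ × ℕ) → List (List Cert) → Set
    ValidFar k E [] [] = ⊤
    ValidFar k E ((x , y) ∷ far) (cs ∷ css) = x < k × y < k × Valids (joins k E x y) cs × ValidFar k E far css
    ValidFar k E [] (_ ∷ _) = ⊥
    ValidFar k E (_ ∷ _) [] = ⊥

  mutual
    valid? : ∀ K c → Dec (Valid K c)
    valid? (k , E) (script R far ss ws css) = ScriptOK? k E R far ss ws ×-dec validFar? k E far css
    valid? (k , E) (grow v cs) = v <? k ×-dec unique? (nbs E v) ×-dec length (nbs E v) ≤? 2 ×-dec valids? (grows k E v) cs
    valid? (k , E) (known i ρ) = i <? length solved ×-dec Occurs? k E (lookupE (0 , []) solved i) ρ
    valid? (k , E) (full v) = unique? (nbs E v) ×-dec 4 ≤? length (nbs E v)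
    valid? (k , E) (loop v) = v ∈ℕ? nbs E v

    valids? : ∀ Ks cs → Dec (Valids Ks cs)
    valids? [] [] = yes tt
    valids? (K ∷ Ks) (c ∷ cs) = valid? K c ×-dec valids? Ks cs
    valids? [] (_ ∷ _) = no λ ()
    valids? (_ ∷ _) [] = no λ ()

    validFar? : ∀ k E far css → Dec (ValidFar k E far css)
    validFar? k E [] [] = yes tt
    validFar? k E ((x , y) ∷ far) (cs ∷ css) = x <? k ×-dec y <? k ×-dec valids? (joins k E x y) cs ×-dec validFar? k E far css
    validFar? k E [] (_ ∷ _) = no λ ()
    validFar? k E (_ ∷ _) [] = no λ ()

-- Slack before colouring in graphs of maximum degree three

module Subcubic {n} (G : Graph n) (L : Fin n → List ℕ) (uL : ∀ v → Unique (L v)) (len : ∀ v → length (L v) ≡ 8)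
                (conn : Connected G) (deg : MaxDegreeAtMost G 3) where
  open Engine G L uL public

  N : V → List V
  N v = filter (λ u → adj G v u Bool.≟ true) (allFin n)

  N⁺ : ∀ {v u} → Adj G v u → u ∈ N v
  N⁺ {v} a = ∈-filter⁺ (λ u → adj G v u Bool.≟ true) (∈-allFin _) a

  N⁻ : ∀ {v u} → u ∈ N v → Adj G v u
  N⁻ {v} i = proj₂ (∈-filter⁻ (λ u → adj G v u Bool.≟ true) {xs = allFin n} i)

  N-unique : ∀ v → Unique (N v)
  N-unique v = Unique.filter⁺ _ (Unique.allFin⁺ n)

  N-but : V → V → List V
  N-but z w = filter (λ u → ¬? (u Fin.≟ z)) (N w)

  N-but⁺ : ∀ {z w u} → u ≢ z → Adj G w u → u ∈ N-but z w
  N-but⁺ {z} ne a = ∈-filter⁺ (λ u → ¬? (u Fin.≟ z)) (N⁺ a) ne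

  N-but-length : ∀ {z w} → Adj G z w → length (N-but z w) ≤ 2
  N-but-length {z} {w} a = ≤-pred (≤-trans (filter-notAll (λ u → ¬? (u Fin.≟ z)) (N w) (Any.map (λ { refl n → n refl }) (N⁺ (Adj-sym a)))) (deg w))

  concatMap-length : ∀ {A B : Set} (f : A → List B) (b : A → ℕ) xs → (∀ {x} → x ∈ xs → length (f x) ≤ b x) →
                     length (concatMap f xs) ≤ sum (map b xs)
  concatMap-length f b [] _ = z≤n
  concatMap-length f b (x ∷ xs) le = ≤-trans (≤-reflexive (length-++ (f x))) (+-mono-≤ (le (here refl)) (concatMap-length f b xs (le ∘ there)))

  sum-const : ∀ {A : Set} k (xs : List A) → sum (map (λ _ → k) xs) ≡ length xs * k
  sum-const k [] = refl
  sum-const k (_ ∷ xs) = cong (k +_) (sum-const k xs)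

  ∅ : PC
  ∅ _ = nothing

  ∅-proper : Proper ∅
  ∅-proper = (λ ()) , λ _ ()

  ∅-slack : ∀ {z m} → length (unc ∅ z) + m ≤ 9 → S ∅ z m
  ∅-slack {z} le = mkS (≤-trans le (s≤s (≤-trans (≤-reflexive (sym (len z)))
    (unique-⊑-length (uL z) λ p∈ → avail⁺ ∅ z p∈ λ ()))))

  ball : ∀ z → length (unc ∅ z) ≤ length (N z) + sum (map (λ w → length (N-but z w)) (N z))
  ball z = ≤-trans (unc-upper (N z ++ concatMap (N-but z) (N z)) cover) (≤-trans (≤-reflexive (length-++ (N z)))
      (+-monoʳ-≤ (length (N z)) (concatMap-length (N-but z) (λ w → length (N-but z w)) (N z) (λ _ → ≤-refl))))
    where
    cover : ∀ {t} → Adj² G z t → Unc ∅ t → t ∈ N z ++ concatMap (N-but z) (N z)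
    cover (_ , inj₁ a) _ = ∈-++⁺ˡ (N⁺ a)
    cover (ne , inj₂ (w , a , b)) _ = ∈-++⁺ʳ (N z) (∈-concatMap⁺ (N-but z) (lose (N⁺ a) (N-but⁺ (ne ∘ sym) b)))

  sum-≤ : ∀ {A : Set} (f : A → ℕ) k xs → (∀ {x} → x ∈ xs → f x ≤ k) → sum (map f xs) ≤ length xs * k
  sum-≤ f k [] _ = z≤n
  sum-≤ f k (x ∷ xs) le = +-mono-≤ (le (here refl)) (sum-≤ f k xs (le ∘ there))

  ∅-nine : ∀ z → length (unc ∅ z) ≤ 9
  ∅-nine z = ≤-trans (ball z) (+-mono-≤ (deg z) (≤-trans (sum-≤ _ 2 (N z) (N-but-length ∘ N⁻)) (*-monoˡ-≤ 2 (deg z))))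

  S₀ : ∀ {z} → S ∅ z 0
  S₀ {z} = ∅-slack (≤-trans (≤-reflexive (+-identityʳ _)) (∅-nine z))

  walk-path : ∀ {x y} → Walk G x y → Path (Unc ∅) x y
  walk-path here = end refl
  walk-path (step a w) = edge refl a (walk-path w)

  -- The order grown outwards from `R` demands slack 0 only. Slacks computed in the uncoloured graph
  -- carry over to the vertices of `R`.
  outside : (R : List V) → Unique R → (r₀ : V) → r₀ ∈ R → (∀ {r} → r ∈ R → ∃[ r′ ] r′ ∈ R × Adj G r r′) →
    ∃[ c ] Proper c × (∀ {t} → Unc c t → t ∈ R) × (∀ {t} → t ∈ R → Unc c t) × (∀ {z m} → S ∅ z m → S c z m)
  outside R uR r₀ r₀∈ R-nb with Grow.result ∅ (λ _ → S₀) R uR r₀ r₀∈ R-nb (λ _ → refl) (λ _ → walk-path (conn _ _))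
  ... | T , o , all with greedy ∅-proper o
  ...   | c , P , f , g , mono = c , P , f′ , (λ {t} i → g refl (R∉T i)) , mono
    where
    f′ : ∀ {t} → Unc c t → t ∈ R
    f′ {t} u with ∈-++⁻ T (all {t} refl)
    ... | inj₁ i = contradiction i (proj₂ (f u))
    ... | inj₂ i = i
    disj : ∀ {ws} → Order ∅ R ws → ∀ {t} → t ∈ ws → t ∉ R
    disj (step _ _ _ _ n _ _ _ _ _) (here refl) = n
    disj (step _ _ _ _ _ _ _ _ _ o) (there i) = disj o i
    R∉T : ∀ {t} → t ∈ R → t ∉ T
    R∉T i j = disj o j i

-- The configurations and their certificates

triangle : Extension
triangle = 3 , (0 , 1) ∷ (1 , 2) ∷ (2 , 0) ∷ []

square : Extension
square = 4 , (0 , 1) ∷ (1 , 2) ∷ (2 , 3) ∷ (3 , 0) ∷ []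

-- It has no certificate of its own and counts as solved only where the shortest loop has length at
-- least six, so that it cannot occur.
pentagon : Extension
pentagon = 5 , (0 , 1) ∷ (1 , 2) ∷ (2 , 3) ∷ (3 , 4) ∷ (4 , 0) ∷ []

petersen : Extension
petersen = 10 , (0 , 1) ∷ (1 , 2) ∷ (2 , 3) ∷ (3 , 4) ∷ (4 , 0) ∷ (5 , 7) ∷ (7 , 9) ∷ (9 , 6) ∷ (6 , 8) ∷ (8 , 5) ∷ (0 , 5) ∷ (1 ,
  6) ∷ (2 , 7) ∷ (3 , 8) ∷ (4 , 9) ∷ []

-- In the names of theta graphs, the indices are the lengths of the three paths.
theta₁₄₄ : Extension
theta₁₄₄ = 8 , (0 , 1) ∷ (1 , 2) ∷ (2 , 3) ∷ (3 , 4) ∷ (4 , 0) ∷ (0 , 5) ∷ (1 , 6) ∷ (5 , 7) ∷ (6 , 7) ∷ []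

theta₂₃₃ : Extension
theta₂₃₃ = 7 , (0 , 1) ∷ (1 , 2) ∷ (2 , 3) ∷ (3 , 4) ∷ (4 , 0) ∷ (0 , 5) ∷ (2 , 6) ∷ (5 , 6) ∷ []

theta₂₃₄ : Extension
theta₂₃₄ = 8 , (0 , 1) ∷ (1 , 2) ∷ (2 , 3) ∷ (3 , 4) ∷ (4 , 0) ∷ (0 , 5) ∷ (2 , 6) ∷ (5 , 7) ∷ (6 , 7) ∷ []

theta₂₄₄ : Extension
theta₂₄₄ = 9 , (0 , 1) ∷ (1 , 2) ∷ (2 , 3) ∷ (3 , 4) ∷ (4 , 5) ∷ (5 , 0) ∷ (0 , 6) ∷ (2 , 7) ∷ (6 , 8) ∷ (7 , 8) ∷ []

theta₃₃₃ : Extension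
theta₃₃₃ = 8 , (0 , 1) ∷ (1 , 2) ∷ (2 , 3) ∷ (3 , 4) ∷ (4 , 5) ∷ (5 , 0) ∷ (0 , 6) ∷ (3 , 7) ∷ (6 , 7) ∷ []

theta₃₃₄ : Extension
theta₃₃₄ = 9 , (0 , 1) ∷ (1 , 2) ∷ (2 , 3) ∷ (3 , 4) ∷ (4 , 5) ∷ (5 , 0) ∷ (0 , 6) ∷ (3 , 7) ∷ (6 , 8) ∷ (7 , 8) ∷ []

theta₃₄₄ : Extension
theta₃₄₄ = 10 , (0 , 1) ∷ (1 , 2) ∷ (2 , 3) ∷ (3 , 4) ∷ (4 , 5) ∷ (5 , 6) ∷ (6 , 0) ∷ (0 , 7) ∷ (3 , 8) ∷ (7 , 9) ∷ (8 , 9) ∷ []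

triangle-cert : Cert
triangle-cert =
  script (0 ∷ 1 ∷ []) [] [] (1 ∷ 0 ∷ []) []

square-cert : Cert
square-cert =
  grow 2 ((script (0 ∷ 1 ∷ 2 ∷ 3 ∷ 4 ∷ []) ((0 , 4) ∷ []) ((0 , 4 , inj₂ 2) ∷ []) (3 ∷ 1 ∷ 2 ∷ []) (((script (0 ∷ 1 ∷
  2 ∷ []) [] [] (2 ∷ 1 ∷ 0 ∷ []) []) ∷ (grow 4 ((script (0 ∷ 1 ∷ 2 ∷ 3 ∷ 4 ∷ 5 ∷ 6 ∷ []) ((0 , 6) ∷ []) ((0 , 6 , inj₂
  2) ∷ []) (5 ∷ 4 ∷ 3 ∷ 1 ∷ 2 ∷ []) (((full 0) ∷ (full 0) ∷ (loop 0) ∷ (script (0 ∷ 1 ∷ 2 ∷ 4 ∷ []) [] [] (4 ∷ 2 ∷ 0 ∷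
  1 ∷ []) []) ∷ (full 0) ∷ (script (0 ∷ 2 ∷ 3 ∷ 4 ∷ []) [] [] (4 ∷ 3 ∷ 0 ∷ 2 ∷ []) []) ∷ (full 0) ∷ (known 0 (4 ∷ 5 ∷
  6 ∷ [])) ∷ (loop 6) ∷ []) ∷ [])) ∷ (full 0) ∷ (known 0 (1 ∷ 2 ∷ 4 ∷ [])) ∷ (known 0 (2 ∷ 3 ∷ 4 ∷ [])) ∷ (loop 4) ∷
  [])) ∷ (loop 0) ∷ (known 0 (1 ∷ 2 ∷ 4 ∷ [])) ∷ (full 2) ∷ (known 0 (2 ∷ 3 ∷ 4 ∷ [])) ∷ (loop 4) ∷ []) ∷ [])) ∷
  (known 0 (0 ∷ 1 ∷ 2 ∷ [])) ∷ (loop 2) ∷ [])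

theta₂₃₄-cert : Cert
theta₂₃₄-cert =
  script (0 ∷ 1 ∷ 2 ∷ 3 ∷ 4 ∷ 5 ∷ 6 ∷ 7 ∷ []) ((5 , 3) ∷ (4 , 7) ∷ (6 , 0) ∷ []) ((5 , 3 , inj₁ (1 , 6)) ∷ (4 , 7 ,
  inj₂ 0) ∷ (6 , 0 , inj₁ (1 , 2)) ∷ []) (2 ∷ 1 ∷ []) (((known 1 (0 ∷ 4 ∷ 3 ∷ 5 ∷ [])) ∷ (script (0 ∷ 1 ∷ 2 ∷ 3 ∷ 4 ∷
  5 ∷ 6 ∷ 7 ∷ 8 ∷ []) ((6 , 0) ∷ (5 , 2) ∷ (3 , 7) ∷ []) ((6 , 0 , inj₁ (1 , 3)) ∷ (5 , 2 , inj₁ (1 , 7)) ∷ []) (7 ∷ 8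
  ∷ 4 ∷ 3 ∷ 1 ∷ []) (((full 0) ∷ (full 0) ∷ (loop 0) ∷ (known 0 (1 ∷ 2 ∷ 6 ∷ [])) ∷ (full 0) ∷ (full 0) ∷ (known 1 (2
  ∷ 3 ∷ 4 ∷ 6 ∷ [])) ∷ (full 5) ∷ (loop 6) ∷ (full 0) ∷ (full 0) ∷ []) ∷ ((full 2) ∷ (full 2) ∷ (full 0) ∷ (full 5) ∷
  (loop 2) ∷ (full 3) ∷ (full 2) ∷ (loop 5) ∷ (full 5) ∷ (full 2) ∷ (full 2) ∷ []) ∷ ((full 3) ∷ (full 3) ∷ (full 0) ∷
  (full 1) ∷ (full 2) ∷ (loop 3) ∷ (known 1 (0 ∷ 4 ∷ 7 ∷ 5 ∷ [])) ∷ (full 3) ∷ (full 3) ∷ (loop 7) ∷ (known 0 (5 ∷ 7 ∷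
  8 ∷ [])) ∷ []) ∷ [])) ∷ (full 0) ∷ (full 1) ∷ (full 2) ∷ (loop 3) ∷ (known 0 (0 ∷ 4 ∷ 5 ∷ [])) ∷ (loop 5) ∷ (full 6)
  ∷ (known 1 (2 ∷ 3 ∷ 7 ∷ 6 ∷ [])) ∷ []) ∷ ((known 1 (0 ∷ 4 ∷ 7 ∷ 5 ∷ [])) ∷ (script (0 ∷ 1 ∷ 2 ∷ 3 ∷ 4 ∷ 5 ∷ 6 ∷ 7 ∷
  8 ∷ []) ((8 , 2) ∷ (6 , 0) ∷ (1 , 7) ∷ (3 , 7) ∷ []) ((8 , 2 , inj₂ 3) ∷ (6 , 0 , inj₁ (1 , 3)) ∷ []) (7 ∷ 5 ∷ 4 ∷ 1
  ∷ 3 ∷ []) (((full 2) ∷ (full 2) ∷ (full 0) ∷ (known 1 (0 ∷ 1 ∷ 8 ∷ 4 ∷ [])) ∷ (loop 2) ∷ (known 0 (3 ∷ 4 ∷ 8 ∷ []))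
  ∷ (full 2) ∷ (full 2) ∷ (known 0 (6 ∷ 7 ∷ 8 ∷ [])) ∷ (full 2) ∷ (loop 8) ∷ []) ∷ ((full 0) ∷ (full 0) ∷ (loop 0) ∷
  (known 0 (1 ∷ 2 ∷ 6 ∷ [])) ∷ (full 0) ∷ (full 0) ∷ (full 4) ∷ (known 0 (5 ∷ 6 ∷ 7 ∷ [])) ∷ (loop 6) ∷ (full 0) ∷
  (full 0) ∷ []) ∷ ((full 7) ∷ (full 7) ∷ (full 0) ∷ (loop 1) ∷ (full 2) ∷ (full 3) ∷ (full 4) ∷ (known 0 (0 ∷ 1 ∷ 5 ∷
  [])) ∷ (known 0 (1 ∷ 2 ∷ 6 ∷ [])) ∷ (loop 7) ∷ (known 1 (0 ∷ 1 ∷ 8 ∷ 4 ∷ [])) ∷ []) ∷ ((full 7) ∷ (full 7) ∷ (full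
  0) ∷ (full 1) ∷ (full 2) ∷ (loop 3) ∷ (full 4) ∷ (known 1 (0 ∷ 4 ∷ 3 ∷ 5 ∷ [])) ∷ (known 0 (2 ∷ 3 ∷ 6 ∷ [])) ∷ (loop
  7) ∷ (known 0 (3 ∷ 4 ∷ 8 ∷ [])) ∷ []) ∷ [])) ∷ (full 0) ∷ (full 1) ∷ (full 2) ∷ (known 1 (2 ∷ 3 ∷ 7 ∷ 6 ∷ [])) ∷
  (loop 4) ∷ (known 0 (0 ∷ 4 ∷ 5 ∷ [])) ∷ (known 1 (2 ∷ 3 ∷ 4 ∷ 6 ∷ [])) ∷ (loop 7) ∷ []) ∷ ((full 0) ∷ (full 0) ∷
  (loop 0) ∷ (known 0 (1 ∷ 2 ∷ 6 ∷ [])) ∷ (full 0) ∷ (full 0) ∷ (known 1 (2 ∷ 3 ∷ 4 ∷ 6 ∷ [])) ∷ (known 0 (5 ∷ 6 ∷ 7 ∷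
  [])) ∷ (loop 6) ∷ (full 0) ∷ []) ∷ [])

theta₁₄₄-cert : Cert
theta₁₄₄-cert =
  grow 5 ((grow 6 ((grow 2 ((grow 7 ((grow 3 ((script (0 ∷ 1 ∷ 2 ∷ 3 ∷ 4 ∷ 5 ∷ 6 ∷ 7 ∷ 12 ∷ []) ((6 , 3) ∷ (12 , 0) ∷
  (1 , 12) ∷ (2 , 5) ∷ (2 , 7) ∷ []) ((6 , 3 , inj₁ (1 , 2)) ∷ (12 , 0 , inj₂ 2) ∷ []) (7 ∷ 5 ∷ 4 ∷ 1 ∷ 2 ∷ [])
  (((full 3) ∷ (full 3) ∷ (full 0) ∷ (full 1) ∷ (full 2) ∷ (loop 3) ∷ (full 6) ∷ (full 3) ∷ (loop 6) ∷ (full 3) ∷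
  (full 3) ∷ (full 3) ∷ (full 3) ∷ (full 3) ∷ (full 6) ∷ []) ∷ ((full 0) ∷ (full 0) ∷ (loop 0) ∷ (full 1) ∷ (full 0) ∷
  (full 0) ∷ (known 0 (3 ∷ 4 ∷ 12 ∷ [])) ∷ (full 5) ∷ (full 0) ∷ (full 0) ∷ (full 0) ∷ (full 0) ∷ (full 0) ∷ (full 0)
  ∷ (loop 12) ∷ []) ∷ ((full 1) ∷ (full 1) ∷ (full 0) ∷ (loop 1) ∷ (full 2) ∷ (full 1) ∷ (full 1) ∷ (full 1) ∷ (full
  6) ∷ (full 1) ∷ (full 1) ∷ (full 1) ∷ (full 1) ∷ (full 1) ∷ (loop 12) ∷ []) ∷ ((full 2) ∷ (full 2) ∷ (full 0) ∷
  (full 1) ∷ (loop 2) ∷ (full 3) ∷ (full 2) ∷ (loop 5) ∷ (full 2) ∷ (full 2) ∷ (full 2) ∷ (full 2) ∷ (full 5) ∷ (full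
  2) ∷ (full 2) ∷ []) ∷ ((full 2) ∷ (full 2) ∷ (full 0) ∷ (full 1) ∷ (loop 2) ∷ (full 3) ∷ (full 2) ∷ (full 2) ∷ (full
  2) ∷ (loop 7) ∷ (full 2) ∷ (full 2) ∷ (full 7) ∷ (full 2) ∷ (full 2) ∷ []) ∷ [])) ∷ (full 0) ∷ (full 1) ∷ (loop 3) ∷
  (full 5) ∷ (full 6) ∷ (full 7) ∷ (known 2 (1 ∷ 0 ∷ 5 ∷ 7 ∷ 6 ∷ 2 ∷ 8 ∷ 3 ∷ [])) ∷ (known 2 (0 ∷ 1 ∷ 6 ∷ 7 ∷ 5 ∷ 4 ∷
  9 ∷ 3 ∷ [])) ∷ (known 0 (2 ∷ 3 ∷ 10 ∷ [])) ∷ (known 2 (0 ∷ 4 ∷ 3 ∷ 2 ∷ 1 ∷ 5 ∷ 11 ∷ 7 ∷ [])) ∷ [])) ∷ (full 0) ∷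
  (full 1) ∷ (full 2) ∷ (script (0 ∷ 1 ∷ 2 ∷ 3 ∷ 4 ∷ 5 ∷ 6 ∷ 7 ∷ 10 ∷ []) ((10 , 0) ∷ (5 , 2) ∷ []) ((10 , 0 , inj₂ 1)
  ∷ (5 , 2 , inj₁ (1 , 3)) ∷ []) (7 ∷ 6 ∷ 4 ∷ 3 ∷ 1 ∷ []) (((full 0) ∷ (full 0) ∷ (loop 0) ∷ (full 1) ∷ (full 0) ∷
  (full 0) ∷ (known 1 (2 ∷ 3 ∷ 4 ∷ 10 ∷ [])) ∷ (full 5) ∷ (full 0) ∷ (full 0) ∷ (full 0) ∷ (full 0) ∷ (loop 10) ∷ [])
  ∷ ((full 2) ∷ (full 2) ∷ (full 0) ∷ (full 1) ∷ (loop 2) ∷ (full 3) ∷ (full 2) ∷ (loop 5) ∷ (full 2) ∷ (full 2) ∷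
  (full 2) ∷ (full 2) ∷ (full 5) ∷ []) ∷ [])) ∷ (known 1 (0 ∷ 4 ∷ 7 ∷ 5 ∷ [])) ∷ (loop 7) ∷ (known 0 (5 ∷ 7 ∷ 8 ∷ []))
  ∷ (known 0 (6 ∷ 7 ∷ 9 ∷ [])) ∷ (known 2 (0 ∷ 1 ∷ 2 ∷ 3 ∷ 4 ∷ 5 ∷ 10 ∷ 7 ∷ [])) ∷ [])) ∷ (full 0) ∷ (loop 2) ∷ (known
  0 (2 ∷ 3 ∷ 4 ∷ [])) ∷ (full 5) ∷ (full 6) ∷ (known 1 (1 ∷ 2 ∷ 7 ∷ 6 ∷ [])) ∷ (grow 3 ((script (0 ∷ 1 ∷ 2 ∷ 3 ∷ 4 ∷ 5
  ∷ 6 ∷ 7 ∷ 8 ∷ []) ((2 , 7) ∷ (5 , 3) ∷ (6 , 3) ∷ []) ((2 , 7 , inj₁ (1 , 6)) ∷ (5 , 3 , inj₂ 1) ∷ []) (8 ∷ 4 ∷ 0 ∷ 6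
  ∷ 1 ∷ []) (((full 2) ∷ (full 2) ∷ (full 0) ∷ (full 1) ∷ (loop 2) ∷ (full 3) ∷ (full 2) ∷ (full 2) ∷ (full 2) ∷ (loop
  7) ∷ (known 0 (5 ∷ 7 ∷ 8 ∷ [])) ∷ (full 2) ∷ (full 2) ∷ []) ∷ ((full 3) ∷ (full 3) ∷ (full 0) ∷ (full 1) ∷ (full 2)
  ∷ (loop 3) ∷ (full 5) ∷ (loop 5) ∷ (full 3) ∷ (full 3) ∷ (full 3) ∷ (full 3) ∷ (full 5) ∷ []) ∷ ((full 3) ∷ (full 3)
  ∷ (full 0) ∷ (full 1) ∷ (full 2) ∷ (loop 3) ∷ (full 6) ∷ (full 3) ∷ (loop 6) ∷ (full 3) ∷ (full 3) ∷ (full 3) ∷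
  (full 6) ∷ []) ∷ [])) ∷ (full 0) ∷ (full 1) ∷ (loop 3) ∷ (full 5) ∷ (full 6) ∷ (grow 4 ((script (0 ∷ 1 ∷ 2 ∷ 3 ∷ 4 ∷
  5 ∷ 6 ∷ 7 ∷ 10 ∷ []) ((10 , 1) ∷ (6 , 4) ∷ []) ((10 , 1 , inj₂ 3) ∷ (6 , 4 , inj₁ (3 , 7)) ∷ []) (5 ∷ 2 ∷ 0 ∷ 7 ∷ 3
  ∷ []) (((full 1) ∷ (full 1) ∷ (full 0) ∷ (loop 1) ∷ (full 2) ∷ (full 1) ∷ (full 1) ∷ (full 1) ∷ (full 6) ∷ (full 1)
  ∷ (full 1) ∷ (full 1) ∷ (loop 10) ∷ []) ∷ ((full 4) ∷ (full 4) ∷ (full 0) ∷ (full 1) ∷ (full 2) ∷ (full 3) ∷ (loop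
  4) ∷ (full 4) ∷ (loop 6) ∷ (full 4) ∷ (full 4) ∷ (full 4) ∷ (full 6) ∷ []) ∷ [])) ∷ (full 1) ∷ (full 2) ∷ (loop 4) ∷
  (full 5) ∷ (full 6) ∷ (full 7) ∷ (known 1 (0 ∷ 4 ∷ 8 ∷ 5 ∷ [])) ∷ (script (0 ∷ 1 ∷ 2 ∷ 3 ∷ 4 ∷ 5 ∷ 6 ∷ 7 ∷ 8 ∷ 9 ∷
  []) ((8 , 6) ∷ (9 , 5) ∷ []) ((8 , 6 , inj₁ (1 , 3)) ∷ (9 , 5 , inj₂ 1) ∷ []) (7 ∷ 4 ∷ 2 ∷ 0 ∷ 3 ∷ 1 ∷ []) (((full
  6) ∷ (full 6) ∷ (full 0) ∷ (full 1) ∷ (full 2) ∷ (full 3) ∷ (full 4) ∷ (full 5) ∷ (loop 6) ∷ (full 7) ∷ (loop 8) ∷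
  (known 3 (0 ∷ 1 ∷ 2 ∷ 3 ∷ 4 ∷ 5 ∷ 6 ∷ 8 ∷ 7 ∷ 9 ∷ [])) ∷ []) ∷ ((full 5) ∷ (full 5) ∷ (full 0) ∷ (full 1) ∷ (full 2)
  ∷ (full 3) ∷ (full 4) ∷ (loop 5) ∷ (full 5) ∷ (full 7) ∷ (known 3 (0 ∷ 1 ∷ 2 ∷ 3 ∷ 4 ∷ 5 ∷ 6 ∷ 8 ∷ 7 ∷ 9 ∷ [])) ∷
  (loop 9) ∷ []) ∷ [])) ∷ [])) ∷ (known 0 (2 ∷ 3 ∷ 8 ∷ [])) ∷ (known 2 (0 ∷ 1 ∷ 6 ∷ 7 ∷ 5 ∷ 4 ∷ 9 ∷ 3 ∷ [])) ∷ [])) ∷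
  (known 1 (1 ∷ 2 ∷ 9 ∷ 6 ∷ [])) ∷ [])) ∷ (full 0) ∷ (known 0 (1 ∷ 2 ∷ 6 ∷ [])) ∷ (known 1 (1 ∷ 2 ∷ 3 ∷ 6 ∷ [])) ∷
  (known 1 (0 ∷ 1 ∷ 6 ∷ 4 ∷ [])) ∷ (full 5) ∷ (loop 6) ∷ (known 1 (5 ∷ 7 ∷ 6 ∷ 8 ∷ [])) ∷ [])) ∷ (full 1) ∷ (known 1
  (0 ∷ 1 ∷ 2 ∷ 5 ∷ [])) ∷ (known 1 (0 ∷ 4 ∷ 3 ∷ 5 ∷ [])) ∷ (known 0 (0 ∷ 4 ∷ 5 ∷ [])) ∷ (loop 5) ∷ (known 0 (5 ∷ 6 ∷ 7
  ∷ [])) ∷ [])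

theta₂₃₃-cert : Cert
theta₂₃₃-cert =
  grow 5 ((grow 6 ((grow 1 ((grow 3 ((grow 4 ((script (0 ∷ 1 ∷ 2 ∷ 3 ∷ 4 ∷ 5 ∷ 6 ∷ 10 ∷ []) ((10 , 0) ∷ (6 , 4) ∷ (3 ,
  5) ∷ []) ((10 , 0 , inj₂ 3) ∷ (6 , 4 , inj₁ (1 , 3)) ∷ []) (5 ∷ 2 ∷ 1 ∷ 3 ∷ []) (((full 0) ∷ (full 0) ∷ (loop 0) ∷
  (full 1) ∷ (full 0) ∷ (full 0) ∷ (full 4) ∷ (full 5) ∷ (full 0) ∷ (full 0) ∷ (full 0) ∷ (full 0) ∷ (loop 10) ∷ (full
  0) ∷ []) ∷ ((full 4) ∷ (full 4) ∷ (full 0) ∷ (full 1) ∷ (full 2) ∷ (full 3) ∷ (loop 4) ∷ (full 4) ∷ (loop 6) ∷ (full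
  4) ∷ (full 4) ∷ (full 4) ∷ (full 4) ∷ (full 6) ∷ []) ∷ ((full 3) ∷ (full 3) ∷ (full 0) ∷ (full 1) ∷ (full 2) ∷ (loop
  3) ∷ (full 4) ∷ (loop 5) ∷ (full 3) ∷ (full 3) ∷ (full 3) ∷ (full 3) ∷ (full 5) ∷ (full 3) ∷ []) ∷ [])) ∷ (full 1) ∷
  (full 2) ∷ (loop 4) ∷ (full 5) ∷ (full 6) ∷ (known 1 (0 ∷ 4 ∷ 7 ∷ 5 ∷ [])) ∷ (known 3 (0 ∷ 4 ∷ 3 ∷ 2 ∷ 1 ∷ 5 ∷ 8 ∷ 6
  ∷ [])) ∷ (known 1 (0 ∷ 1 ∷ 9 ∷ 4 ∷ [])) ∷ (known 0 (3 ∷ 4 ∷ 10 ∷ [])) ∷ [])) ∷ (full 0) ∷ (full 1) ∷ (loop 3) ∷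
  (full 5) ∷ (full 6) ∷ (known 3 (0 ∷ 5 ∷ 6 ∷ 2 ∷ 1 ∷ 4 ∷ 7 ∷ 3 ∷ [])) ∷ (known 1 (2 ∷ 3 ∷ 8 ∷ 6 ∷ [])) ∷ (known 1 (1
  ∷ 2 ∷ 3 ∷ 9 ∷ [])) ∷ [])) ∷ (loop 1) ∷ (known 0 (1 ∷ 2 ∷ 3 ∷ [])) ∷ (known 0 (0 ∷ 1 ∷ 4 ∷ [])) ∷ (full 5) ∷ (full 6)
  ∷ (known 1 (0 ∷ 1 ∷ 7 ∷ 5 ∷ [])) ∷ (known 1 (1 ∷ 2 ∷ 6 ∷ 8 ∷ [])) ∷ [])) ∷ (full 0) ∷ (known 0 (1 ∷ 2 ∷ 6 ∷ [])) ∷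
  (known 0 (2 ∷ 3 ∷ 6 ∷ [])) ∷ (known 1 (0 ∷ 4 ∷ 6 ∷ 5 ∷ [])) ∷ (loop 6) ∷ (known 0 (5 ∷ 6 ∷ 7 ∷ [])) ∷ [])) ∷ (known
  0 (0 ∷ 1 ∷ 5 ∷ [])) ∷ (full 2) ∷ (known 1 (0 ∷ 4 ∷ 3 ∷ 5 ∷ [])) ∷ (known 0 (0 ∷ 4 ∷ 5 ∷ [])) ∷ (loop 5) ∷ [])

theta₂₄₄-cert : Cert
theta₂₄₄-cert =
  script (0 ∷ 1 ∷ 2 ∷ 3 ∷ 4 ∷ 5 ∷ 6 ∷ 7 ∷ 8 ∷ []) ((4 , 8) ∷ (6 , 2) ∷ (7 , 5) ∷ (0 , 3) ∷ (0 , 7) ∷ []) ((4 , 8 ,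
  inj₂ 0) ∷ (6 , 2 , inj₁ (7 , 0)) ∷ (7 , 5 , inj₁ (1 , 3)) ∷ []) (3 ∷ 1 ∷ 0 ∷ []) (((known 2 (0 ∷ 5 ∷ 4 ∷ 8 ∷ 6 ∷
  [])) ∷ (script (0 ∷ 1 ∷ 2 ∷ 3 ∷ 4 ∷ 5 ∷ 6 ∷ 7 ∷ 8 ∷ 9 ∷ []) ((9 , 0) ∷ (7 , 4) ∷ (8 , 1) ∷ (8 , 3) ∷ (8 , 5) ∷ (2 ,
  5) ∷ []) ((9 , 0 , inj₁ (8 , 6)) ∷ (7 , 4 , inj₁ (8 , 2)) ∷ []) (5 ∷ 3 ∷ 1 ∷ 6 ∷ 2 ∷ 8 ∷ []) (((full 0) ∷ (full 0) ∷
  (loop 0) ∷ (known 2 (0 ∷ 1 ∷ 9 ∷ 4 ∷ 5 ∷ [])) ∷ (full 0) ∷ (full 0) ∷ (full 0) ∷ (known 0 (4 ∷ 5 ∷ 9 ∷ [])) ∷ (known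
  0 (6 ∷ 8 ∷ 9 ∷ [])) ∷ (full 0) ∷ (full 0) ∷ (loop 9) ∷ []) ∷ ((full 4) ∷ (full 4) ∷ (full 0) ∷ (full 1) ∷ (full 2) ∷
  (known 0 (2 ∷ 3 ∷ 7 ∷ [])) ∷ (loop 4) ∷ (known 2 (0 ∷ 1 ∷ 2 ∷ 7 ∷ 5 ∷ [])) ∷ (full 4) ∷ (loop 7) ∷ (full 4) ∷ (known
  0 (7 ∷ 8 ∷ 9 ∷ [])) ∷ []) ∷ ((full 8) ∷ (full 8) ∷ (full 0) ∷ (loop 1) ∷ (full 2) ∷ (full 3) ∷ (full 4) ∷ (full 5) ∷
  (known 0 (0 ∷ 1 ∷ 6 ∷ [])) ∷ (known 0 (1 ∷ 2 ∷ 7 ∷ [])) ∷ (loop 8) ∷ (known 2 (0 ∷ 1 ∷ 9 ∷ 4 ∷ 5 ∷ [])) ∷ []) ∷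
  ((full 8) ∷ (full 8) ∷ (full 0) ∷ (full 1) ∷ (full 2) ∷ (loop 3) ∷ (full 4) ∷ (full 5) ∷ (known 2 (0 ∷ 1 ∷ 2 ∷ 3 ∷ 6
  ∷ [])) ∷ (known 0 (2 ∷ 3 ∷ 7 ∷ [])) ∷ (loop 8) ∷ (known 0 (3 ∷ 4 ∷ 9 ∷ [])) ∷ []) ∷ ((full 8) ∷ (full 8) ∷ (full 0)
  ∷ (full 1) ∷ (full 2) ∷ (full 3) ∷ (full 4) ∷ (loop 5) ∷ (known 0 (0 ∷ 5 ∷ 6 ∷ [])) ∷ (known 2 (0 ∷ 1 ∷ 2 ∷ 7 ∷ 5 ∷
  [])) ∷ (loop 8) ∷ (known 0 (4 ∷ 5 ∷ 9 ∷ [])) ∷ []) ∷ ((full 2) ∷ (full 2) ∷ (full 0) ∷ (known 0 (0 ∷ 1 ∷ 5 ∷ [])) ∷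
  (loop 2) ∷ (known 0 (3 ∷ 4 ∷ 5 ∷ [])) ∷ (full 2) ∷ (loop 5) ∷ (full 2) ∷ (known 2 (0 ∷ 1 ∷ 2 ∷ 7 ∷ 5 ∷ [])) ∷ (full
  2) ∷ (full 2) ∷ []) ∷ [])) ∷ (full 0) ∷ (full 1) ∷ (full 2) ∷ (known 1 (2 ∷ 3 ∷ 8 ∷ 7 ∷ [])) ∷ (loop 4) ∷ (known 1
  (0 ∷ 5 ∷ 8 ∷ 6 ∷ [])) ∷ (known 1 (0 ∷ 5 ∷ 4 ∷ 6 ∷ [])) ∷ (known 1 (2 ∷ 3 ∷ 4 ∷ 7 ∷ [])) ∷ (loop 8) ∷ []) ∷ ((full 2)
  ∷ (full 2) ∷ (full 0) ∷ (known 0 (0 ∷ 1 ∷ 6 ∷ [])) ∷ (loop 2) ∷ (known 2 (0 ∷ 1 ∷ 2 ∷ 3 ∷ 6 ∷ [])) ∷ (full 2) ∷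
  (full 2) ∷ (loop 6) ∷ (known 0 (6 ∷ 7 ∷ 8 ∷ [])) ∷ (full 2) ∷ []) ∷ ((known 2 (0 ∷ 1 ∷ 2 ∷ 7 ∷ 5 ∷ [])) ∷ (script (0
  ∷ 1 ∷ 2 ∷ 3 ∷ 4 ∷ 5 ∷ 6 ∷ 7 ∷ 8 ∷ 9 ∷ []) ((9 , 6) ∷ (7 , 4) ∷ (5 , 2) ∷ (3 , 0) ∷ (3 , 8) ∷ (5 , 8) ∷ []) ((9 , 6 ,
  inj₂ 5) ∷ (7 , 4 , inj₁ (3 , 5)) ∷ []) (8 ∷ 2 ∷ 0 ∷ 1 ∷ 3 ∷ 5 ∷ []) (((known 1 (0 ∷ 5 ∷ 9 ∷ 6 ∷ [])) ∷ (known 2 (0 ∷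
  5 ∷ 9 ∷ 10 ∷ 6 ∷ [])) ∷ (full 0) ∷ (full 1) ∷ (full 2) ∷ (full 3) ∷ (full 4) ∷ (full 5) ∷ (loop 6) ∷ (full 7) ∷
  (known 0 (7 ∷ 8 ∷ 9 ∷ [])) ∷ (loop 9) ∷ []) ∷ ((full 7) ∷ (full 7) ∷ (full 0) ∷ (full 1) ∷ (full 2) ∷ (full 7) ∷
  (loop 4) ∷ (full 5) ∷ (full 6) ∷ (loop 7) ∷ (known 2 (0 ∷ 5 ∷ 4 ∷ 8 ∷ 6 ∷ [])) ∷ (known 0 (4 ∷ 5 ∷ 9 ∷ [])) ∷ []) ∷
  ((full 2) ∷ (full 2) ∷ (full 0) ∷ (full 5) ∷ (loop 2) ∷ (full 5) ∷ (full 2) ∷ (loop 5) ∷ (full 2) ∷ (full 5) ∷ (full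
  2) ∷ (full 2) ∷ []) ∷ ((full 0) ∷ (full 0) ∷ (loop 0) ∷ (known 0 (1 ∷ 2 ∷ 3 ∷ [])) ∷ (full 0) ∷ (loop 3) ∷ (full 0)
  ∷ (full 5) ∷ (known 2 (0 ∷ 1 ∷ 2 ∷ 3 ∷ 6 ∷ [])) ∷ (full 0) ∷ (full 0) ∷ (full 0) ∷ []) ∷ ((known 1 (2 ∷ 3 ∷ 8 ∷ 7 ∷
  [])) ∷ (known 2 (2 ∷ 3 ∷ 10 ∷ 8 ∷ 7 ∷ [])) ∷ (full 0) ∷ (full 1) ∷ (full 2) ∷ (loop 3) ∷ (known 2 (0 ∷ 5 ∷ 4 ∷ 8 ∷ 6
  ∷ [])) ∷ (full 5) ∷ (known 2 (0 ∷ 1 ∷ 2 ∷ 3 ∷ 6 ∷ [])) ∷ (full 7) ∷ (loop 8) ∷ (full 9) ∷ []) ∷ ((full 5) ∷ (full 5)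
  ∷ (full 0) ∷ (full 1) ∷ (full 2) ∷ (full 3) ∷ (known 2 (0 ∷ 5 ∷ 4 ∷ 8 ∷ 6 ∷ [])) ∷ (loop 5) ∷ (full 5) ∷ (full 5) ∷
  (loop 8) ∷ (known 0 (7 ∷ 8 ∷ 9 ∷ [])) ∷ []) ∷ [])) ∷ (full 0) ∷ (full 1) ∷ (full 2) ∷ (full 3) ∷ (known 1 (2 ∷ 3 ∷ 4
  ∷ 7 ∷ [])) ∷ (loop 5) ∷ (full 6) ∷ (loop 7) ∷ (known 1 (0 ∷ 5 ∷ 8 ∷ 6 ∷ [])) ∷ []) ∷ ((full 0) ∷ (full 0) ∷ (loop 0)
  ∷ (known 0 (1 ∷ 2 ∷ 3 ∷ [])) ∷ (full 0) ∷ (loop 3) ∷ (full 0) ∷ (known 0 (3 ∷ 4 ∷ 5 ∷ [])) ∷ (known 2 (0 ∷ 1 ∷ 2 ∷ 3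
  ∷ 6 ∷ [])) ∷ (full 0) ∷ (full 0) ∷ []) ∷ ((full 0) ∷ (full 0) ∷ (loop 0) ∷ (known 0 (1 ∷ 2 ∷ 7 ∷ [])) ∷ (full 0) ∷
  (full 0) ∷ (full 0) ∷ (known 2 (0 ∷ 1 ∷ 2 ∷ 7 ∷ 5 ∷ [])) ∷ (known 0 (6 ∷ 7 ∷ 8 ∷ [])) ∷ (loop 7) ∷ (full 0) ∷ []) ∷
  [])

theta₃₃₃-cert : Cert
theta₃₃₃-cert =
  script (0 ∷ 1 ∷ 2 ∷ 3 ∷ 4 ∷ 5 ∷ 6 ∷ 7 ∷ []) ((6 , 2) ∷ (7 , 5) ∷ (0 , 3) ∷ (4 , 1) ∷ []) ((6 , 2 , inj₁ (1 , 3)) ∷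
  (7 , 5 , inj₁ (0 , 4)) ∷ (0 , 3 , inj₁ (1 , 4)) ∷ []) (4 ∷ 1 ∷ []) (((known 1 (0 ∷ 1 ∷ 2 ∷ 6 ∷ [])) ∷ (known 2 (0 ∷
  1 ∷ 2 ∷ 8 ∷ 6 ∷ [])) ∷ (full 0) ∷ (known 0 (0 ∷ 1 ∷ 6 ∷ [])) ∷ (loop 2) ∷ (full 3) ∷ (full 4) ∷ (full 5) ∷ (loop 6)
  ∷ (known 0 (2 ∷ 3 ∷ 7 ∷ [])) ∷ []) ∷ ((known 1 (0 ∷ 5 ∷ 7 ∷ 6 ∷ [])) ∷ (known 2 (0 ∷ 5 ∷ 8 ∷ 7 ∷ 6 ∷ [])) ∷ (full 0)
  ∷ (full 1) ∷ (full 2) ∷ (full 3) ∷ (known 0 (3 ∷ 4 ∷ 7 ∷ [])) ∷ (loop 5) ∷ (known 0 (0 ∷ 5 ∷ 6 ∷ [])) ∷ (loop 7) ∷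
  []) ∷ ((full 0) ∷ (full 0) ∷ (loop 0) ∷ (full 3) ∷ (full 0) ∷ (loop 3) ∷ (full 0) ∷ (full 3) ∷ (full 3) ∷ (full 0) ∷
  []) ∷ ((known 1 (0 ∷ 1 ∷ 4 ∷ 5 ∷ [])) ∷ (known 2 (0 ∷ 1 ∷ 8 ∷ 4 ∷ 5 ∷ [])) ∷ (full 0) ∷ (loop 1) ∷ (known 0 (2 ∷ 3 ∷
  4 ∷ [])) ∷ (full 3) ∷ (loop 4) ∷ (known 0 (0 ∷ 1 ∷ 5 ∷ [])) ∷ (full 6) ∷ (full 7) ∷ []) ∷ [])

theta₃₃₄-cert : Cert
theta₃₃₄-cert =
  script (0 ∷ 1 ∷ 2 ∷ 3 ∷ 4 ∷ 5 ∷ 6 ∷ 7 ∷ 8 ∷ []) ((6 , 2) ∷ (4 , 8) ∷ (1 , 4) ∷ (1 , 7) ∷ (1 , 8) ∷ (0 , 3) ∷ (0 , 7)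
  ∷ (7 , 5) ∷ []) ((6 , 2 , inj₁ (1 , 0)) ∷ (4 , 8 , inj₁ (0 , 7)) ∷ []) (7 ∷ 3 ∷ 5 ∷ 1 ∷ 0 ∷ []) (((known 1 (0 ∷ 1 ∷
  2 ∷ 6 ∷ [])) ∷ (known 2 (0 ∷ 1 ∷ 2 ∷ 9 ∷ 6 ∷ [])) ∷ (full 0) ∷ (known 0 (0 ∷ 1 ∷ 6 ∷ [])) ∷ (loop 2) ∷ (full 3) ∷
  (full 4) ∷ (full 5) ∷ (loop 6) ∷ (full 7) ∷ (known 1 (2 ∷ 3 ∷ 7 ∷ 8 ∷ [])) ∷ []) ∷ ((known 1 (3 ∷ 4 ∷ 8 ∷ 7 ∷ [])) ∷
  (known 2 (3 ∷ 4 ∷ 9 ∷ 8 ∷ 7 ∷ [])) ∷ (full 0) ∷ (full 1) ∷ (full 2) ∷ (full 3) ∷ (loop 4) ∷ (known 1 (0 ∷ 5 ∷ 8 ∷ 6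
  ∷ [])) ∷ (known 1 (0 ∷ 5 ∷ 4 ∷ 6 ∷ [])) ∷ (known 0 (3 ∷ 4 ∷ 7 ∷ [])) ∷ (loop 8) ∷ []) ∷ ((known 1 (0 ∷ 1 ∷ 4 ∷ 5 ∷
  [])) ∷ (known 2 (0 ∷ 1 ∷ 9 ∷ 4 ∷ 5 ∷ [])) ∷ (full 0) ∷ (loop 1) ∷ (known 0 (2 ∷ 3 ∷ 4 ∷ [])) ∷ (full 3) ∷ (loop 4) ∷
  (known 0 (0 ∷ 1 ∷ 5 ∷ [])) ∷ (full 6) ∷ (full 7) ∷ (full 8) ∷ []) ∷ ((known 1 (1 ∷ 2 ∷ 3 ∷ 7 ∷ [])) ∷ (known 2 (1 ∷
  2 ∷ 3 ∷ 7 ∷ 9 ∷ [])) ∷ (full 0) ∷ (loop 1) ∷ (known 0 (2 ∷ 3 ∷ 7 ∷ [])) ∷ (full 3) ∷ (full 4) ∷ (full 5) ∷ (full 6)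
  ∷ (loop 7) ∷ (known 1 (0 ∷ 1 ∷ 8 ∷ 6 ∷ [])) ∷ []) ∷ ((known 1 (0 ∷ 1 ∷ 8 ∷ 6 ∷ [])) ∷ (known 2 (0 ∷ 1 ∷ 9 ∷ 8 ∷ 6 ∷
  [])) ∷ (full 0) ∷ (loop 1) ∷ (known 1 (2 ∷ 3 ∷ 7 ∷ 8 ∷ [])) ∷ (full 3) ∷ (full 4) ∷ (full 5) ∷ (known 0 (0 ∷ 1 ∷ 6 ∷
  [])) ∷ (known 1 (1 ∷ 2 ∷ 3 ∷ 7 ∷ [])) ∷ (loop 8) ∷ []) ∷ ((full 0) ∷ (full 0) ∷ (loop 0) ∷ (full 3) ∷ (full 0) ∷
  (loop 3) ∷ (full 0) ∷ (full 3) ∷ (full 3) ∷ (full 0) ∷ (full 0) ∷ []) ∷ ((full 0) ∷ (full 0) ∷ (loop 0) ∷ (known 1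
  (1 ∷ 2 ∷ 3 ∷ 7 ∷ [])) ∷ (full 0) ∷ (full 0) ∷ (full 0) ∷ (known 1 (3 ∷ 4 ∷ 5 ∷ 7 ∷ [])) ∷ (known 0 (6 ∷ 7 ∷ 8 ∷ []))
  ∷ (loop 7) ∷ (full 0) ∷ []) ∷ ((known 1 (3 ∷ 4 ∷ 5 ∷ 7 ∷ [])) ∷ (known 2 (3 ∷ 4 ∷ 5 ∷ 9 ∷ 7 ∷ [])) ∷ (full 0) ∷
  (full 1) ∷ (full 2) ∷ (full 3) ∷ (known 0 (3 ∷ 4 ∷ 7 ∷ [])) ∷ (loop 5) ∷ (full 6) ∷ (loop 7) ∷ (known 1 (0 ∷ 5 ∷ 8 ∷
  6 ∷ [])) ∷ []) ∷ [])

theta₃₄₄-cert : Cert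
theta₃₄₄-cert =
  grow 7 ((grow 4 ((script (0 ∷ 1 ∷ 2 ∷ 3 ∷ 4 ∷ 5 ∷ 6 ∷ 7 ∷ 8 ∷ 9 ∷ []) ((1 , 9) ∷ (2 , 5) ∷ (0 , 3) ∷ (0 , 4) ∷ (7 ,
  2) ∷ (7 , 3) ∷ (0 , 8) ∷ (7 , 4) ∷ (7 , 5) ∷ []) ((1 , 9 , inj₁ (0 , 7)) ∷ (2 , 5 , inj₁ (0 , 4)) ∷ []) (3 ∷ 8 ∷ 4 ∷
  6 ∷ 7 ∷ 0 ∷ []) (((known 1 (0 ∷ 1 ∷ 9 ∷ 7 ∷ [])) ∷ (known 2 (0 ∷ 1 ∷ 12 ∷ 9 ∷ 7 ∷ [])) ∷ (full 0) ∷ (loop 1) ∷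
  (known 1 (2 ∷ 3 ∷ 8 ∷ 9 ∷ [])) ∷ (full 3) ∷ (full 4) ∷ (full 5) ∷ (full 6) ∷ (full 7) ∷ (known 1 (1 ∷ 2 ∷ 3 ∷ 8 ∷
  [])) ∷ (loop 9) ∷ (known 0 (7 ∷ 9 ∷ 10 ∷ [])) ∷ (known 2 (0 ∷ 1 ∷ 11 ∷ 9 ∷ 7 ∷ [])) ∷ []) ∷ ((known 1 (2 ∷ 3 ∷ 4 ∷ 5
  ∷ [])) ∷ (known 2 (2 ∷ 3 ∷ 4 ∷ 5 ∷ 12 ∷ [])) ∷ (full 0) ∷ (known 1 (0 ∷ 1 ∷ 5 ∷ 6 ∷ [])) ∷ (loop 2) ∷ (full 3) ∷
  (full 4) ∷ (loop 5) ∷ (known 1 (0 ∷ 1 ∷ 2 ∷ 6 ∷ [])) ∷ (full 7) ∷ (full 8) ∷ (full 9) ∷ (known 2 (0 ∷ 1 ∷ 2 ∷ 10 ∷ 7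
  ∷ [])) ∷ (known 0 (4 ∷ 5 ∷ 11 ∷ [])) ∷ []) ∷ ((full 0) ∷ (full 0) ∷ (loop 0) ∷ (full 3) ∷ (full 0) ∷ (loop 3) ∷
  (full 0) ∷ (full 0) ∷ (full 3) ∷ (full 3) ∷ (full 0) ∷ (full 0) ∷ (full 0) ∷ (full 0) ∷ []) ∷ ((full 0) ∷ (full 0) ∷
  (loop 0) ∷ (full 4) ∷ (full 0) ∷ (full 0) ∷ (loop 4) ∷ (full 0) ∷ (full 4) ∷ (full 4) ∷ (full 0) ∷ (full 0) ∷ (full
  0) ∷ (full 0) ∷ []) ∷ ((full 7) ∷ (full 7) ∷ (full 0) ∷ (full 7) ∷ (loop 2) ∷ (full 3) ∷ (full 4) ∷ (full 5) ∷ (full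
  6) ∷ (loop 7) ∷ (full 7) ∷ (known 1 (2 ∷ 3 ∷ 8 ∷ 9 ∷ [])) ∷ (known 2 (0 ∷ 1 ∷ 2 ∷ 10 ∷ 7 ∷ [])) ∷ (full 7) ∷ []) ∷
  ((full 3) ∷ (full 3) ∷ (full 0) ∷ (full 1) ∷ (full 7) ∷ (loop 3) ∷ (full 4) ∷ (full 3) ∷ (full 3) ∷ (loop 7) ∷ (full
  7) ∷ (full 3) ∷ (full 3) ∷ (full 3) ∷ []) ∷ ((full 0) ∷ (full 0) ∷ (loop 0) ∷ (known 1 (1 ∷ 2 ∷ 3 ∷ 8 ∷ [])) ∷ (full
  0) ∷ (full 0) ∷ (full 0) ∷ (full 0) ∷ (known 2 (0 ∷ 6 ∷ 8 ∷ 9 ∷ 7 ∷ [])) ∷ (full 7) ∷ (loop 8) ∷ (full 0) ∷ (full 0)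
  ∷ (full 0) ∷ []) ∷ ((full 4) ∷ (full 4) ∷ (full 0) ∷ (full 1) ∷ (full 2) ∷ (full 3) ∷ (loop 4) ∷ (full 7) ∷ (full 4)
  ∷ (loop 7) ∷ (full 4) ∷ (full 4) ∷ (full 4) ∷ (full 7) ∷ []) ∷ ((full 7) ∷ (full 7) ∷ (full 0) ∷ (full 1) ∷ (full 2)
  ∷ (full 3) ∷ (full 4) ∷ (loop 5) ∷ (full 7) ∷ (loop 7) ∷ (full 7) ∷ (known 2 (0 ∷ 6 ∷ 5 ∷ 9 ∷ 7 ∷ [])) ∷ (known 2 (0
  ∷ 6 ∷ 5 ∷ 10 ∷ 7 ∷ [])) ∷ (full 7) ∷ []) ∷ [])) ∷ (full 0) ∷ (known 1 (1 ∷ 2 ∷ 3 ∷ 4 ∷ [])) ∷ (known 0 (2 ∷ 3 ∷ 4 ∷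
  [])) ∷ (loop 4) ∷ (known 0 (4 ∷ 5 ∷ 6 ∷ [])) ∷ (full 7) ∷ (known 0 (3 ∷ 4 ∷ 8 ∷ [])) ∷ (known 1 (3 ∷ 4 ∷ 9 ∷ 8 ∷
  [])) ∷ (known 3 (4 ∷ 10 ∷ 7 ∷ 0 ∷ 6 ∷ 5 ∷ 3 ∷ 9 ∷ 8 ∷ [])) ∷ [])) ∷ (known 0 (0 ∷ 1 ∷ 7 ∷ [])) ∷ (known 1 (0 ∷ 1 ∷ 2
  ∷ 7 ∷ [])) ∷ (full 3) ∷ (known 2 (0 ∷ 6 ∷ 5 ∷ 4 ∷ 7 ∷ [])) ∷ (known 1 (0 ∷ 6 ∷ 5 ∷ 7 ∷ [])) ∷ (known 0 (0 ∷ 6 ∷ 7 ∷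
  [])) ∷ (loop 7) ∷ (known 0 (7 ∷ 8 ∷ 9 ∷ [])) ∷ [])

triangle-valid : Checker.Valid [] triangle triangle-cert
triangle-valid = toWitness {a? = Checker.valid? [] _ triangle-cert} tt

square-valid : Checker.Valid (triangle ∷ []) square square-cert
square-valid = toWitness {a? = Checker.valid? (triangle ∷ []) _ square-cert} tt

theta₂₃₄-valid : Checker.Valid (triangle ∷ square ∷ []) theta₂₃₄ theta₂₃₄-cert
theta₂₃₄-valid = toWitness {a? = Checker.valid? (triangle ∷ square ∷ []) _ theta₂₃₄-cert} tt

theta₁₄₄-valid : Checker.Valid (triangle ∷ square ∷ theta₂₃₄ ∷ petersen ∷ []) theta₁₄₄ theta₁₄₄-cert
theta₁₄₄-valid = toWitness {a? = Checker.valid? (triangle ∷ square ∷ theta₂₃₄ ∷ petersen ∷ []) _ theta₁₄₄-cert} tt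

theta₂₃₃-valid : Checker.Valid (triangle ∷ square ∷ theta₂₃₄ ∷ theta₁₄₄ ∷ []) theta₂₃₃ theta₂₃₃-cert
theta₂₃₃-valid = toWitness {a? = Checker.valid? (triangle ∷ square ∷ theta₂₃₄ ∷ theta₁₄₄ ∷ []) _ theta₂₃₃-cert} tt

theta₂₄₄-valid : Checker.Valid (triangle ∷ square ∷ pentagon ∷ []) theta₂₄₄ theta₂₄₄-cert
theta₂₄₄-valid = toWitness {a? = Checker.valid? (triangle ∷ square ∷ pentagon ∷ []) _ theta₂₄₄-cert} tt

theta₃₃₃-valid : Checker.Valid (triangle ∷ square ∷ pentagon ∷ []) theta₃₃₃ theta₃₃₃-cert
theta₃₃₃-valid = toWitness {a? = Checker.valid? (triangle ∷ square ∷ pentagon ∷ []) _ theta₃₃₃-cert} tt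

theta₃₃₄-valid : Checker.Valid (triangle ∷ square ∷ pentagon ∷ []) theta₃₃₄ theta₃₃₄-cert
theta₃₃₄-valid = toWitness {a? = Checker.valid? (triangle ∷ square ∷ pentagon ∷ []) _ theta₃₃₄-cert} tt

theta₃₄₄-valid : Checker.Valid (triangle ∷ square ∷ pentagon ∷ theta₂₄₄ ∷ []) theta₃₄₄ theta₃₄₄-cert
theta₃₄₄-valid = toWitness {a? = Checker.valid? (triangle ∷ square ∷ pentagon ∷ theta₂₄₄ ∷ []) _ theta₃₄₄-cert} tt

petersen-nbs : ∀ x y → petersenAdj x y ≡ does (toℕ y ∈ℕ? nbs (proj₂ petersen) (toℕ x))
petersen-nbs = toWitness {a? = Fin.all? λ x → Fin.all? λ y → petersenAdj x y Bool.≟ does (toℕ y ∈ℕ? nbs (proj₂ petersen) (toℕ x))} tt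

petersen-cubic : All (λ i → Unique (nbs (proj₂ petersen) i) × length (nbs (proj₂ petersen) i) ≡ 3) (upTo 10)
petersen-cubic = toWitness {a? = All.all? (λ i → unique? (nbs (proj₂ petersen) i) ×-dec length (nbs (proj₂ petersen) i) ≟ 3) (upTo 10)} tt

-- Cubic graphs: embedded configurations and soundness of certificates

module Cubic {n} (G : Graph n) (L : Fin n → List ℕ) (uL : ∀ v → Unique (L v)) (len : ∀ v → length (L v) ≡ 8)
             (conn : Connected G) (cubic : ∀ v → degree G v ≡ 3) (notP : ¬ Isomorphic G Petersen) where
  open Subcubic G L uL len conn (≤-reflexive ∘ cubic) public

  module Local {k E} (emb : Embed k E) (uN : ∀ {i} → i < k → Unique (nbs E i)) where
    open Embed emb
    open Config emb

    hs : ℕ → List V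
    hs w = map h (nbs E w)

    hs-unique : ∀ {w} → w < k → Unique (hs w)
    hs-unique {w} w<k = map-unique h (uN w<k) λ i j → inj (proj₁ (proj₂ (nb {w} i))) (proj₁ (proj₂ (nb {w} j)))

    rest : ℕ → List V
    rest w = filter (λ t → ¬? (t ∈V? hs w)) (N (h w))

    rest⁻ : ∀ {w t} → t ∈ rest w → Adj G (h w) t × t ∉ hs w
    rest⁻ {w} i = let (a , b) = ∈-filter⁻ (λ t → ¬? (t ∈V? hs w)) {xs = N (h w)} i in N⁻ a , b

    known-or-rest : ∀ {w t} → Adj G (h w) t → (∃[ j ] j ∈ nbs E w × t ≡ h j) ⊎ t ∈ rest w
    known-or-rest {w} {t} a with t ∈V? hs w
    ... | yes i = inj₁ (∈-map⁻ h i)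
    ... | no n = inj₂ (∈-filter⁺ (λ t → ¬? (t ∈V? hs w)) (N⁺ a) n)

    rest-length : ∀ {w} → w < k → length (rest w) ≤ 3 ∸ length (nbs E w)
    rest-length {w} w<k = m+n≤o⇒m≤o∸n (length (rest w)) (≤-trans
      (≤-reflexive (trans (cong (length (rest w) +_) (sym (length-map h (nbs E w)))) (sym (length-++ (rest w)))))
      (≤-trans (unique-⊑-length (Unique.++⁺ (Unique.filter⁺ _ (N-unique (h w))) (hs-unique w<k) λ (i , j) → proj₂ (rest⁻ i) j) sub)
        (≤-reflexive (cubic (h w)))))
      where
      sub : rest w ++ hs w ⊑ N (h w)
      sub i with ∈-++⁻ (rest w) i
      ... | inj₁ j = N⁺ (proj₁ (rest⁻ j))
      ... | inj₂ j with ∈-map⁻ h j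
      ...   | l , l∈ , refl = N⁺ (proj₂ (proj₂ (nb l∈)))

    -- A vertex within distance two is named (`X`), or an unnamed neighbour of a named neighbour
    -- (`Y`), or an unnamed neighbour or one of its at most two further neighbours (`Z`).
    reach-bound : ∀ {i} → i < k → length (unc ∅ (h i)) ≤ reach E i
    reach-bound {i} i<k = ≤-trans (unc-upper (X ++ (Y ++ Z)) cover) (≤-trans (≤-reflexive (trans (length-++ X) (cong (length X +_) (length-++ Y))))
        (+-mono-≤ (≤-reflexive (length-map h (near E i))) (+-mono-≤
          (concatMap-length rest (λ w → 3 ∸ length (nbs E w)) (nbs E i) (λ j → rest-length (proj₁ (proj₂ (nb j)))))
          (≤-trans (concatMap-length step₂ (λ _ → 3) (rest i) (λ j → s≤s (N-but-length (proj₁ (rest⁻ j)))))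
            (≤-trans (≤-reflexive (sum-const 3 (rest i))) (*-monoˡ-≤ 3 (rest-length i<k)))))))
      where
      step₂ : V → List V
      step₂ t = t ∷ N-but (h i) t
      X = map h (near E i)
      Y = concatMap rest (nbs E i)
      Z = concatMap step₂ (rest i)
      near⁺ : ∀ {j} → j ∈ two-step E i → h j ≢ h i → h j ∈ X
      near⁺ {j} j∈ ne = ∈-map⁺ h (∈-deduplicate⁺ _≟_ {xs = filter (λ j → ¬? (i ≟ j)) (two-step E i)}
        (∈-filter⁺ (λ j → ¬? (i ≟ j)) j∈ λ { refl → ne refl }))
      cover : ∀ {t} → Adj² G (h i) t → Unc ∅ t → t ∈ X ++ (Y ++ Z)
      cover (ne , inj₁ a) _ with known-or-rest a
      ... | inj₁ (j , j∈ , refl) = ∈-++⁺ˡ (near⁺ (∈-++⁺ˡ j∈) (ne ∘ sym))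
      ... | inj₂ r = ∈-++⁺ʳ X (∈-++⁺ʳ Y (∈-concatMap⁺ step₂ (lose r (here refl))))
      cover (ne , inj₂ (w , a , b)) _ with known-or-rest a
      ... | inj₂ r = ∈-++⁺ʳ X (∈-++⁺ʳ Y (∈-concatMap⁺ step₂ (lose r (there (N-but⁺ (ne ∘ sym) b)))))
      ... | inj₁ (j , j∈ , refl) with known-or-rest b
      ...   | inj₁ (l , l∈ , refl) = ∈-++⁺ˡ (near⁺ (∈-++⁺ʳ (nbs E i) (∈-concatMap⁺ (nbs E) (lose j∈ l∈))) (ne ∘ sym))
      ...   | inj₂ r = ∈-++⁺ʳ X (∈-++⁺ˡ (∈-concatMap⁺ rest (lose j∈ r)))

    slack₀-sound : ∀ {i} → i < k → S ∅ (h i) (slack₀ E i)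
    slack₀-sound {i} i<k with reach E i ≤? 9
    ... | yes le = ∅-slack (≤-trans (+-monoˡ-≤ (9 ∸ reach E i) (reach-bound i<k)) (≤-reflexive (m+[n∸m]≡n le)))
    ... | no nle = subst (S ∅ (h i)) (sym (m≤n⇒m∸n≡0 (<⇒≤ (≰⇒> nle)))) S₀

  module Extend {k E} (emb : Embed k E) where
    open Embed emb
    open Config emb

    add-edge : ∀ {i j} → i < k → j < k → Adj G (h i) (h j) → Embed k (addE (i , j) E)
    add-edge {i} {j} i< j< a = record { h = h ; inj = inj ; edges = es }
      where
      es : All (λ (a , b) → a < k × b < k × Adj G (h a) (h b)) (addE (i , j) E)
      es with j ∈ℕ? nbs E i
      ... | yes _ = edges
      ... | no _ = (i< , j< , a) ∷ edges

    h′ : V → ℕ → V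
    h′ t i with i ≟ k
    ... | yes _ = t
    ... | no _ = h i

    h′-new : ∀ t → h′ t k ≡ t
    h′-new t with k ≟ k
    ... | yes _ = refl
    ... | no n = contradiction refl n

    h′-old : ∀ {t i} → i < k → h′ t i ≡ h i
    h′-old {i = i} i<k with i ≟ k
    ... | yes refl = contradiction i<k (<-irrefl refl)
    ... | no _ = refl

    image? : ∀ t → Dec (∃[ i ] i < k × h i ≡ t)
    image? t = anyUpTo? (λ i → h i Fin.≟ t) k

    add-vertex : ∀ {t} → (∀ {i} → i < k → h i ≢ t) → Embed (suc k) E
    add-vertex {t} new = record { h = h′ t ; inj = inj′ ; edges = All.map (λ (a , b , c) → m<n⇒m<1+n a , m<n⇒m<1+n b ,
        subst₂ (Adj G) (sym (h′-old a)) (sym (h′-old b)) c) edges }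
      where
      inj′ : ∀ {i j} → i < suc k → j < suc k → h′ t i ≡ h′ t j → i ≡ j
      inj′ {i} {j} i< j< e with i ≟ k | j ≟ k
      ... | yes refl | yes refl = refl
      ... | yes refl | no j≢ = contradiction (sym e) (new (≤∧≢⇒< (≤-pred j<) j≢))
      ... | no i≢ | yes refl = contradiction e (new (≤∧≢⇒< (≤-pred i<) i≢))
      ... | no i≢ | no j≢ = inj (≤∧≢⇒< (≤-pred i<) i≢) (≤∧≢⇒< (≤-pred j<) j≢) e

    add-pendant : ∀ {t i} → (∀ {i} → i < k → h i ≢ t) → i < k → Adj G (h i) t → Embed (suc k) ((i , k) ∷ E)
    add-pendant {t} {i} new i< a = let module V = Embed (add-vertex new) in record { h = h′ t ; inj = V.inj ;
      edges = (m<n⇒m<1+n i< , ≤-refl , subst₂ (Adj G) (sym (h′-old i<)) (sym (h′-new t)) a) ∷ V.edges }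

    add-link : ∀ {t i j} → (∀ {i} → i < k → h i ≢ t) → i < k → j < k → Adj G (h i) t → Adj G t (h j) →
               Embed (suc k) ((i , k) ∷ (j , k) ∷ E)
    add-link {t} new i< j< a b = let module P = Embed (add-pendant new j< (Adj-sym b)) in record { h = h′ t ; inj = P.inj ;
      edges = (m<n⇒m<1+n i< , ≤-refl , subst₂ (Adj G) (sym (h′-old i<)) (sym (h′-new t)) a) ∷ P.edges }

  Emb : Extension → Set
  Emb (k , E) = Embed k E

  joins-sound : ∀ {k E} (emb : Embed k E) → let open Embed emb in ∀ {x y} → x < k → y < k → Adj² G (h x) (h y) → Any Emb (joins k E x y)
  joins-sound emb x< y< (_ , inj₁ a) = here (Extend.add-edge emb x< y< a)
  joins-sound {k} {E} emb {x} {y} x< y< (_ , inj₂ (w , a , b)) with Extend.image? emb w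
  ... | no n = there (here (Extend.add-link emb (λ i< e → n (_ , i< , e)) x< y< a b))
  ... | yes (z , z< , refl) = there (there (Any.map⁺ (lose (∈-upTo⁺ z<)
          (Extend.add-edge (Extend.add-edge emb x< z< a) y< z< (Adj-sym b)))))

  grows-sound : ∀ {k E} (emb : Embed k E) {v} → v < k → Unique (nbs E v) → length (nbs E v) ≤ 2 → Any Emb (grows k E v)
  grows-sound {k} {E} emb {v} v< u le with exists-outside Fin._≟_ (map h (nbs E v)) (N-unique (h v))
      (≤-trans (s≤s (≤-trans (≤-reflexive (length-map h (nbs E v))) le)) (≤-reflexive (sym (cubic (h v)))))
    where open Embed emb
  ... | t , t∈ , t∉ with Extend.image? emb t
  ...   | no n = here (Extend.add-pendant emb (λ i< e → n (_ , i< , e)) v< (N⁻ t∈))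
  ...   | yes (z , z< , refl) = there (Any.map⁺ (lose (∈-filter⁺ (λ z → ¬? (z ∈ℕ? nbs E v)) (∈-upTo⁺ z<)
            λ i → t∉ (∈-map⁺ (Embed.h emb) i)) (Extend.add-edge emb v< z< (N⁻ t∈))))

  restrict : ∀ {k E} (emb : Embed k E) K ρ → Checker.Occurs [] k E K ρ → Emb K
  restrict {k} {E} emb (k₀ , E₀) ρ (l , u , b , es) = record
    { h = h ∘ lookupE 0 ρ
    ; inj = λ i< j< e → lookupE-inj u (subst (_ <_) (sym l) i<) (subst (_ <_) (sym l) j<) (inj (look-< b (subst (_ <_) (sym l) i<)) (look-< b (subst (_ <_) (sym l) j<)) e)
    ; edges = All.map (λ (a , b , c) → a , b , proj₂ (proj₂ (nb c))) es }
    where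
    open Embed emb
    open Config emb
    look-< : ∀ {ρ i} → All (_< k) ρ → i < length ρ → lookupE 0 ρ i < k
    look-< al lt = All.lookup al (lookupE-∈ lt)

  script-sound : ∀ {solved k E} (emb : Embed k E) R far ss ws → Checker.ScriptOK solved k E R far ss ws →
    (∀ {i j} → (i , j) ∈ far → ¬ Adj² G (Embed.h emb i) (Embed.h emb j)) → Done
  script-sound {k = k} {E} emb R far ss ws (1≤ , uR , uN , ok , steps) fs = start R 1≤ refl
    where
    open Embed emb
    open Config emb
    open Run far emb fs using (names-unique; St)
    R<k : ∀ {i} → i ∈ R → i < k
    R<k i∈ = proj₁ (All.lookup ok i∈)
    R-nb : ∀ {r} → r ∈ map h R → ∃[ r′ ] r′ ∈ map h R × Adj G r r′
    R-nb r∈ with ∈-map⁻ h r∈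
    ... | i , i∈ , refl with find (proj₂ (All.lookup ok i∈))
    ...   | j , j∈ , j∈R = h j , ∈-map⁺ h j∈R , proj₂ (proj₂ (nb j∈))
    start : ∀ xs → 1 ≤ length xs → xs ≡ R → Done
    start (r ∷ _) _ e with outside (map h R) (names-unique uR R<k) (h r) (∈-map⁺ h (subst (r ∈_) e (here refl))) R-nb
    ... | c , P , f , g , mono = Run.run far emb fs ss ws (record
      { proper = P ; uR = uR ; R<k = R<k ; R-unc = g ∘ ∈-map⁺ h
      ; unc-R = λ u → ∈-map⁻ h (f u)
      ; slack = λ i∈ → mono (Local.slack₀-sound emb (λ i< → All.lookup uN (∈-upTo⁺ i<)) (R<k i∈)) }) steps

  module Sound (solved : List Extension) (solved-sound : All (λ K → Emb K → Done) solved) where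
    open Checker solved

    at : ∀ {P : Extension → Set} Ks → All P Ks → ∀ i → i < length Ks → P (lookupE (0 , []) Ks i)
    at (_ ∷ _) (p ∷ _) zero _ = p
    at (_ ∷ Ks) (_ ∷ ps) (suc i) (s≤s lt) = at Ks ps i lt

    mutual
      sound : ∀ {k E} → Embed k E → ∀ c → Valid (k , E) c → Done
      sound {k} {E} emb (script R far ss ws css) (ok , v) = sound-far emb far css v (script-sound {solved} emb R far ss ws ok)
      sound emb (grow v cs) (v< , u , le , vs) = sounds _ cs vs (grows-sound emb v< u le)
      sound emb (known i ρ) (i< , oc) = at solved solved-sound i i< (restrict emb _ ρ oc)
      sound {E = E} emb (full v) (u , 4≤) = ⊥-elim (<⇒≱ 4≤ (too-many emb u))
        where
        too-many : ∀ {k E v} (emb : Embed k E) → Unique (nbs E v) → length (nbs E v) ≤ 3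
        too-many {k} {E} {v} emb u = ≤-trans (≤-reflexive (sym (length-map h (nbs E v))))
          (≤-trans (unique-⊑-length (map-unique h u λ i j → inj (proj₁ (proj₂ (nb {v} i))) (proj₁ (proj₂ (nb {v} j))))
            (λ i → let (j , j∈ , e) = ∈-map⁻ h i in subst (_∈ N (h v)) (sym e) (N⁺ (proj₂ (proj₂ (nb {v} j∈))))))
            (≤-reflexive (cubic (h v))))
          where
          open Embed emb
          open Config emb
      sound emb (loop v) v∈ = contradiction refl (Adj-≢ (proj₂ (proj₂ (Config.nb emb v∈))))

      sounds : ∀ Ks cs → Valids Ks cs → Any Emb Ks → Done
      sounds (K ∷ Ks) (c ∷ cs) (v , vs) (here e) = sound e c v
      sounds (K ∷ Ks) (c ∷ cs) (v , vs) (there a) = sounds Ks cs vs a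

      -- The pairs are tested one at a time. If a pair is adjacent in G² after all, its own
      -- certificates take over with the enlarged configuration; the script runs only when all pairs
      -- pass.
      sound-far : ∀ {k E} (emb : Embed k E) far css → ValidFar k E far css →
        ((∀ {i j} → (i , j) ∈ far → ¬ Adj² G (Embed.h emb i) (Embed.h emb j)) → Done) → Done
      sound-far emb [] [] _ f = f λ ()
      sound-far emb ((x , y) ∷ far) (cs ∷ css) (x< , y< , vs , v) f with Adj²? (Embed.h emb x) (Embed.h emb y)
      ... | yes a = sounds _ cs vs (joins-sound emb x< y< a)
      ... | no na = sound-far emb far css v λ g → f λ { (here refl) → na ; (there i) → g i }

  -- An embedded Petersen graph uses up the degree three of all its vertices. No further edge of G
  -- joins or leaves them, so by connectedness it is all of G.
  petersen-embedded : Emb petersen → Isomorphic G Petersen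
  petersen-embedded emb = mk⤖ {to = to} (inj′ , surj) , λ u v → same (image u) (image v)
    where
    open Embed emb
    open Config emb
    P = proj₂ petersen
    closed : ∀ {i t} → i < 10 → Adj G (h i) t → ∃[ j ] j ∈ nbs P i × t ≡ h j
    closed {i} {t} i< a with t ∈V? map h (nbs P i)
    ... | yes p = ∈-map⁻ h p
    ... | no t∉ = contradiction
        (≤-trans (≤-reflexive (cong suc (trans (sym e) (sym (length-map h (nbs P i))))))
          (≤-trans (unique-⊑-length (All-≢⁺ t∉ ∷ map-unique h u λ x y → inj (proj₁ (proj₂ (nb {i} x))) (proj₁ (proj₂ (nb {i} y)))) sub) (≤-reflexive (cubic (h i)))))
        (<⇒≱ ≤-refl)
      where
      u = proj₁ (All.lookup petersen-cubic (∈-upTo⁺ i<))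
      e = proj₂ (All.lookup petersen-cubic (∈-upTo⁺ i<))
      sub : t ∷ map h (nbs P i) ⊑ N (h i)
      sub (here refl) = N⁺ a
      sub (there p) with ∈-map⁻ h p
      ... | j , j∈ , refl = N⁺ (proj₂ (proj₂ (nb {i} j∈)))
    Image : V → Set
    Image t = ∃[ i ] i < 10 × h i ≡ t
    along : ∀ {s t} → Image s → Walk G s t → Image t
    along im here = im
    along (i , i< , refl) (step a w) with closed i< a
    ... | j , j∈ , refl = along (j , proj₁ (proj₂ (nb {i} j∈)) , refl) w
    image : ∀ t → Image t
    image t = along (0 , s≤s z≤n , refl) (conn (h 0) t)
    to : V → Fin 10
    to t = fromℕ< (proj₁ (proj₂ (image t)))
    toℕ-to : ∀ t → toℕ (to t) ≡ proj₁ (image t)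
    toℕ-to t = Fin.toℕ-fromℕ< (proj₁ (proj₂ (image t)))
    h-to : ∀ t → h (toℕ (to t)) ≡ t
    h-to t = trans (cong h (toℕ-to t)) (proj₂ (proj₂ (image t)))
    inj′ : ∀ {s t} → to s ≡ to t → s ≡ t
    inj′ {s} {t} e = trans (sym (h-to s)) (trans (cong (h ∘ toℕ) e) (h-to t))
    surj : ∀ y → ∃[ t ] (∀ {z} → z ≡ t → to z ≡ y)
    surj y = h (toℕ y) , λ { refl → Fin.toℕ-injective (inj (Fin.toℕ<n (to (h (toℕ y)))) (Fin.toℕ<n y) (h-to (h (toℕ y)))) }
    same : ∀ {u v} → Image u → Image v → adj G u v ≡ petersenAdj (to u) (to v)
    same {u} {v} _ _ = trans (agree (toℕ v' ∈ℕ? nbs P (toℕ u'))) (sym (petersen-nbs u' v'))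
      where
      u' = to u
      v' = to v
      agree : (d : Dec (toℕ v' ∈ nbs P (toℕ u'))) → adj G u v ≡ does d
      agree (yes p) = subst (λ x → adj G x v ≡ true) (h-to u) (subst (λ x → adj G (h (toℕ u')) x ≡ true) (h-to v) (proj₂ (proj₂ (nb {toℕ u'} p))))
      agree (no np) = off (Adj? u v)
        where
        off : Dec (Adj G u v) → adj G u v ≡ false
        off (no na) = ¬-not na
        off (yes a) with closed (Fin.toℕ<n u') (subst (λ x → Adj G x v) (sym (h-to u)) a)
        ... | j , j∈ , e = contradiction (subst (_∈ nbs P (toℕ u')) (inj (proj₁ (proj₂ (nb {toℕ u'} j∈))) (Fin.toℕ<n v') (trans (sym e) (sym (h-to v)))) j∈) np

  triangle-done : Emb triangle → Done
  triangle-done e = Sound.sound [] [] e triangle-cert triangle-valid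

  square-done : Emb square → Done
  square-done e = Sound.sound _ (triangle-done ∷ []) e square-cert square-valid

  theta₂₃₄-done : Emb theta₂₃₄ → Done
  theta₂₃₄-done e = Sound.sound _ (triangle-done ∷ square-done ∷ []) e theta₂₃₄-cert theta₂₃₄-valid

  -- Two pentagons with a common edge, which can grow into the Petersen graph; no other certificate
  -- appeals to `petersen` directly.
  theta₁₄₄-done : Emb theta₁₄₄ → Done
  theta₁₄₄-done e = Sound.sound _ (triangle-done ∷ square-done ∷ theta₂₃₄-done ∷ (⊥-elim ∘ notP ∘ petersen-embedded) ∷ [])
    e theta₁₄₄-cert theta₁₄₄-valid

  theta₂₃₃-done : Emb theta₂₃₃ → Done
  theta₂₃₃-done e = Sound.sound _ (triangle-done ∷ square-done ∷ theta₂₃₄-done ∷ theta₁₄₄-done ∷ []) e theta₂₃₃-cert theta₂₃₃-valid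

  module NoPentagon (pentagon-done : Emb pentagon → Done) where
    short : All (λ K → Emb K → Done) (triangle ∷ square ∷ pentagon ∷ [])
    short = triangle-done ∷ square-done ∷ pentagon-done ∷ []

    theta₂₄₄-done : Emb theta₂₄₄ → Done
    theta₂₄₄-done e = Sound.sound _ short e theta₂₄₄-cert theta₂₄₄-valid

    theta₃₃₃-done : Emb theta₃₃₃ → Done
    theta₃₃₃-done e = Sound.sound _ short e theta₃₃₃-cert theta₃₃₃-valid

    theta₃₃₄-done : Emb theta₃₃₄ → Done
    theta₃₃₄-done e = Sound.sound _ short e theta₃₃₄-cert theta₃₃₄-valid

    theta₃₄₄-done : Emb theta₃₄₄ → Done
    theta₃₄₄-done e = Sound.sound _ (triangle-done ∷ square-done ∷ pentagon-done ∷ theta₂₄₄-done ∷ []) e theta₃₄₄-cert theta₃₄₄-valid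

  -- Non-backtracking closed walks

  -- A closed non-backtracking walk of length g, unrolled to a periodic sequence.
  record Loop (g : ℕ) : Set where
    field
      v   : ℕ → V
      1≤g : 1 ≤ g
      per : ∀ i → v (g + i) ≡ v i
      link : ∀ i → Adj G (v i) (v (1 + i))
      nb  : ∀ i → v i ≢ v (2 + i)

  -- The ends are the directed edges from `a` to `b` and from `c` to `d`, and the number counts the
  -- steps between them. With whole edges as ends, a closed walk `NB a b a b m` does not backtrack
  -- at its seam either.
  data NB : (a b c d : V) → ℕ → Set where
    stop : ∀ {a b} → Adj G a b → NB a b a b 0
    cons : ∀ {a b c y z m} → Adj G a b → a ≢ c → NB b c y z m → NB a b y z (suc m)

  snoc : ∀ {a b y z w m} → NB a b y z m → Adj G z w → y ≢ w → NB a b z w (suc m)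
  snoc (stop a) a′ ne = cons a ne (stop a′)
  snoc (cons a ne p) a′ ne′ = cons a ne (snoc p a′ ne′)

  vertex : ∀ {a b c d m} → NB a b c d m → ℕ → V
  vertex {a = a} _ zero = a
  vertex {b = b} (stop _) (suc _) = b
  vertex (cons _ _ p) (suc i) = vertex p i

  vertex-1 : ∀ {a b c d m} (p : NB a b c d m) → vertex p 1 ≡ b
  vertex-1 (stop _) = refl
  vertex-1 (cons _ _ p) = refl

  vertex-last : ∀ {a b c d m} (p : NB a b c d m) → vertex p m ≡ c
  vertex-last (stop _) = refl
  vertex-last (cons _ _ p) = vertex-last p

  vertex-last′ : ∀ {a b c d m} (p : NB a b c d m) → vertex p (suc m) ≡ d
  vertex-last′ (stop _) = refl
  vertex-last′ (cons _ _ p) = vertex-last′ p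

  vertex-adj : ∀ {a b c d m} (p : NB a b c d m) {i} → i ≤ m → Adj G (vertex p i) (vertex p (suc i))
  vertex-adj (stop a) z≤n = a
  vertex-adj (cons a _ p) {zero} _ = a
  vertex-adj (cons _ _ p) {suc i} (s≤s le) = vertex-adj p le

  vertex-nb : ∀ {a b c d m} (p : NB a b c d m) {i} → i < m → vertex p i ≢ vertex p (2 + i)
  vertex-nb (cons _ ne p) {zero} _ = λ e → ne (trans e (vertex-1 p))
  vertex-nb (cons _ _ p) {suc i} (s≤s lt) = vertex-nb p lt

  module Close {a b g} (p : NB a b a b (suc g)) where
    private
      f = vertex p
      m = suc g
      succ-mod : ∀ i → (suc i % m ≡ suc (i % m)) ⊎ (suc (i % m) ≡ m × suc i % m ≡ 0)
      succ-mod i with suc (i % m) <? m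
      ... | yes lt = inj₁ (trans (%-distribˡ-+ 1 i m) (trans (cong (_% m) (lemma g lt)) (m<n⇒m%n≡m lt)))
        where
        open import Data.Nat.DivMod using (%-distribˡ-+; m<n⇒m%n≡m)
        lemma : ∀ g → suc (i % m) < m → 1 % m + i % m ≡ suc (i % m)
        lemma _ lt = cong (_+ i % m) (m<n⇒m%n≡m (≤-trans (s≤s (s≤s z≤n)) lt))
      ... | no nlt = inj₂ (e , trans (%-distribˡ-+ 1 i m) (wrap g refl))
        where
        open import Data.Nat.DivMod using (%-distribˡ-+; m<n⇒m%n≡m; n%n≡0; n%1≡0)
        e : suc (i % m) ≡ m
        e = ≤-antisym (m%n<n i m) (≮⇒≥ nlt)
        wrap : ∀ g′ → g ≡ g′ → (1 % m + i % m) % m ≡ 0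
        -- Length one is treated apart because `1 % m` is then zero.
        wrap zero refl = n%1≡0 (1 % m + i % m)
        wrap (suc g′) refl = trans (cong (λ x → x % m) (trans (cong (_+ i % m) (m<n⇒m%n≡m {n = m} {m = 1} (s≤s (s≤s z≤n)))) e)) (n%n≡0 m)
      f-step : ∀ i → f (suc i % m) ≡ f (suc (i % m))
      f-step i with succ-mod i
      ... | inj₁ e = cong f e
      ... | inj₂ (e , e′) = trans (cong f e′) (sym (trans (cong f e) (vertex-last p)))
      f-step₂ : ∀ i → f ((2 + i) % m) ≡ f (2 + i % m)
      f-step₂ i with succ-mod i
      ... | inj₁ e = trans (f-step (suc i)) (cong (f ∘ suc) e)
      ... | inj₂ (e , e′) = trans (f-step (suc i)) (trans (cong (f ∘ suc) e′)
              (trans (vertex-1 p) (sym (trans (cong (f ∘ suc) e) (vertex-last′ p)))))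

    closed : Loop (suc g)
    closed = record
      { v = λ i → f (i % m)
      ; 1≤g = s≤s z≤n
      ; per = λ i → cong f (trans (cong (_% m) (+-comm m i)) ([m+n]%n≡m%n i m))
      ; link = λ i → subst (Adj G (f (i % m))) (sym (f-step i)) (vertex-adj p (<⇒≤ (m%n<n i m)))
      ; nb = λ i e → vertex-nb p (m%n<n i m) (trans e (f-step₂ i)) }
      where open import Data.Nat.DivMod using ([m+n]%n≡m%n)

  -- The value b is junk: a vertex of a cubic graph has a third neighbour.
  abstract
    third : V → V → V → V
    third a b c = pick (filter (λ t → ¬? (t ∈V? (a ∷ c ∷ []))) (N b))
      where
      pick : List V → V
      pick [] = b
      pick (t ∷ _) = t

    third-spec : ∀ a b c → let t = third a b c in Adj G b t × t ≢ a × t ≢ c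
    third-spec a b c with exists-outside Fin._≟_ (a ∷ c ∷ []) (N-unique b) (≤-reflexive (sym (cubic b)))
    ... | t , t∈ , t∉ with filter (λ t → ¬? (t ∈V? (a ∷ c ∷ []))) (N b) in eq
    ...   | [] = contradiction (subst (t ∈_) eq (∈-filter⁺ (λ t → ¬? (t ∈V? (a ∷ c ∷ []))) t∈ t∉)) λ ()
    ...   | s ∷ _ with ∈-filter⁻ (λ t → ¬? (t ∈V? (a ∷ c ∷ []))) {xs = N b} (subst (s ∈_) (sym eq) (here refl))
    ...     | s∈ , s∉ = N⁻ s∈ , (s∉ ∘ here) , (s∉ ∘ there ∘ here)

    third-all : ∀ {a b c t} → Adj G b a → Adj G b c → a ≢ c → Adj G b t → t ≡ a ⊎ t ≡ c ⊎ t ≡ third a b c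
    third-all {a} {b} {c} {t} a∼ c∼ a≢c t∼ with t Fin.≟ a | t Fin.≟ c | t Fin.≟ third a b c
    ... | yes e | _ | _ = inj₁ e
    ... | _ | yes e | _ = inj₂ (inj₁ e)
    ... | _ | _ | yes e = inj₂ (inj₂ e)
    ... | no n₁ | no n₂ | no n₃ with third-spec a b c
    ...   | s∼ , s≢a , s≢c = contradiction
              (≤-trans (unique-⊑-length
                {xs = t ∷ a ∷ c ∷ third a b c ∷ []}
                ((n₁ ∷ n₂ ∷ n₃ ∷ []) ∷ (a≢c ∷ (s≢a ∘ sym) ∷ []) ∷ ((s≢c ∘ sym) ∷ []) ∷ [] ∷ [])
                (All.lookup (N⁺ t∼ ∷ N⁺ a∼ ∷ N⁺ c∼ ∷ N⁺ s∼ ∷ []))) (≤-reflexive (cubic b)))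
              (<⇒≱ ≤-refl)

  -- A non-backtracking walk in a finite cubic graph runs into a loop.
  exists-loop : V → ∃[ g ] Loop g
  exists-loop r = start (N r) refl
    where
    next : V × V → V × V
    next (a , b) = b , third a b a
    module From (s : V) (r∼s : Adj G r s) where
      e : ℕ → V × V
      e zero = r , s
      e (suc i) = next (e i)
      e-adj : ∀ i → Adj G (proj₁ (e i)) (proj₂ (e i))
      e-adj zero = r∼s
      e-adj (suc i) = proj₁ (third-spec (proj₁ (e i)) (proj₂ (e i)) (proj₁ (e i)))
      e-nb : ∀ i → proj₁ (e i) ≢ proj₁ (e (2 + i))
      e-nb i q = proj₁ (proj₂ (third-spec (proj₁ (e i)) (proj₂ (e i)) (proj₁ (e i)))) (sym q)
      code : V × V → Fin (n * n)
      code (a , b) = Fin.combine a b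
      e-shift : ∀ {i j} → e i ≡ e j → ∀ k → e (k + i) ≡ e (k + j)
      e-shift q zero = q
      e-shift q (suc k) = cong next (e-shift q k)
      result : ∃[ g ] Loop g
      -- The continuation depends only on the current directed edge, which has at most `n * n`
      -- values; a repetition makes the walk periodic from there on.
      result with Fin.pigeonhole {m = n * n} {n = suc (n * n)} ≤-refl (code ∘ e ∘ Fin.toℕ)
      ... | i , j , i<j , q = d , record
          { v = λ k → proj₁ (e (k + a))
          ; 1≤g = m<n⇒0<n∸m i<j
          ; per = λ k → cong proj₁ (trans (cong e (shuffle k)) (e-shift (sym same) k))
          ; link = λ k → e-adj (k + a)
          ; nb = λ k → e-nb (k + a) }
        where
        a = Fin.toℕ i
        b = Fin.toℕ j
        d = b ∸ a
        same : e a ≡ e b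
        same = let (p , p′) = Fin.combine-injective (proj₁ (e a)) (proj₂ (e a)) (proj₁ (e b)) (proj₂ (e b)) q in cong₂ _,_ p p′
        shuffle : ∀ k → d + k + a ≡ k + b
        shuffle k = trans (cong (_+ a) (+-comm d k)) (trans (+-assoc k d a) (cong (k +_) (m∸n+n≡m (<⇒≤ i<j))))
    start : ∀ xs → xs ≡ N r → ∃[ g ] Loop g
    start [] q = contradiction (trans (cong length q) (cubic r)) λ ()
    start (s ∷ _) q = From.result s (N⁻ (subst (s ∈_) q (here refl)))

  InRange : ℕ → Edges → Set
  InRange k = All (λ (a , b) → a < k × b < k)

  inRange? : ∀ k E → Dec (InRange k E)
  inRange? k = All.all? (λ (a , b) → a <? k ×-dec b <? k)

  embed-list : ∀ (d : V) xs E → Unique xs → True (inRange? (length xs) E) →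
               All (λ (a , b) → Adj G (lookupE d xs a) (lookupE d xs b)) E → Embed (length xs) E
  embed-list d xs E u r as = record
    { h = lookupE d xs
    ; inj = lookupE-inj u
    ; edges = All.zipWith (λ ((a , b) , c) → a , b , c) (toWitness r , as) }

  pentagon-loop : Emb pentagon → Loop 5
  pentagon-loop record { h = h ; inj = inj ; edges = (_ , _ , a₀₁) ∷ (_ , _ , a₁₂) ∷ (_ , _ , a₂₃) ∷ (_ , _ , a₃₄) ∷ (_ , _ , a₄₀) ∷ [] } =
    Close.closed (cons a₀₁ (ne {0} {2}) (cons a₁₂ (ne {1} {3}) (cons a₂₃ (ne {2} {4}) (cons a₃₄ (ne {3} {0}) (cons a₄₀ (ne {4} {1}) (stop a₀₁))))))
    where
    ne : ∀ {i j} {_ : True (i <? 5)} {_ : True (j <? 5)} {_ : True (¬? (i ≟ j))} → h i ≢ h j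
    ne {i} {j} {p} {q} {r} e = toWitness r (inj (toWitness p) (toWitness q) e)

  -- A shortest loop, its pendants, and theta graphs

  module Short (p : ℕ) (lp : Loop (suc p)) (nd : ¬ Done) (shortest : ∀ {m} → m < suc p → ¬ Loop m) where
    open Loop lp public

    g : ℕ
    g = suc p

    -- `p` is -1 modulo the length of the loop, so predecessors are reached without subtraction.
    prev : ℕ → V
    prev i = v (p + i)

    prev-adj : ∀ i → Adj G (prev i) (v i)
    prev-adj i = subst (Adj G (prev i)) (per i) (link (p + i))

    prev-suc : ∀ i → prev (1 + i) ≡ v i
    prev-suc i = trans (cong v (+-suc p i)) (per i)

    prev≢next : ∀ i → prev i ≢ v (1 + i)
    prev≢next i e = nb (p + i) (trans e (sym (trans (cong (v ∘ suc) (sym (+-suc p i))) (per (1 + i)))))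

    u : ℕ → V
    u i = third (prev i) (v i) (v (1 + i))

    u-adj : ∀ i → Adj G (v i) (u i)
    u-adj i = proj₁ (third-spec (prev i) (v i) (v (1 + i)))

    nbrs : ∀ {i t} → Adj G (v i) t → t ≡ prev i ⊎ t ≡ v (1 + i) ⊎ t ≡ u i
    nbrs {i} = third-all (Adj-sym (prev-adj i)) (link i) (prev≢next i)

    u-per : ∀ i → u (g + i) ≡ u i
    u-per i = cong₃ (trans (cong v (trans (sym (+-assoc p g i)) (trans (cong (_+ i) (+-comm p g)) (+-assoc g p i)))) (per (p + i)))
                    (per i) (trans (cong v (sym (+-suc g i))) (per (1 + i)))
      where
      cong₃ : ∀ {a a′ b b′ c c′} → a ≡ a′ → b ≡ b′ → c ≡ c′ → third a b c ≡ third a′ b′ c′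
      cong₃ refl refl refl = refl

    module Periodic {A : Set} (f : ℕ → A) (f-per : ∀ i → f (g + i) ≡ f i) where
      multiple : ∀ q x → f (q * g + x) ≡ f x
      multiple zero x = refl
      multiple (suc q) x = trans (cong f (+-assoc g (q * g) x)) (trans (f-per (q * g + x)) (multiple q x))

      -- Modulo `g`, `p` is -1, so `j + p * i` stands for `j` minus `i`.
      from : ∀ i j → f j ≡ f ((j + p * i) % g + i)
      from i j = trans (sym (multiple i j)) (trans (cong f shuffle) (multiple (K / g) (K % g + i)))
        where
        K = j + p * i
        shuffle : i * g + j ≡ K / g * g + (K % g + i)
        shuffle = trans (cong (_+ j) (trans (*-comm i g) (+-comm i (p * i)))) (trans (+-assoc (p * i) i j)
          (trans (cong (p * i +_) (+-comm i j)) (trans (sym (+-assoc (p * i) j i)) (trans (cong (_+ i) (trans (+-comm (p * i) j)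
            (trans (m≡m%n+[m/n]*n K g) (+-comm (K % g) _)))) (+-assoc (K / g * g) _ i)))))

    offset : ∀ i j → ∃[ k ] k < g × v j ≡ v (k + i) × u j ≡ u (k + i)
    offset i j = (j + p * i) % g , m%n<n (j + p * i) g , Periodic.from v per i j , Periodic.from u u-per i j

    seg : ∀ k i → NB (v i) (v (1 + i)) (v (k + i)) (v (suc k + i)) k
    seg zero i = stop (link i)
    seg (suc k) i = snoc (seg k i) (link (suc k + i)) (nb (k + i))

    no-closed : ∀ {a b m} → NB a b a b (suc m) → suc m < g → ⊥
    no-closed q lt = shortest lt (Close.closed q)

    -- A repetition at distance `k` closes a shorter loop unless it backtracks at the seam; then
    -- there is a repetition at distance `k` minus two inside it. `m` is fuel.
    v-distinct′ : ∀ m k i → k ≤ m → 0 < k → k < g → v i ≢ v (k + i)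
    v-distinct′ _ 1 i _ _ _ e = Adj-≢ (link i) e
    v-distinct′ _ 2 i _ _ _ e = nb i e
    v-distinct′ (suc m) (suc (suc (suc k))) i (s≤s le) _ lt e with v (2 + k + i) Fin.≟ v (1 + i)
    ... | yes e′ = v-distinct′ m (suc k) (1 + i) (<⇒≤ le) (s≤s z≤n) (<-trans (n<1+n (suc k)) (<-trans (n<1+n _) lt))
                     (trans (sym e′) (cong (v ∘ suc) (sym (+-suc k i))))
    ... | no ne = no-closed (subst (λ x → NB (v i) (v (1 + i)) x (v (1 + i)) (3 + k)) (sym e)
                     (snoc (seg (2 + k) i) (subst (λ x → Adj G x (v (1 + i))) e (link i)) ne)) lt

    v-distinct : ∀ k i → 0 < k → k < g → v i ≢ v (k + i)
    v-distinct k i = v-distinct′ k k i ≤-refl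

    distinct-inj : ∀ {A : Set} (f : ℕ → A) → (∀ k i → 0 < k → k < g → f i ≢ f (k + i)) →
                   ∀ {i a b} → a < g → b < g → f (a + i) ≡ f (b + i) → a ≡ b
    distinct-inj f ne {i} {a} {b} a< b< e = compare (<-cmp a b)
      where
      apart : ∀ {a b} → b < g → a < b → f (a + i) ≢ f (b + i)
      apart {a} {b} b< lt e = ne (b ∸ a) (a + i) (m<n⇒0<n∸m lt) (≤-<-trans (m∸n≤m b a) b<)
        (trans e (cong f (trans (cong (_+ i) (sym (m∸n+n≡m (<⇒≤ lt)))) (+-assoc (b ∸ a) a i))))
      compare : Tri (a < b) (a ≡ b) (b < a) → a ≡ b
      compare (tri≈ _ q _) = q
      compare (tri< lt _ _) = ⊥-elim (apart b< lt e)
      compare (tri> _ _ lt) = ⊥-elim (apart a< lt (sym e))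

    v-inj : ∀ {i a b} → a < g → b < g → v (a + i) ≡ v (b + i) → a ≡ b
    v-inj = distinct-inj v v-distinct

    -- Offsets 1 and `p` are excluded by the choice of the third neighbour; a chord with any other
    -- non-zero offset would close a shorter loop.
    u≢v-near : ∀ k i → k < g → u i ≢ v (k + i)
    u≢v-near zero i _ e = Adj-≢ (u-adj i) (sym e)
    u≢v-near (suc zero) i _ e = proj₂ (proj₂ (third-spec (prev i) (v i) (v (1 + i)))) e
    u≢v-near (suc (suc k)) i lt e with suc (suc k) ≟ p
    ... | yes refl = proj₁ (proj₂ (third-spec (prev i) (v i) (v (1 + i)))) e
    ... | no ne = no-closed (snoc (snoc (seg (suc k) i) (Adj-sym (subst (Adj G (v i)) e (u-adj i)))
                      (v-distinct (suc k) i (s≤s z≤n) (<-trans (n<1+n _) lt) ∘ sym))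
                    (link i) (λ e′ → v-distinct (suc k) (1 + i) (s≤s z≤n) (<-trans (n<1+n _) lt)
                      (trans (sym e′) (cong v (sym (cong suc (+-suc k i)))))))
                  (s≤s (≤∧≢⇒< (≤-pred lt) ne))

    Off : V → Set
    Off x = ∀ j → x ≢ v j

    u-off : ∀ i → Off (u i)
    u-off i j e = let (k , k< , q , _) = offset i j in u≢v-near k i k< (trans e q)

    -- An ear that is too short gives a shorter loop.
    ear₂ : ∀ k i {x} → Adj G (v (suc k + i)) x → Adj G x (v i) → Off x → suc k < g → suc k + 2 < g → ⊥
    ear₂ k i {x} a b ox k< lt = no-closed (snoc (snoc (snoc (seg k i) a (ox _ ∘ sym)) b (v-distinct (suc k) i (s≤s z≤n) k< ∘ sym))
        (link i) (ox _)) (subst (_< g) (+-comm (suc k) 2) lt)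

    ear₃ : ∀ k i {x y} → Adj G (v (suc k + i)) x → Adj G x y → Adj G y (v i) → Off x → Off y → suc k + 3 < g → ⊥
    ear₃ k i a b c ox oy lt = no-closed (snoc (snoc (snoc (snoc (seg k i) a (ox _ ∘ sym)) b (oy _ ∘ sym)) c (ox _)) (link i) (oy _))
        (subst (_< g) (+-comm (suc k) 3) lt)

    ear₄ : ∀ k i {x y z} → Adj G (v (suc k + i)) x → Adj G x y → Adj G y z → Adj G z (v i) → Off x → Off y → Off z → x ≢ z →
           suc k + 4 < g → ⊥
    ear₄ k i a b c d ox oy oz x≢z lt = no-closed
        (snoc (snoc (snoc (snoc (snoc (seg k i) a (ox _ ∘ sym)) b (oy _ ∘ sym)) c x≢z) d (oy _)) (link i) (oz _))
        (subst (_< g) (+-comm (suc k) 4) lt)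

    ring : ℕ → ℕ → List V
    ring i m = map (λ x → v (x + i)) (upTo m)

    ring-unique : ∀ i {m} → m ≤ g → Unique (ring i m)
    ring-unique i {m} m≤ = map-unique (λ x → v (x + i)) (Unique.upTo⁺ m)
      λ a b → v-inj (<-≤-trans (∈-upTo⁻ a) m≤) (<-≤-trans (∈-upTo⁻ b) m≤)

    ring-off : ∀ {i m xs} → All Off xs → ∀ {t} → t ∈ ring i m × t ∈ xs → ⊥
    ring-off {i} {m} os (r , x∈) = let (j , _ , e) = ∈-map⁻ (λ x → v (x + i)) r in All.lookup os x∈ (j + i) e

    wrap : ∀ {m} → p ≡ m → ∀ i → Adj G (v (m + i)) (v i)
    wrap refl i = prev-adj i

    p≥4 : 4 ≤ p
    p≥4 = go p refl
      where
      go : ∀ q → p ≡ q → 4 ≤ q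
      go 0 e = contradiction (sym (trans (cong (λ q → v (suc q + 0)) (sym e)) (per 0))) (Adj-≢ (link 0))
      go 1 e = contradiction (sym (trans (cong (λ q → v (suc q + 0)) (sym e)) (per 0))) (nb 0)
      go 2 e = ⊥-elim (nd (triangle-done (embed-list (v 0) (ring 0 3) (proj₂ triangle)
                (ring-unique 0 (≤-reflexive (cong suc (sym e)))) tt (link 0 ∷ link 1 ∷ wrap e 0 ∷ []))))
      go 3 e = ⊥-elim (nd (square-done (embed-list (v 0) (ring 0 4) (proj₂ square)
                (ring-unique 0 (≤-reflexive (cong suc (sym e)))) tt (link 0 ∷ link 1 ∷ link 2 ∷ wrap e 0 ∷ []))))
      go (suc (suc (suc (suc _)))) _ = s≤s (s≤s (s≤s (s≤s z≤n)))

    complement : ∀ {k} → k < g → ∀ i → v (g ∸ k + (k + i)) ≡ v i × u (g ∸ k + (k + i)) ≡ u i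
    complement {k} k< i = trans (cong v e) (per i) , trans (cong u e) (u-per i)
      where
      e : g ∸ k + (k + i) ≡ g + i
      e = trans (sym (+-assoc (g ∸ k) k i)) (cong (_+ i) (m∸n+n≡m (<⇒≤ k<)))

    Half : ℕ → Set
    Half k = 0 < k × k + k ≤ g

    half-< : ∀ {k} → Half k → k < g
    half-< {suc k} (_ , le) = ≤-trans (s≤s (≤-trans (m≤n+m (suc k) k) ≤-refl)) le

    -- Up to going round the other way, two indices differ by at most half the length of the loop.
    by-half : (P : ℕ → ℕ → Set) → (∀ {i j i′ j′} → v i ≡ v i′ × u i ≡ u i′ → v j ≡ v j′ × u j ≡ u j′ → P i j → P i′ j′) →
              (∀ {i j} → P i j → P j i) → (∀ {k} i → Half k → P i (k + i)) → ∀ k i → 0 < k → k < g → P i (k + i)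
    by-half P resp flip H k i 0< k< with k + k ≤? g
    ... | yes le = H i (0< , le)
    ... | no nle = flip (resp (refl , refl) (complement k< i) (H {g ∸ k} (k + i) (m<n⇒0<n∸m k< , half)))
      where
      half : g ∸ k + (g ∸ k) ≤ g
      half = ≤-trans (+-monoʳ-≤ (g ∸ k) (≤-trans (∸-monoˡ-≤ k (<⇒≤ (≰⇒> nle))) (≤-reflexive (m+n∸n≡m k k)))) (≤-reflexive (m∸n+n≡m (<⇒≤ k<)))

    half+2 : ∀ {k} → Half k → k + 2 < g
    half+2 {1} _ = s≤s (≤-trans (s≤s (s≤s (s≤s z≤n))) p≥4)
    half+2 {2} _ = s≤s p≥4
    half+2 {suc (suc (suc k))} (_ , le) = ≤-trans (≤-reflexive (sym (+-suc (3 + k) 2))) (≤-trans (+-monoʳ-≤ (3 + k) (s≤s (s≤s (s≤s (z≤n {k}))))) le)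

    u-distinct : ∀ k i → 0 < k → k < g → u i ≢ u (k + i)
    u-distinct = by-half (λ i j → u i ≢ u j) (λ (_ , e) (_ , e′) ne q → ne (trans e (trans q (sym e′)))) (_∘ sym) H
      where
      H : ∀ {k} i → Half k → u i ≢ u (k + i)
      H {suc k} i hf e = ear₂ k i (u-adj (suc k + i)) (Adj-sym (subst (Adj G (v i)) e (u-adj i))) (u-off _) (half-< hf) (half+2 hf)

    foot : ∀ {i k} → 0 < k → k < g → ¬ Adj G (u i) (v (k + i))
    foot {i} {k} 0< k< a with nbrs (Adj-sym a)
    ... | inj₁ e = u-off i _ e
    ... | inj₂ (inj₁ e) = u-off i _ e
    ... | inj₂ (inj₂ e) = u-distinct k i 0< k< e

    not-pentagon : ∀ {m} → p ≡ 5 + m → Emb pentagon → Done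
    not-pentagon e emb = contradiction (pentagon-loop emb)
      (shortest (s≤s (subst (5 ≤_) (sym e) (s≤s (s≤s (s≤s (s≤s (s≤s z≤n))))))))

    module NP {m} (e : p ≡ 5 + m) = NoPentagon (not-pentagon e)

    big : ∀ k {m} → 4 ≤ k → k + k ≤ g → ¬ (k + m < g) → m < 4 → ⊥
    big k {m} 4≤k le nlt m< = <⇒≱ m< (≤-trans 4≤k (+-cancelˡ-≤ k k m (≤-trans le (≮⇒≥ nlt))))

    -- If an ear of length three or four spanning k steps is not a shortcut, k and the loop are small.
    span₃ : ∀ {k} → Half k → (k + 3 < g) ⊎ (k ≡ 2 × p ≡ 4) ⊎ (k ≡ 3 × p ≡ 5)
    span₃ {k} (0< , le) with k + 3 <? g
    ... | yes lt = inj₁ lt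
    ... | no nlt = inj₂ (go k 0< le nlt)
      where
      go : ∀ k → 0 < k → k + k ≤ g → ¬ (k + 3 < g) → (k ≡ 2 × p ≡ 4) ⊎ (k ≡ 3 × p ≡ 5)
      go 1 _ _ nlt = contradiction (≤-pred (≮⇒≥ nlt)) (<⇒≱ p≥4)
      go 2 _ _ nlt = inj₁ (refl , ≤-antisym (≤-pred (≮⇒≥ nlt)) p≥4)
      go 3 _ le nlt = inj₂ (refl , ≤-antisym (≤-pred (≮⇒≥ nlt)) (≤-pred le))
      go (suc (suc (suc (suc k)))) _ le nlt = ⊥-elim (big (4 + k) (s≤s (s≤s (s≤s (s≤s z≤n)))) le nlt ≤-refl)

    -- Each exception yields a theta graph with paths of lengths `k`, `g ∸ k` and 4: in this order
    -- the ones with subscripts 144, 234, 244, 334 and 344.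
    span₄ : ∀ {k} → Half k → k ≤ 3 →
      (k + 4 < g) ⊎ (k ≡ 1 × p ≡ 4) ⊎ (k ≡ 2 × p ≡ 4) ⊎ (k ≡ 2 × p ≡ 5) ⊎ (k ≡ 3 × p ≡ 5) ⊎ (k ≡ 3 × p ≡ 6)
    span₄ {k} (0< , le) k≤3 with k + 4 <? g
    ... | yes lt = inj₁ lt
    ... | no nlt = inj₂ (go k 0< k≤3 le nlt)
      where
      go : ∀ k → 0 < k → k ≤ 3 → k + k ≤ g → ¬ (k + 4 < g) →
        (k ≡ 1 × p ≡ 4) ⊎ (k ≡ 2 × p ≡ 4) ⊎ (k ≡ 2 × p ≡ 5) ⊎ (k ≡ 3 × p ≡ 5) ⊎ (k ≡ 3 × p ≡ 6)
      go 1 _ _ _ nlt = inj₁ (refl , ≤-antisym (≤-pred (≮⇒≥ nlt)) p≥4)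
      go 2 _ _ _ nlt with m≤n⇒m<n∨m≡n p≥4
      ... | inj₁ 5≤p = inj₂ (inj₂ (inj₁ (refl , ≤-antisym (≤-pred (≮⇒≥ nlt)) 5≤p)))
      ... | inj₂ e = inj₂ (inj₁ (refl , sym e))
      go 3 _ _ le nlt with m≤n⇒m<n∨m≡n (≤-pred le)
      ... | inj₁ 6≤p = inj₂ (inj₂ (inj₂ (inj₂ (refl , ≤-antisym (≤-pred (≮⇒≥ nlt)) 6≤p))))
      ... | inj₂ e = inj₂ (inj₂ (inj₂ (inj₁ (refl , sym e))))
      go (suc (suc (suc (suc _)))) _ (s≤s (s≤s (s≤s ()))) _ _

    pendants-unique : ∀ {i k m} → Half k → m ≤ g → Unique (ring i m ++ u i ∷ u (k + i) ∷ [])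
    pendants-unique {i} {k} {m} hf m≤ = Unique.++⁺ (ring-unique i m≤) ((u-distinct k i (proj₁ hf) (half-< hf) ∷ []) ∷ [] ∷ [])
      (ring-off {i} {m} (u-off _ ∷ u-off _ ∷ []))

    -- An edge between pendants is an ear of length three. It is no shortcut only for feet two steps
    -- apart on a pentagon or three steps apart on a hexagon, which gives `theta₂₃₃` or `theta₃₃₃`.
    pendants-apart : ∀ k i → 0 < k → k < g → ¬ Adj G (u i) (u (k + i))
    pendants-apart = by-half (λ i j → ¬ Adj G (u i) (u j)) (λ (_ , e) (_ , e′) na a → na (subst₂ (Adj G) (sym e) (sym e′) a))
        (λ na a → na (Adj-sym a)) H
      where
      H : ∀ {k} i → Half k → ¬ Adj G (u i) (u (k + i))
      H {suc k} i hf a with span₃ hf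
      ... | inj₁ lt = ear₃ k i (u-adj (suc k + i)) (Adj-sym a) (Adj-sym (u-adj i)) (u-off _) (u-off _) lt
      ... | inj₂ (inj₁ (refl , e)) = nd (theta₂₃₃-done (embed-list (v i) (ring i 5 ++ u i ∷ u (2 + i) ∷ []) (proj₂ theta₂₃₃)
              (pendants-unique hf (≤-reflexive (cong suc (sym e)))) tt
              (link i ∷ link (1 + i) ∷ link (2 + i) ∷ link (3 + i) ∷ wrap e i ∷ u-adj i ∷ u-adj (2 + i) ∷ a ∷ [])))
      ... | inj₂ (inj₂ (refl , e)) = nd (NP.theta₃₃₃-done e (embed-list (v i) (ring i 6 ++ u i ∷ u (3 + i) ∷ []) (proj₂ theta₃₃₃)
              (pendants-unique hf (≤-reflexive (cong suc (sym e)))) tt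
              (link i ∷ link (1 + i) ∷ link (2 + i) ∷ link (3 + i) ∷ link (4 + i) ∷ wrap e i ∷ u-adj i ∷ u-adj (3 + i) ∷ a ∷ [])))

    -- A common neighbour of two pendants whose feet are at most three steps apart closes a short theta graph.
    no-common : ∀ {k} i → Half k → k ≤ 3 → ∀ {w} → Adj G (u i) w → Adj G w (u (k + i)) → ⊥
    no-common {suc k} i hf k≤3 {w} a b = [ short , [ t₁₄₄ , [ t₂₃₄ , [ t₂₄₄ , [ t₃₃₄ , t₃₄₄ ]′ ]′ ]′ ]′ ]′ (span₄ hf k≤3)
      where
      k< = half-< hf
      u≢u = u-distinct (suc k) i (s≤s z≤n) k<
      w-off : Off w
      w-off j refl with offset i j
      ... | zero , _ , e , _ = clash (nbrs {i} (subst (λ x → Adj G x (u (suc k + i))) e b))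
        where
        clash : _ → ⊥
        clash (inj₁ q) = u-off _ _ q
        clash (inj₂ (inj₁ q)) = u-off _ _ q
        clash (inj₂ (inj₂ q)) = u≢u (sym q)
      ... | suc m , m< , e , _ = foot {i} {suc m} (s≤s z≤n) m< (subst (Adj G (u i)) e a)
      uniq : ∀ {m} → m ≤ g → Unique (ring i m ++ u i ∷ u (suc k + i) ∷ w ∷ [])
      uniq {m} m≤ = Unique.++⁺ (ring-unique i m≤) ((u≢u ∷ Adj-≢ a ∷ []) ∷ ((Adj-≢ b ∘ sym) ∷ []) ∷ [] ∷ [])
        (ring-off {i} {m} (u-off _ ∷ u-off _ ∷ w-off ∷ []))
      short : suc k + 4 < g → ⊥
      short = ear₄ k i (u-adj (suc k + i)) (Adj-sym b) (Adj-sym a) (Adj-sym (u-adj i)) (u-off _) w-off (u-off _) (u≢u ∘ sym)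
      t₁₄₄ : suc k ≡ 1 × p ≡ 4 → ⊥
      t₁₄₄ (refl , e) = nd (theta₁₄₄-done (embed-list (v i) (ring i 5 ++ u i ∷ u (1 + i) ∷ w ∷ []) (proj₂ theta₁₄₄)
              (uniq (≤-reflexive (cong suc (sym e)))) tt
              (link i ∷ link (1 + i) ∷ link (2 + i) ∷ link (3 + i) ∷ wrap e i ∷ u-adj i ∷ u-adj (1 + i) ∷ a ∷ Adj-sym b ∷ [])))
      t₂₃₄ : suc k ≡ 2 × p ≡ 4 → ⊥
      t₂₃₄ (refl , e) = nd (theta₂₃₄-done (embed-list (v i) (ring i 5 ++ u i ∷ u (2 + i) ∷ w ∷ []) (proj₂ theta₂₃₄)
              (uniq (≤-reflexive (cong suc (sym e)))) tt
              (link i ∷ link (1 + i) ∷ link (2 + i) ∷ link (3 + i) ∷ wrap e i ∷ u-adj i ∷ u-adj (2 + i) ∷ a ∷ Adj-sym b ∷ [])))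
      t₂₄₄ : suc k ≡ 2 × p ≡ 5 → ⊥
      t₂₄₄ (refl , e) = nd (NP.theta₂₄₄-done e (embed-list (v i) (ring i 6 ++ u i ∷ u (2 + i) ∷ w ∷ []) (proj₂ theta₂₄₄)
              (uniq (≤-reflexive (cong suc (sym e)))) tt
              (link i ∷ link (1 + i) ∷ link (2 + i) ∷ link (3 + i) ∷ link (4 + i) ∷ wrap e i ∷ u-adj i ∷ u-adj (2 + i) ∷ a ∷ Adj-sym b ∷ [])))
      t₃₃₄ : suc k ≡ 3 × p ≡ 5 → ⊥
      t₃₃₄ (refl , e) = nd (NP.theta₃₃₄-done e (embed-list (v i) (ring i 6 ++ u i ∷ u (3 + i) ∷ w ∷ []) (proj₂ theta₃₃₄)
              (uniq (≤-reflexive (cong suc (sym e)))) tt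
              (link i ∷ link (1 + i) ∷ link (2 + i) ∷ link (3 + i) ∷ link (4 + i) ∷ wrap e i ∷ u-adj i ∷ u-adj (3 + i) ∷ a ∷ Adj-sym b ∷ [])))
      t₃₄₄ : suc k ≡ 3 × p ≡ 6 → ⊥
      t₃₄₄ (refl , e) = nd (NP.theta₃₄₄-done e (embed-list (v i) (ring i 7 ++ u i ∷ u (3 + i) ∷ w ∷ []) (proj₂ theta₃₄₄)
              (uniq (≤-reflexive (cong suc (sym e)))) tt
              (link i ∷ link (1 + i) ∷ link (2 + i) ∷ link (3 + i) ∷ link (4 + i) ∷ link (5 + i) ∷ wrap e i ∷ u-adj i ∷ u-adj (3 + i) ∷ a ∷ Adj-sym b ∷ [])))

    pendants-far : ∀ k i → 0 < k → k ≤ 3 → ¬ Adj² G (u i) (u (k + i))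
    pendants-far k i 0< k≤3 (_ , inj₁ a) = pendants-apart k i 0< (≤-<-trans k≤3 (s≤s (≤-trans (n≤1+n 3) p≥4))) a
    pendants-far k i 0< k≤3 (_ , inj₂ (w , a , b)) with k + k ≤? g
    ... | yes le = no-common i (0< , le) k≤3 a b
    -- This occurs only for `k` three and `g` five; the other way round, the feet are two steps
    -- apart.
    ... | no nle = no-common {g ∸ k} (k + i) (m<n⇒0<n∸m k< , half)
          (≤-trans small k≤3) (Adj-sym b) (subst (Adj G w) (sym (proj₂ (complement k< i))) (Adj-sym a))
      where
      k< : k < g
      k< = ≤-<-trans k≤3 (s≤s (≤-trans (n≤1+n 3) p≥4))
      small : g ∸ k ≤ k
      small = ≤-trans (∸-monoˡ-≤ k (<⇒≤ (≰⇒> nle))) (≤-reflexive (m+n∸n≡m k k))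
      half : g ∸ k + (g ∸ k) ≤ g
      half = ≤-trans (+-monoʳ-≤ (g ∸ k) small) (≤-reflexive (m∸n+n≡m (<⇒≤ k<)))

    -- A common neighbour would be one of the three neighbours of `v (k + i)`, none of which is
    -- adjacent to `u i`. The bounds on `k` leave out `v i` and its two neighbours on the loop.
    foot-far : ∀ k i → 2 ≤ k → suc k < g → ¬ Adj² G (u i) (v (k + i))
    foot-far k i 2≤ k< (_ , inj₁ a) = foot {i} {k} (<⇒≤ 2≤) (<⇒≤ k<) a
    foot-far (suc k) i (s≤s 1≤) k< (_ , inj₂ (z , a , b)) with nbrs (Adj-sym b)
    ... | inj₁ refl = foot {i} {k} 1≤ (<⇒≤ (<⇒≤ k<)) (subst (Adj G (u i)) (prev-suc (k + i)) a)
    ... | inj₂ (inj₁ refl) = foot {i} {suc (suc k)} (s≤s z≤n) k< a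
    ... | inj₂ (inj₂ refl) = pendants-apart (suc k) i (s≤s z≤n) (<⇒≤ k<) a

  -- Winning plays complete the colouring

  path-snoc : ∀ {P : V → Set} {x y z} → Path P x y → Adj G y z → P z → Path P x z
  path-snoc (end py) a pz = edge py a (end pz)
  path-snoc (edge px b q) a pz = edge px b (path-snoc q a pz)

  path-map : ∀ {P Q : V → Set} → (∀ {t} → P t → Q t) → ∀ {x y} → Path P x y → Path Q x y
  path-map f (end p) = end (f p)
  path-map f (edge p a q) = edge (f p) a (path-map f q)

  -- A winning choice of colours for four pendants x₀,…,x₃ and the cut vertex z leaves y₁ and y₂ with
  -- enough slack to finish greedily.
  module Play {c : PC} (P : Proper c) (s₀ : ∀ {w} → S c w 0)
    {x₀ x₁ x₂ x₃ y₁ y₂ z : V} (ux₀ : Unc c x₀) (ux₁ : Unc c x₁) (ux₂ : Unc c x₂) (ux₃ : Unc c x₃) (uz : Unc c z)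
    (uy₁ : Unc c y₁) (uy₂ : Unc c y₂)
    (distinct : Unique (x₀ ∷ x₁ ∷ x₂ ∷ x₃ ∷ z ∷ []))
    (y₁∉ : y₁ ∉ x₀ ∷ x₁ ∷ x₂ ∷ x₃ ∷ z ∷ []) (y₂∉ : y₂ ∉ x₀ ∷ x₁ ∷ x₂ ∷ x₃ ∷ z ∷ [])
    (n₀₁ : ¬ Adj² G x₀ x₁) (n₀₂ : ¬ Adj² G x₀ x₂) (n₀₃ : ¬ Adj² G x₀ x₃)
    (n₁₂ : ¬ Adj² G x₁ x₂) (n₁₃ : ¬ Adj² G x₁ x₃) (n₂₃ : ¬ Adj² G x₂ x₃)
    (n₀z : ¬ Adj² G x₀ z) (n₁z : ¬ Adj² G x₁ z)
    (y₁∼ : All (Adj² G y₁) (x₀ ∷ x₁ ∷ x₂ ∷ z ∷ [])) (y₂∼ : All (Adj² G y₂) (x₁ ∷ x₂ ∷ x₃ ∷ z ∷ []))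
    (y₁≁ : ¬ Adj² G y₁ x₃) (y₂≁ : ¬ Adj² G y₂ x₀) (y₁∼y₂ : Adj G y₁ y₂)
    (seven₁ : length (unc c y₁) ≤ 7) (seven₂ : length (unc c y₂) ≤ 7)
    (paths : ∀ {w} → Unc c w → w ∉ x₀ ∷ x₁ ∷ x₂ ∷ x₃ ∷ z ∷ [] → Path (λ t → Unc c t × t ∉ x₀ ∷ x₁ ∷ x₂ ∷ x₃ ∷ z ∷ []) w y₁)
    {A₁ A₂ C : List ℕ} (six₁ : Six A₁) (six₂ : Six A₂) (A₁⊑ : A₁ ⊑ avail c y₁) (A₂⊑ : A₂ ⊑ avail c y₂) (C⊑ : C ⊑ avail c z)
    where

    module _ {a₀ a₁ a₂ a₃ p} (i₀ : a₀ ∈ avail c x₀) (i₁ : a₁ ∈ avail c x₁) (i₂ : a₂ ∈ avail c x₂) (i₃ : a₃ ∈ avail c x₃)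
             (ip : p ∈ avail c z) (p≢a₂ : p ≢ a₂) (p≢a₃ : p ≢ a₃) where
      as : Assignment
      as = (x₀ , a₀) ∷ (x₁ , a₁) ∷ (x₂ , a₂) ∷ (x₃ , a₃) ∷ (z , p) ∷ []

      asg : Asg c as
      asg = case distinct of λ { (d₀ ∷ d₁ ∷ d₂ ∷ d₃ ∷ _ ∷ []) →
        (ux₀ , All-≢⁻ d₀ , i₀ , λ { (here refl) a → contradiction a n₀₁ ; (there (here refl)) a → contradiction a n₀₂
                                  ; (there (there (here refl))) a → contradiction a n₀₃
                                  ; (there (there (there (here refl)))) a → contradiction a n₀z }) ∷
        (ux₁ , All-≢⁻ d₁ , i₁ , λ { (here refl) a → contradiction a n₁₂ ; (there (here refl)) a → contradiction a n₁₃
                                  ; (there (there (here refl))) a → contradiction a n₁z }) ∷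
        (ux₂ , All-≢⁻ d₂ , i₂ , λ { (here refl) a → contradiction a n₂₃ ; (there (here refl)) _ → p≢a₂ ∘ sym }) ∷
        (ux₃ , All-≢⁻ d₃ , i₃ , λ { (here refl) _ → p≢a₃ ∘ sym }) ∷ (uz , (λ ()) , ip , λ ()) ∷ [] }

      c′ : PC
      c′ = upd c as

      -- Of seven uncoloured square-neighbours, four are coloured by the batch. With six colours, a
      -- loss of `k` leaves slack `4 ∸ k`; hence the losses 3 and 2 in `Balanced`, which give slacks
      -- 1 and 2.
      four : ∀ u k m → u ≤ 7 → k + m ≤ 4 → u + m + k ≤ 7 + 4
      four u k m u≤ le = ≤-trans (≤-reflexive (+-assoc u m k)) (+-mono-≤ u≤ (≤-trans (≤-reflexive (+-comm m k)) le))

      slack₁ : ∀ m → length (hit A₁ (a₀ ∷ a₁ ∷ a₂ ∷ p ∷ [])) + m ≤ 4 → S c′ y₁ m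
      slack₁ m le = case distinct of λ { ((d₀₁ ∷ d₀₂ ∷ d₀₃ ∷ d₀z ∷ []) ∷ (d₁₂ ∷ d₁₃ ∷ d₁z ∷ []) ∷ (d₂₃ ∷ d₂z ∷ []) ∷ _) →
        upd-S c as (x₀ ∷ x₁ ∷ x₂ ∷ z ∷ []) (hit A₁ (a₀ ∷ a₁ ∷ a₂ ∷ p ∷ [])) (proj₁ six₁) A₁⊑ hits
          ((d₀₁ ∷ d₀₂ ∷ d₀z ∷ []) ∷ (d₁₂ ∷ d₁z ∷ []) ∷ (d₂z ∷ []) ∷ [] ∷ [])
          (λ { i@(here refl) → here refl , ux₀ , All.lookup y₁∼ i
             ; i@(there (here refl)) → there (here refl) , ux₁ , All.lookup y₁∼ i
             ; i@(there (there (here refl))) → there (there (here refl)) , ux₂ , All.lookup y₁∼ i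
             ; i@(there (there (there (here refl)))) → there (there (there (there (here refl)))) , uz , All.lookup y₁∼ i })
          (subst (λ k → length (unc c y₁) + m + length (hit A₁ (a₀ ∷ a₁ ∷ a₂ ∷ p ∷ [])) ≤ suc k + 4) (sym (proj₂ six₁))
            (four (length (unc c y₁)) _ m seven₁ le)) }
        where
        hits : ∀ {v q} → q ∈ A₁ → (v , q) ∈ as → Adj² G y₁ v → q ∈ hit A₁ (a₀ ∷ a₁ ∷ a₂ ∷ p ∷ [])
        hits q∈ (here refl) _ = ∈-filter⁺ (_∈ℕ? _) q∈ (here refl)
        hits q∈ (there (here refl)) _ = ∈-filter⁺ (_∈ℕ? _) q∈ (there (here refl))
        hits q∈ (there (there (here refl))) _ = ∈-filter⁺ (_∈ℕ? _) q∈ (there (there (here refl)))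
        hits q∈ (there (there (there (here refl)))) a = contradiction a y₁≁
        hits q∈ (there (there (there (there (here refl))))) _ = ∈-filter⁺ (_∈ℕ? _) q∈ (there (there (there (here refl))))

      slack₂ : ∀ m → length (hit A₂ (a₁ ∷ a₂ ∷ a₃ ∷ p ∷ [])) + m ≤ 4 → S c′ y₂ m
      slack₂ m le = case distinct of λ { (_ ∷ (d₁₂ ∷ d₁₃ ∷ d₁z ∷ []) ∷ (d₂₃ ∷ d₂z ∷ []) ∷ (d₃z ∷ []) ∷ _) →
        upd-S c as (x₁ ∷ x₂ ∷ x₃ ∷ z ∷ []) (hit A₂ (a₁ ∷ a₂ ∷ a₃ ∷ p ∷ [])) (proj₁ six₂) A₂⊑ hits
          ((d₁₂ ∷ d₁₃ ∷ d₁z ∷ []) ∷ (d₂₃ ∷ d₂z ∷ []) ∷ (d₃z ∷ []) ∷ [] ∷ [])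
          (λ { i@(here refl) → there (here refl) , ux₁ , All.lookup y₂∼ i
             ; i@(there (here refl)) → there (there (here refl)) , ux₂ , All.lookup y₂∼ i
             ; i@(there (there (here refl))) → there (there (there (here refl))) , ux₃ , All.lookup y₂∼ i
             ; i@(there (there (there (here refl)))) → there (there (there (there (here refl)))) , uz , All.lookup y₂∼ i })
          (subst (λ k → length (unc c y₂) + m + length (hit A₂ (a₁ ∷ a₂ ∷ a₃ ∷ p ∷ [])) ≤ suc k + 4) (sym (proj₂ six₂))
            (four (length (unc c y₂)) _ m seven₂ le)) }
        where
        hits : ∀ {v q} → q ∈ A₂ → (v , q) ∈ as → Adj² G y₂ v → q ∈ hit A₂ (a₁ ∷ a₂ ∷ a₃ ∷ p ∷ [])
        hits q∈ (here refl) a = contradiction a y₂≁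
        hits q∈ (there (here refl)) _ = ∈-filter⁺ (_∈ℕ? _) q∈ (here refl)
        hits q∈ (there (there (here refl))) _ = ∈-filter⁺ (_∈ℕ? _) q∈ (there (here refl))
        hits q∈ (there (there (there (here refl)))) _ = ∈-filter⁺ (_∈ℕ? _) q∈ (there (there (here refl)))
        hits q∈ (there (there (there (there (here refl))))) _ = ∈-filter⁺ (_∈ℕ? _) q∈ (there (there (there (here refl))))

      unc′ : ∀ {t} → Unc c t × t ∉ x₀ ∷ x₁ ∷ x₂ ∷ x₃ ∷ z ∷ [] → Unc c′ t
      unc′ (a , b) = upd-unc c as a b

      path₁ : ∀ {w} → Unc c′ w → Path (Unc c′) w y₁
      path₁ {w} uw = let (a , b) = upd-none c as uw in path-map unc′ (paths a b)

      balanced : Balanced A₁ A₂ a₀ a₁ a₂ a₃ p → Done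
      balanced (inj₁ (l₁ , l₂)) = endgame (upd-proper P asg) y₁∼y₂ (unc′ (uy₁ , y₁∉)) (unc′ (uy₂ , y₂∉))
        (slack₁ 1 (+-monoˡ-≤ 1 l₁)) (slack₂ 2 (+-monoˡ-≤ 2 l₂)) (λ _ → S-mono asg s₀) path₁
      balanced (inj₂ (l₁ , l₂)) = endgame (upd-proper P asg) (Adj-sym y₁∼y₂) (unc′ (uy₂ , y₂∉)) (unc′ (uy₁ , y₁∉))
        (slack₂ 1 (+-monoˡ-≤ 1 l₂)) (slack₁ 2 (+-monoˡ-≤ 2 l₁)) (λ _ → S-mono asg s₀)
        (λ uw → path-snoc (path₁ uw) y₁∼y₂ (unc′ (uy₂ , y₂∉)))

    win : Win (avail c x₀) (avail c x₁) (avail c x₂) (avail c x₃) A₁ A₂ C → Done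
    win (_ , i₀ , _ , i₁ , _ , i₂ , _ , i₃ , _ , ip , n₂ , n₃ , b) = balanced i₀ i₁ i₂ i₃ (C⊑ ip) n₂ n₃ b

  -- Colouring around a shortest loop

  module Rigid (p : ℕ) (lp : Loop (suc p)) (nd : ¬ Done) (shortest : ∀ {m} → m < suc p → ¬ Loop m) where
    open Short p lp nd shortest

    5≤g : 5 ≤ g
    5≤g = s≤s p≥4

    -- `x + 0` has the shape `k + i` of the lemmas on offsets, with base index 0.
    feet pendants : List V
    feet = map (λ x → v (x + 0)) (upTo g)
    pendants = map (λ x → u (x + 0)) (upTo g)

    u-inj : ∀ {a b} → a < g → b < g → u (a + 0) ≡ u (b + 0) → a ≡ b
    u-inj = distinct-inj u u-distinct

    pendants-unique′ : Unique pendants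
    pendants-unique′ = map-unique (λ x → u (x + 0)) (Unique.upTo⁺ g) λ a b → u-inj (∈-upTo⁻ a) (∈-upTo⁻ b)

    R : List V
    R = feet ++ pendants

    v∈feet : ∀ j → v j ∈ feet
    v∈feet j = let (k , k< , e , _) = offset 0 j in subst (_∈ feet) (sym e) (∈-map⁺ (λ x → v (x + 0)) (∈-upTo⁺ k<))

    u∈pendants : ∀ j → u j ∈ pendants
    u∈pendants j = let (k , k< , _ , e) = offset 0 j in subst (_∈ pendants) (sym e) (∈-map⁺ (λ x → u (x + 0)) (∈-upTo⁺ k<))

    R-cases : ∀ {t} → t ∈ R → (∃[ j ] t ≡ v j) ⊎ (∃[ j ] t ≡ u j)
    R-cases t∈ with ∈-++⁻ feet t∈
    ... | inj₁ i = let (j , _ , e) = ∈-map⁻ (λ x → v (x + 0)) i in inj₁ (_ , e)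
    ... | inj₂ i = let (j , _ , e) = ∈-map⁻ (λ x → u (x + 0)) i in inj₂ (_ , e)

    R-unique : Unique R
    R-unique = Unique.++⁺ (ring-unique 0 ≤-refl) pendants-unique′
      λ (i , j) → let (_ , _ , e) = ∈-map⁻ (λ x → v (x + 0)) i ; (_ , _ , e′) = ∈-map⁻ (λ x → u (x + 0)) j in u-off _ _ (trans (sym e′) e)

    R-nb : ∀ {r} → r ∈ R → ∃[ r′ ] r′ ∈ R × Adj G r r′
    R-nb r∈ with R-cases r∈
    ... | inj₁ (j , refl) = v (1 + j) , ∈-++⁺ˡ (v∈feet (1 + j)) , link j
    ... | inj₂ (j , refl) = v j , ∈-++⁺ˡ (v∈feet j) , Adj-sym (u-adj j)

    same-foot : ∀ {a b} → v a ≡ v b → u a ≡ u b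
    same-foot {a} {b} e with offset b a
    ... | zero , _ , _ , q = q
    ... | suc k , k< , q , _ = contradiction (trans (sym e) q) (v-distinct (suc k) b (s≤s z≤n) k<)

    module Coloured {c : PC} (P : Proper c) (unc-R : ∀ {t} → Unc c t → t ∈ R) (R-unc : ∀ {t} → t ∈ R → Unc c t)
                    (s₀ : ∀ {w} → S c w 0) where

      v-unc : ∀ j → Unc c (v j)
      v-unc j = R-unc (∈-++⁺ˡ (v∈feet j))
      u-unc : ∀ j → Unc c (u j)
      u-unc j = R-unc (∈-++⁺ʳ feet (u∈pendants j))

      U : ℕ → List ℕ
      U j = avail c (u j)

      u∼prev : ∀ j → Adj² G (u j) (prev j)
      u∼prev j = adj₂ (u-off j _) (Adj-sym (u-adj j)) (Adj-sym (prev-adj j))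
      u∼next : ∀ j → Adj² G (u j) (v (1 + j))
      u∼next j = adj₂ (u-off j _) (Adj-sym (u-adj j)) (link j)

      feet₃ : ∀ j → Unique (v j ∷ prev j ∷ v (1 + j) ∷ [])
      feet₃ j = ((Adj-≢ (prev-adj j) ∘ sym) ∷ Adj-≢ (link j) ∷ []) ∷ (prev≢next j ∷ []) ∷ [] ∷ []

      feet₃-near : ∀ j {t} → t ∈ v j ∷ prev j ∷ v (1 + j) ∷ [] → Adj² G (u j) t × Unc c t
      feet₃-near j (here refl) = adj₁ (Adj-sym (u-adj j)) , v-unc j
      feet₃-near j (there (here refl)) = u∼prev j , v-unc (p + j)
      feet₃-near j (there (there (here refl))) = u∼next j , v-unc (1 + j)

      -- Three uncoloured square-neighbours on the loop and slack 0 leave at least two colours.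
      two : ∀ j → Two (U j)
      two j = get (avail-unique c (u j)) (≤-pred (≤-trans (unc-lower (feet₃ j) (feet₃-near j))
                (≤-trans (≤-reflexive (sym (+-identityʳ _))) (S.bound s₀))))
        where
        get : ∀ {xs} → Unique xs → 2 ≤ length xs → Two xs
        get {x ∷ y ∷ _} ((ne ∷ _) ∷ _) _ = x , y , here refl , there (here refl) , ne
        get {_ ∷ []} _ (s≤s ())

      -- All uncoloured square-neighbours of `v (2 + i)`. The centre is at `2 + i` so that no index
      -- has to be lowered.
      around : ℕ → List V
      around i = v i ∷ v (1 + i) ∷ v (3 + i) ∷ v (4 + i) ∷ u (1 + i) ∷ u (2 + i) ∷ u (3 + i) ∷ []

      around-near : ∀ i {t} → t ∈ around i → Adj² G (v (2 + i)) t × Unc c t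
      around-near i = All.lookup {P = λ t → Adj² G (v (2 + i)) t × Unc c t} (
        (adj₂ (nb i ∘ sym) (Adj-sym (link (1 + i))) (Adj-sym (link i)) , v-unc i) ∷
        (adj₁ (Adj-sym (link (1 + i))) , v-unc (1 + i)) ∷
        (adj₁ (link (2 + i)) , v-unc (3 + i)) ∷
        (adj₂ (nb (2 + i)) (link (2 + i)) (link (3 + i)) , v-unc (4 + i)) ∷
        (adj₂ (u-off (1 + i) _ ∘ sym) (Adj-sym (link (1 + i))) (u-adj (1 + i)) , u-unc (1 + i)) ∷
        (adj₁ (u-adj (2 + i)) , u-unc (2 + i)) ∷
        (adj₂ (u-off (3 + i) _ ∘ sym) (link (2 + i)) (u-adj (3 + i)) , u-unc (3 + i)) ∷ [])

      around-unique : ∀ i → Unique (around i)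
      around-unique i =
        (vd 1 i ∷ vd 3 i ∷ vd 4 i ∷ vu ∷ vu ∷ vu ∷ []) ∷ (vd 2 (1 + i) ∷ vd 3 (1 + i) ∷ vu ∷ vu ∷ vu ∷ []) ∷
        (vd 1 (3 + i) ∷ vu ∷ vu ∷ vu ∷ []) ∷ (vu ∷ vu ∷ vu ∷ []) ∷
        (ud 1 (1 + i) ∷ ud 2 (1 + i) ∷ []) ∷ (ud 1 (2 + i) ∷ []) ∷ [] ∷ []
        where
        open import Relation.Nullary.Decidable using (True; toWitness)
        vd : ∀ k j {_ : True (1 ≤? k)} {_ : True (k <? 5)} → v j ≢ v (k + j)
        vd k j {a} {b} = v-distinct k j (toWitness a) (<-≤-trans (toWitness b) 5≤g)
        ud : ∀ k j {_ : True (1 ≤? k)} {_ : True (k <? 5)} → u j ≢ u (k + j)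
        ud k j {a} {b} = u-distinct k j (toWitness a) (<-≤-trans (toWitness b) 5≤g)
        vu : ∀ {a b} → v a ≢ u b
        vu {a} {b} e = u-off b a (sym e)

      around-all : ∀ i {t} → Adj² G (v (2 + i)) t → Unc c t → t ∈ around i
      around-all i {t} (ne , inj₁ a) _ with nbrs a
      ... | inj₁ e = there (here (trans e (prev-suc (1 + i))))
      ... | inj₂ (inj₁ e) = there (there (here e))
      ... | inj₂ (inj₂ e) = there (there (there (there (there (here e)))))
      around-all i {t} (ne , inj₂ (w , a , b)) ut with nbrs a
      ... | inj₁ refl with nbrs {1 + i} (subst (λ x → Adj G x t) (prev-suc (1 + i)) b)
      ...   | inj₁ e = here (trans e (prev-suc i))
      ...   | inj₂ (inj₁ e) = contradiction (sym e) ne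
      ...   | inj₂ (inj₂ e) = there (there (there (there (here e))))
      around-all i {t} (ne , inj₂ (w , a , b)) ut | inj₂ (inj₁ refl) with nbrs {3 + i} b
      ...   | inj₁ e = contradiction (sym (trans e (prev-suc (2 + i)))) ne
      ...   | inj₂ (inj₁ e) = there (there (there (here e)))
      ...   | inj₂ (inj₂ e) = there (there (there (there (there (there (here e))))))
      around-all i {t} (ne , inj₂ (w , a , b)) ut | inj₂ (inj₂ refl) with R-cases (unc-R ut)
      ...   | inj₁ (j , refl) = ⊥-elim (onfoot (offset (2 + i) j))
        where
        onfoot : (∃[ k ] k < g × v j ≡ v (k + (2 + i)) × u j ≡ u (k + (2 + i))) → ⊥
        onfoot (zero , _ , e , _) = ne (sym e)
        onfoot (suc k , k< , e , _) = foot {2 + i} {suc k} (s≤s z≤n) k< (subst (Adj G (u (2 + i))) e b)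
      ...   | inj₂ (j , refl) = ⊥-elim (onpendant (offset (2 + i) j))
        where
        onpendant : (∃[ k ] k < g × v j ≡ v (k + (2 + i)) × u j ≡ u (k + (2 + i))) → ⊥
        onpendant (zero , _ , _ , e) = Adj-≢ b (sym e)
        onpendant (suc k , k< , _ , e) = pendants-apart (suc k) (2 + i) (s≤s z≤n) k< (subst (Adj G (u (2 + i))) e b)

      -- Since s + s p = s g, facts about the indices s, s + 1, … hold for all indices.
      shifted : ∀ s j → v (s + (s * p + j)) ≡ v j × u (s + (s * p + j)) ≡ u j
      shifted s j = trans (cong v e) (Periodic.multiple v per s j) , trans (cong u e) (Periodic.multiple u u-per s j)
        where
        e : s + (s * p + j) ≡ s * g + j
        e = trans (sym (+-assoc s (s * p) j)) (cong (_+ j) (sym (*-suc s p)))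

      unc-seven : ∀ j → length (unc c (v j)) ≡ 7
      unc-seven j = subst (λ x → length (unc c x) ≡ 7) (proj₁ (shifted 2 j))
        (≤-antisym (unc-upper (around i) (around-all i)) (unc-lower (around-unique i) (around-near i)))
        where i = 2 * p + j

      A : ℕ → List ℕ
      A j = take 6 (avail c (v j))

      six : ∀ j → Six (A j)
      six j = Unique.take⁺ 6 (avail-unique c (v j)) , trans (length-take 6 (avail c (v j))) (m≤n⇒m⊓n≡m
        (≤-pred (≤-trans (≤-reflexive (trans (sym (unc-seven j)) (sym (+-identityʳ _)))) (S.bound s₀))))

      A⊑ : ∀ j → A j ⊑ avail c (v j)
      A⊑ j = take-⊑ 6

      foot-far′ : ∀ k j → 2 ≤ k → suc k < g → ¬ Adj² G (u (k + j)) (v j)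
      foot-far′ k j 2≤ k< a = foot-far (g ∸ k) (k + j) (≤-trans (≤-reflexive (sym (m+n∸n≡m 2 k))) (∸-monoˡ-≤ k k<))
        (≤-trans (≤-reflexive (sym (+-∸-assoc 2 (<⇒≤ (<⇒≤ k<))))) (≤-trans (∸-monoʳ-≤ (2 + g) 2≤) ≤-refl))
        (subst (Adj² G (u (k + j))) (sym (proj₁ (complement (<⇒≤ k<) j))) a)

      far : ∀ k j → 0 < k → k ≤ 3 → ¬ Adj² G (u (k + j)) (u j)
      far k j a b = pendants-far k j a b ∘ Adj²-sym

      4<g : 4 < g
      4<g = 5≤g

      module Windows (j : ℕ) where
        vu : ∀ {a b} → v a ≢ u b
        vu {a} {b} e = u-off b a (sym e)
        d₁ = u-distinct 1 j (s≤s z≤n) (<-≤-trans (s≤s (s≤s z≤n)) 5≤g)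
        d₂ = u-distinct 2 j (s≤s z≤n) (<-≤-trans (s≤s (s≤s (s≤s z≤n))) 5≤g)
        d₃ = u-distinct 3 j (s≤s z≤n) (<-≤-trans (s≤s (s≤s (s≤s (s≤s z≤n)))) 5≤g)
        e₁ = u-distinct 1 (1 + j) (s≤s z≤n) (<-≤-trans (s≤s (s≤s z≤n)) 5≤g)
        e₂ = u-distinct 2 (1 + j) (s≤s z≤n) (<-≤-trans (s≤s (s≤s (s≤s z≤n))) 5≤g)
        f₁ = u-distinct 1 (2 + j) (s≤s z≤n) (<-≤-trans (s≤s (s≤s z≤n)) 5≤g)
        3<g : 3 < g
        3<g = <⇒≤ 4<g

        y₁∼u₀ = Adj²-sym (u∼next j)
        y₁∼u₁ = adj₁ (u-adj (1 + j))
        y₁∼u₂ : Adj² G (v (1 + j)) (u (2 + j))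
        y₁∼u₂ = Adj²-sym (subst (Adj² G (u (2 + j))) (prev-suc (1 + j)) (u∼prev (2 + j)))
        y₂∼u₁ = Adj²-sym (u∼next (1 + j))
        y₂∼u₂ = adj₁ (u-adj (2 + j))
        y₂∼u₃ : Adj² G (v (2 + j)) (u (3 + j))
        y₂∼u₃ = Adj²-sym (subst (Adj² G (u (3 + j))) (prev-suc (2 + j)) (u∼prev (3 + j)))
        y₁≁u₃ : ¬ Adj² G (v (1 + j)) (u (3 + j))
        y₁≁u₃ = foot-far′ 2 (1 + j) ≤-refl 3<g ∘ Adj²-sym
        y₂≁u₀ : ¬ Adj² G (v (2 + j)) (u j)
        y₂≁u₀ = foot-far 2 j ≤-refl 3<g ∘ Adj²-sym

        index : ∀ {w} → Unc c w → ∃[ k ] k < g × (w ≡ v (k + j) ⊎ w ≡ u (k + j))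
        index uw with R-cases (unc-R uw)
        ... | inj₁ (i , refl) = let (k , k< , e , _) = offset j i in k , k< , inj₁ e
        ... | inj₂ (i , refl) = let (k , k< , _ , e) = offset j i in k , k< , inj₂ e

        right-set left-set : List V
        right-set = u j ∷ u (1 + j) ∷ u (2 + j) ∷ u (3 + j) ∷ v (3 + j) ∷ []
        left-set = u (3 + j) ∷ u (2 + j) ∷ u (1 + j) ∷ u j ∷ v j ∷ []

        v∉right : ∀ {a} → v a ≢ v (3 + j) → v a ∉ right-set
        v∉right n (here e) = vu e
        v∉right n (there (here e)) = vu e
        v∉right n (there (there (here e))) = vu e
        v∉right n (there (there (there (here e)))) = vu e
        v∉right n (there (there (there (there (here e))))) = n e

        v∉left : ∀ {a} → v a ≢ v j → v a ∉ left-set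
        v∉left n (here e) = vu e
        v∉left n (there (here e)) = vu e
        v∉left n (there (there (here e))) = vu e
        v∉left n (there (there (there (here e)))) = vu e
        v∉left n (there (there (there (there (here e))))) = n e

        Pr Pl : V → Set
        Pr t = Unc c t × t ∉ right-set
        Pl t = Unc c t × t ∉ left-set

        y₁-r : Pr (v (1 + j))
        y₁-r = v-unc _ , v∉right (nb (1 + j))
        y₂-r : Pr (v (2 + j))
        y₂-r = v-unc _ , v∉right (Adj-≢ (link (2 + j)))
        y₁-l : Pl (v (1 + j))
        y₁-l = v-unc _ , v∉left (Adj-≢ (link j) ∘ sym)
        y₂-l : Pl (v (2 + j))
        y₂-l = v-unc _ , v∉left (nb j ∘ sym)

        v-r : ∀ {k} → 4 ≤ k → k ≤ g → Pr (v (k + j))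
        v-r {suc (suc (suc (suc k)))} _ k≤ = v-unc _ , v∉right (λ e → v-distinct (suc k) (3 + j) (s≤s z≤n)
          (≤-trans (s≤s (s≤s (≤-trans (n≤1+n k) (n≤1+n (suc k))))) k≤)
          (trans (sym e) (cong v (sym (trans (+-suc (suc k) (2 + j)) (cong suc (trans (+-suc (suc k) (suc j)) (cong suc (+-suc (suc k) j)))))))))

        v-r {suc zero} (s≤s ()) _
        v-r {suc (suc zero)} (s≤s (s≤s ())) _
        v-r {suc (suc (suc zero))} (s≤s (s≤s (s≤s ()))) _

        v₀-r : Pr (v j)
        v₀-r = v-unc _ , v∉right (v-distinct 3 j (s≤s z≤n) 3<g)

        ascend : ∀ d k → 4 ≤ k → k + d ≡ g → Path Pr (v (k + j)) (v (1 + j))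
        ascend zero k 4≤ e = subst (λ x → Path Pr x (v (1 + j))) (sym (trans (cong (λ k → v (k + j)) (trans (sym (+-identityʳ k)) e)) (per j)))
          (edge v₀-r (link j) (end y₁-r))
        ascend (suc d) k 4≤ e = edge (v-r 4≤ (≤-trans (m≤m+n k (suc d)) (≤-reflexive e))) (link (k + j))
          (ascend d (suc k) (≤-trans 4≤ (n≤1+n k)) (trans (sym (+-suc k d)) e))

        descend : ∀ k → 2 ≤ k → k < g → Path Pl (v (k + j)) (v (2 + j))
        descend 2 _ _ = end y₂-l
        descend (suc (suc (suc k))) _ k< = edge (v-unc _ , v∉left (v-distinct (3 + k) j (s≤s z≤n) k< ∘ sym))
          (Adj-sym (link (2 + k + j))) (descend (suc (suc k)) (s≤s (s≤s z≤n)) (<⇒≤ k<))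
        descend (suc zero) (s≤s ()) _

        -- Without `v (3 + j)` the loop becomes a path through all other feet, with the remaining
        -- pendants attached to it, so what is still uncoloured stays connected.
        right-paths : ∀ {w} → Unc c w → w ∉ right-set → Path Pr w (v (1 + j))
        right-paths uw w∉ = go (index uw) uw w∉
          where
          go : ∀ {w} → (∃[ k ] k < g × (w ≡ v (k + j) ⊎ w ≡ u (k + j))) → Unc c w → w ∉ right-set → Path Pr w (v (1 + j))
          go (0 , _ , inj₁ refl) _ _ = edge v₀-r (link j) (end y₁-r)
          go (1 , _ , inj₁ refl) _ _ = end y₁-r
          go (2 , _ , inj₁ refl) _ _ = edge y₂-r (Adj-sym (link (1 + j))) (end y₁-r)
          go (3 , _ , inj₁ refl) _ w∉ = contradiction (there (there (there (there (here refl))))) w∉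
          go (suc (suc (suc (suc k))) , k< , inj₁ refl) _ _ = ascend (g ∸ (4 + k)) (4 + k) (s≤s (s≤s (s≤s (s≤s z≤n)))) (m+[n∸m]≡n (<⇒≤ k<))
          go (0 , _ , inj₂ refl) _ w∉ = contradiction (here refl) w∉
          go (1 , _ , inj₂ refl) _ w∉ = contradiction (there (here refl)) w∉
          go (2 , _ , inj₂ refl) _ w∉ = contradiction (there (there (here refl))) w∉
          go (3 , _ , inj₂ refl) _ w∉ = contradiction (there (there (there (here refl)))) w∉
          go (suc (suc (suc (suc k))) , k< , inj₂ refl) uw w∉ = edge (uw , w∉) (Adj-sym (u-adj _))
            (ascend (g ∸ (4 + k)) (4 + k) (s≤s (s≤s (s≤s (s≤s z≤n)))) (m+[n∸m]≡n (<⇒≤ k<)))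

        left-paths : ∀ {w} → Unc c w → w ∉ left-set → Path Pl w (v (2 + j))
        left-paths uw w∉ = go (index uw) uw w∉
          where
          go : ∀ {w} → (∃[ k ] k < g × (w ≡ v (k + j) ⊎ w ≡ u (k + j))) → Unc c w → w ∉ left-set → Path Pl w (v (2 + j))
          go (0 , _ , inj₁ refl) _ w∉ = contradiction (there (there (there (there (here refl))))) w∉
          go (1 , _ , inj₁ refl) _ _ = edge y₁-l (link (1 + j)) (end y₂-l)
          go (suc (suc k) , k< , inj₁ refl) _ _ = descend (2 + k) (s≤s (s≤s z≤n)) k<
          go (0 , _ , inj₂ refl) _ w∉ = contradiction (there (there (there (here refl)))) w∉
          go (1 , _ , inj₂ refl) _ w∉ = contradiction (there (there (here refl))) w∉
          go (2 , _ , inj₂ refl) _ w∉ = contradiction (there (here refl)) w∉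
          go (3 , _ , inj₂ refl) _ w∉ = contradiction (here refl) w∉
          go (suc (suc (suc (suc k))) , k< , inj₂ refl) uw w∉ = edge (uw , w∉) (Adj-sym (u-adj _))
            (descend (4 + k) (s≤s (s≤s z≤n)) k<)

        no-right : ¬ Win (U j) (U (1 + j)) (U (2 + j)) (U (3 + j)) (A (1 + j)) (A (2 + j)) (A (3 + j))
        no-right = nd ∘ Play.win P s₀ (u-unc j) (u-unc (1 + j)) (u-unc (2 + j)) (u-unc (3 + j)) (v-unc (3 + j)) (v-unc (1 + j)) (v-unc (2 + j))
          ((d₁ ∷ d₂ ∷ d₃ ∷ u-off j (3 + j) ∷ []) ∷ (e₁ ∷ e₂ ∷ u-off (1 + j) (3 + j) ∷ []) ∷ (f₁ ∷ u-off (2 + j) (3 + j) ∷ []) ∷ (u-off (3 + j) (3 + j) ∷ []) ∷ [] ∷ [])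
          (proj₂ y₁-r) (proj₂ y₂-r)
          (pendants-far 1 j (s≤s z≤n) (s≤s z≤n)) (pendants-far 2 j (s≤s z≤n) (s≤s (s≤s z≤n))) (pendants-far 3 j (s≤s z≤n) ≤-refl)
          (pendants-far 1 (1 + j) (s≤s z≤n) (s≤s z≤n)) (pendants-far 2 (1 + j) (s≤s z≤n) (s≤s (s≤s z≤n)))
          (pendants-far 1 (2 + j) (s≤s z≤n) (s≤s z≤n))
          (foot-far 3 j (s≤s (s≤s z≤n)) 4<g) (foot-far 2 (1 + j) ≤-refl 3<g)
          (y₁∼u₀ ∷ y₁∼u₁ ∷ y₁∼u₂ ∷ adj₂ (nb (1 + j)) (link (1 + j)) (link (2 + j)) ∷ [])
          (y₂∼u₁ ∷ y₂∼u₂ ∷ y₂∼u₃ ∷ adj₁ (link (2 + j)) ∷ [])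
          y₁≁u₃ y₂≁u₀ (link (1 + j)) (≤-reflexive (unc-seven (1 + j))) (≤-reflexive (unc-seven (2 + j))) right-paths
          (six (1 + j)) (six (2 + j)) (A⊑ (1 + j)) (A⊑ (2 + j)) (A⊑ (3 + j))

        no-left : ¬ Win (U (3 + j)) (U (2 + j)) (U (1 + j)) (U j) (A (2 + j)) (A (1 + j)) (A j)
        no-left = nd ∘ Play.win P s₀ (u-unc (3 + j)) (u-unc (2 + j)) (u-unc (1 + j)) (u-unc j) (v-unc j) (v-unc (2 + j)) (v-unc (1 + j))
          (((f₁ ∘ sym) ∷ (e₂ ∘ sym) ∷ (d₃ ∘ sym) ∷ u-off (3 + j) j ∷ []) ∷ ((e₁ ∘ sym) ∷ (d₂ ∘ sym) ∷ u-off (2 + j) j ∷ []) ∷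
           ((d₁ ∘ sym) ∷ u-off (1 + j) j ∷ []) ∷ (u-off j j ∷ []) ∷ [] ∷ [])
          (proj₂ y₂-l) (proj₂ y₁-l)
          (far 1 (2 + j) (s≤s z≤n) (s≤s z≤n)) (far 2 (1 + j) (s≤s z≤n) (s≤s (s≤s z≤n))) (far 3 j (s≤s z≤n) ≤-refl)
          (far 1 (1 + j) (s≤s z≤n) (s≤s z≤n)) (far 2 j (s≤s z≤n) (s≤s (s≤s z≤n))) (far 1 j (s≤s z≤n) (s≤s z≤n))
          (foot-far′ 3 j (s≤s (s≤s z≤n)) 4<g) (foot-far′ 2 j ≤-refl 3<g)
          (y₂∼u₃ ∷ y₂∼u₂ ∷ y₂∼u₁ ∷ adj₂ (nb j ∘ sym) (Adj-sym (link (1 + j))) (Adj-sym (link j)) ∷ [])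
          (y₁∼u₂ ∷ y₁∼u₁ ∷ y₁∼u₀ ∷ adj₁ (Adj-sym (link j)) ∷ [])
          y₂≁u₀ y₁≁u₃ (Adj-sym (link (1 + j))) (≤-reflexive (unc-seven (2 + j))) (≤-reflexive (unc-seven (1 + j))) left-paths
          (six (2 + j)) (six (1 + j)) (A⊑ (2 + j)) (A⊑ (1 + j)) (A⊑ j)

        middle : Disjoint (U (1 + j)) (U (2 + j))
        middle = middle-disjoint (six (1 + j)) (six (2 + j)) no-right (two j) (two (3 + j)) (six (3 + j))

      -- Index 0 of `Window` is `2 + i`. On a loop of length five, `U₋` and `U₄` are the list of one
      -- and the same pendant, which `Window` permits.
      module W (i : ℕ) = Window (two (1 + i)) (two (2 + i)) (two (3 + i)) (two (4 + i)) (two (5 + i)) (two (6 + i))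
        (six (2 + i)) (six (3 + i)) (six (4 + i)) (six (5 + i))
        (Windows.no-right (2 + i)) (Windows.no-left (2 + i)) (Windows.no-left (3 + i)) (Windows.no-right (1 + i))
        (Windows.middle i) (Windows.middle (1 + i)) (Windows.middle (2 + i)) (Windows.middle (3 + i))

      disjoint₁ : ∀ j → Disjoint (U j) (U (1 + j))
      disjoint₁ j = subst₂ (λ x y → Disjoint (avail c x) (avail c y)) (proj₂ (shifted 1 j))
        (trans (cong u (cong suc (sym (+-suc (1 * p) j)))) (proj₂ (shifted 1 (1 + j)))) (Windows.middle (1 * p + j))

      disjoint₂ : ∀ j → Disjoint (U j) (U (2 + j))
      disjoint₂ j = subst₂ (λ x y → Disjoint (avail c x) (avail c y)) (proj₂ (shifted 3 j))
        (trans (cong u (cong (3 +_) (sym (trans (+-suc (3 * p) (suc j)) (cong suc (+-suc (3 * p) j)))))) (proj₂ (shifted 3 (2 + j))))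
        (W.U₁∩U₃ (3 * p + j))

      U⊑v : ∀ j → U j ⊑ avail c (v j)
      U⊑v j = subst₂ (λ x y → avail c x ⊑ avail c y) (proj₂ (shifted 4 j)) (proj₁ (shifted 4 j))
        (λ i → A⊑ (4 + (4 * p + j)) (W.U₂⊑A₂ (4 * p + j) i))

      abstract
        -- A colour of a pendant, to be given to its foot. It depends on the vertex and not on the
        -- index, so indices that differ by a multiple of `g` agree. The value 0 is junk: lists of
        -- pendants are not empty.
        β : V → ℕ
        β t with avail c t
        ... | [] = 0
        ... | q ∷ _ = q

        β∈ : ∀ j → β (u j) ∈ U j
        β∈ j with avail c (u j) | two j
        ... | [] | _ , _ , () , _
        ... | q ∷ _ | _ = here refl

      -- Loop vertices adjacent in G² are one or two steps apart, and there the lists of the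
      -- pendants are disjoint.
      β-near : ∀ i {j} → Adj² G (v (2 + i)) (v j) → β (u (2 + i)) ≢ β (u j)
      β-near i {j} a e = go (around-all i a (v-unc j))
        where
        go : v j ∈ around i → ⊥
        go (here q) = disjoint₂ i (subst (_∈ U i) (trans (cong β (same-foot {i} {j} (sym q))) (sym e)) (β∈ i)) (β∈ (2 + i))
        go (there (here q)) = disjoint₁ (1 + i) (subst (_∈ U (1 + i)) (trans (cong β (same-foot {1 + i} {j} (sym q))) (sym e)) (β∈ (1 + i))) (β∈ (2 + i))
        go (there (there (here q))) = disjoint₁ (2 + i) (β∈ (2 + i)) (subst (_∈ U (3 + i)) (trans (cong β (same-foot {3 + i} {j} (sym q))) (sym e)) (β∈ (3 + i)))
        go (there (there (there (here q)))) = disjoint₂ (2 + i) (β∈ (2 + i)) (subst (_∈ U (4 + i)) (trans (cong β (same-foot {4 + i} {j} (sym q))) (sym e)) (β∈ (4 + i)))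
        go (there (there (there (there (here q))))) = u-off _ _ (sym q)
        go (there (there (there (there (there (here q)))))) = u-off _ _ (sym q)
        go (there (there (there (there (there (there (here q))))))) = u-off _ _ (sym q)

      β-distinct : ∀ {i j} → Adj² G (v i) (v j) → β (u i) ≢ β (u j)
      β-distinct {i} {j} a e = β-near (2 * p + i) {j} (subst (λ x → Adj² G x (v j)) (sym (proj₁ (shifted 2 i))) a)
        (trans (cong β (proj₂ (shifted 2 i))) e)

      as : Assignment
      as = map (λ x → v (x + 0) , β (u (x + 0))) (upTo g)

      as⁻ : ∀ {t q} → (t , q) ∈ as → ∃[ j ] t ≡ v j × q ≡ β (u j)
      as⁻ i with ∈-map⁻ (λ x → v (x + 0) , β (u (x + 0))) i
      ... | x , _ , refl = _ , refl , refl

      dom⁺ : ∀ j → v j ∈ dom as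
      dom⁺ j with offset 0 j
      ... | k , k< , e , _ = subst (_∈ dom as) (sym e) (∈-map⁺ proj₁ (∈-map⁺ (λ x → v (x + 0) , β (u (x + 0))) (∈-upTo⁺ k<)))

      asg : Asg c as
      asg = go (Unique.upTo⁺ g) ∈-upTo⁻
        where
        f : ℕ → V × ℕ
        f x = v (x + 0) , β (u (x + 0))
        go : ∀ {xs} → Unique xs → (∀ {x} → x ∈ xs → x < g) → Asg c (map f xs)
        go [] _ = []
        go {x ∷ xs} (x∉ ∷ q) b = (v-unc _ ,
            (λ i → let (s , s∈ , e) = ∈-map⁻ proj₁ i ; (y , y∈ , e′) = ∈-map⁻ f s∈ in
               All.lookup x∉ y∈ (v-inj (b (here refl)) (b (there y∈)) (trans e (cong proj₁ e′)))) ,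
            U⊑v _ (β∈ _) ,
            (λ i a → let (y , y∈ , e) = ∈-map⁻ f i in λ q≡ →
               β-distinct (subst (Adj² G (v (x + 0))) (cong proj₁ e) a) (trans q≡ (cong proj₂ e)))) ∷ go q (b ∘ there)

      c′ : PC
      c′ = upd c as

      hits : ∀ j {t q} → q ∈ U j → (t , q) ∈ as → Adj² G (u j) t → q ∈ β (u j) ∷ []
      hits j q∈ i a with as⁻ i
      ... | x , refl , refl = cases (offset j x)
        where
        via : ∀ {k} → u x ≡ u k → β (u x) ∈ U k
        via {k} e = subst (_∈ U k) (cong β (sym e)) (β∈ k)
        cases : (∃[ k ] k < g × v x ≡ v (k + j) × u x ≡ u (k + j)) → β (u x) ∈ β (u j) ∷ []
        cases (0 , _ , _ , e) = here (cong β e)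
        cases (1 , _ , _ , e) = contradiction (via e) (disjoint₁ j q∈)
        cases (suc (suc k) , k< , e , e′) with suc (suc k) ≟ p
        ... | yes refl = contradiction q∈ (λ q∈ → disjoint₁ (p + j) (via e′) (subst (λ t → β (u x) ∈ avail c t) (sym (u-per j)) q∈))
        ... | no ne = contradiction (subst (Adj² G (u j)) e a) (foot-far (suc (suc k)) j (s≤s (s≤s z≤n)) (s≤s (≤∧≢⇒< (≤-pred k<) ne)))

      -- Three square-neighbours are coloured, but only `β (u j)` is lost, because the colours of
      -- the other two come from lists disjoint from that of `u j`. With slack 2 the pendants can be
      -- coloured last, in any order.
      slack : ∀ j → S c′ (u j) 2
      slack j = upd-S c as (v j ∷ prev j ∷ v (1 + j) ∷ []) (β (u j) ∷ []) (avail-unique c (u j)) id (hits j) (feet₃ j)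
        (λ { i@(here refl) → dom⁺ j , v-unc j , proj₁ (feet₃-near j i)
           ; i@(there (here refl)) → dom⁺ (p + j) , v-unc (p + j) , proj₁ (feet₃-near j i)
           ; i@(there (there (here refl))) → dom⁺ (1 + j) , v-unc (1 + j) , proj₁ (feet₃-near j i) })
        (≤-trans (≤-reflexive (trans (+-assoc (length (unc c (u j))) 2 1) (cong (_+ 3) (sym (+-identityʳ _))))) (+-monoˡ-≤ 3 (S.bound s₀)))

      order : ∀ {xs} → Unique xs → (∀ {x} → x ∈ xs → x < g) → Order c′ [] (map (λ x → u (x + 0)) xs)
      order [] _ = []
      order {x ∷ xs} (x∉ ∷ q) b = step 2 []
        (upd-unc c as (u-unc (x + 0)) (λ i → let (s , s∈ , e) = ∈-map⁻ proj₁ i ; (k , e′ , _) = as⁻ s∈ in u-off (x + 0) k (trans e e′)))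
        (λ i → let (y , y∈ , e) = ∈-map⁻ (λ x → u (x + 0)) i in All.lookup x∉ y∈ (u-inj (b (here refl)) (b (there y∈)) e))
        (λ ()) [] (λ ()) (slack (x + 0)) ≤-refl (order q (b ∘ there))

      done : Done
      done = finish (upd-proper P asg) (order (Unique.upTo⁺ g) ∈-upTo⁻) last
        where
        last : ∀ {t} → Unc c′ t → t ∈ pendants
        last ut with upd-none c as ut
        ... | ut′ , t∉ with R-cases (unc-R ut′)
        ...   | inj₁ (j , refl) = contradiction (dom⁺ j) t∉
        ...   | inj₂ (j , refl) = u∈pendants j

    absurd : ⊥
    absurd = let (c , P , f , h , mono) = outside R R-unique (v 0) (∈-++⁺ˡ (v∈feet 0)) R-nb in
      nd (Coloured.done {c} P f h (λ {w} → mono (S₀ {w})))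

  -- Strong induction on the length supplies the hypothesis that the loop is shortest.
  no-loop : ¬ Done → ∀ g → ¬ Loop g
  no-loop nd = <-rec _ step′
    where
    step′ : ∀ g → (∀ {m} → m < g → ¬ Loop m) → ¬ Loop g
    step′ zero _ lp = contradiction (Loop.1≤g lp) λ ()
    step′ (suc p) shortest lp = Rigid.absurd p lp nd shortest

-- Graphs with a vertex of degree at most two

module LowDegree {n} (G : Graph n) (L : Fin n → List ℕ) (uL : ∀ v → Unique (L v)) (len : ∀ v → length (L v) ≡ 8)
                 (conn : Connected G) (deg : MaxDegreeAtMost G 3) where
  open Subcubic G L uL len conn deg

  sum-< : ∀ {A : Set} (f : A → ℕ) k xs → (∀ {x} → x ∈ xs → f x ≤ k) → ∀ {y} → y ∈ xs → f y < k → sum (map f xs) < length xs * k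
  sum-< f k (x ∷ xs) le (here refl) lt = +-mono-≤ lt (sum-≤ f k xs (le ∘ there))
  sum-< f k (x ∷ xs) le (there y∈) lt = ≤-trans (≤-reflexive (sym (+-suc (f x) _))) (+-mono-≤ (le (here refl)) (sum-< f k xs (le ∘ there) y∈ lt))

  -- `v` has at most 2 + 4 square-neighbours, which leaves room for slack 2; a neighbour `w` has at
  -- most 3 + 1 + 2 + 2, which gives slack 1. If there is no neighbour, `v` is the whole graph.
  low-degree : ∀ v → degree G v ≤ 2 → Done
  low-degree v d = go (N v) refl
    where
    slack-v : S ∅ v 2
    slack-v = ∅-slack (+-monoˡ-≤ 2 {y = 7} (≤-trans (ball v) (≤-trans
      (+-mono-≤ d (≤-trans (sum-≤ _ 2 (N v) (N-but-length ∘ N⁻)) (*-monoˡ-≤ 2 d))) (n≤1+n 6))))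
    go : ∀ xs → xs ≡ N v → Done
    go [] e = finish ∅-proper (step {ws = []} 2 [] refl (λ ()) (λ ()) [] (λ ()) slack-v ≤-refl []) (λ {t} _ → here (alone (conn v t)))
      where
      alone : ∀ {t} → Walk G v t → t ≡ v
      alone here = refl
      alone (step a _) = contradiction (subst (_ ∈_) (sym e) (N⁺ a)) λ ()
    go (w ∷ _) e = endgame ∅-proper (Adj-sym a) refl refl slack-w slack-v (λ _ → S₀) (λ _ → walk-path (conn _ _))
      where
      a : Adj G v w
      a = N⁻ (subst (w ∈_) e (here refl))
      slack-w : S ∅ w 1
      slack-w = ∅-slack (+-monoˡ-≤ 1 {y = 8} (≤-trans (ball w) (≤-pred (≤-trans (≤-reflexive (sym (+-suc (length (N w)) _)))
        (+-mono-≤ (deg w) (≤-trans (sum-< _ 2 (N w) (N-but-length ∘ N⁻) (N⁺ (Adj-sym a)) small) (*-monoˡ-≤ 2 (deg w))))))))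
        where
        small : length (N-but w v) < 2
        small = ≤-trans (filter-notAll (λ u → ¬? (u Fin.≟ w)) (N v) (Any.map (λ { refl ne → ne refl }) (N⁺ a))) d

theorem1 : {n : ℕ} (G : Graph n) → Connected G → MaxDegreeAtMost G 3 →
    ¬ Isomorphic G Petersen → Square-Choosable G 8
theorem1 {n} G conn deg notP (L , LA) with Fin.any? (λ v → degree G v ≤? 2)
... | yes (v , d) = LowDegree.low-degree G L (proj₁ ∘ LA) (proj₂ ∘ LA) conn deg v d
-- If there were no colouring, any vertex would lead to a loop, and loops are impossible; so there
-- is no vertex, and the empty colouring gives the contradiction.
... | no none = decidable-stable Done? λ nd → nd (trivial (λ r → let (g , lp) = exists-loop r in no-loop nd g lp))
  where
  cubic : ∀ v → degree G v ≡ 3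
  cubic v = ≤-antisym (deg v) (≰⇒> (λ d → none (v , d)))
  open Cubic G L (proj₁ ∘ LA) (proj₂ ∘ LA) conn cubic notP
  trivial : ¬ Fin n → Done
  trivial empty = ⊥-elim ∘ empty , (⊥-elim ∘ empty) , λ u → ⊥-elim (empty u)
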